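{- Let $G$ be a finite graph, let $\sigma=(\sigma_v)_{v\in V(G)}$ be a choice of linear orderings of the half-edges at each vertex, and let $\Delta=(\Delta_v)_{v\in V(G)}$ be a choice of orientations of the gadgets $\Gamma_v$ of the blow-up $G^\sigma$. Let $c_{\sigma,\Delta}(G)$ be the minimal cardinality $k$ of a set $\{D_1,\dots,D_k\}$ of $\Delta$-admissible orientations of $G^\sigma$ such that the even subgraph polynomial $\mathcal E_G(x)$ is a linear combination, with rational coefficients, of the $\sigma$-projected Pfaffians $F^\sigma_{D_1}(x),\dots,F^\sigma_{D_k}(x)$. Then $c_{\sigma,\Delta}(G)$ is a power of $4$.
   Context: Graphs are finite and unoriented; loops and multiple edges are allowed. An indeterminate $x_e$ is attached to every edge $e$. A set $E'\subseteq E(G)$ is even if every vertex has even (possibly zero) degree in $(V(G),E')$; $\mathcal E(G)$ is the set of even subsets and $\mathcal E_G(x)=\sum_{E'\in\mathcal E(G)}\prod_{e\in E'}x_e\in\mathbb Z[(x_e)_{e\in E(G)}]$. For a graph $\Gamma$ with vertices numbered $1,\dots,n$ and an orientation $D$ of $\Gamma$, $A(\Gamma,D)$ is the skew-symmetric $n\times n$ matrix with zero diagonal and off-diagonal entries $A_{ij}=\sum\pm x_e$, the sum over edges $e$ joining $i$ and $j$, with sign $+1$ if $e$ is oriented from $i$ to $j$ in $D$ and $-1$ otherwise; $\operatorname{Pfaf}$ denotes the Pfaffian. Blow-up: for each vertex $v$ of degree $d$ (a loop contributes two half-edges), $\sigma_v$ is a linear ordering $h_1,\dots,h_d$ of the half-edges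 at $v$. The graph $G^\sigma$ is obtained by replacing each vertex $v$ by $6d$ new vertices $v_1,\dots,v_{6d}$ with edges $v_iv_{i+1}$ ($1\le i\le 6d-1$) and $v_{3j-2}v_{3j}$ ($1\le j\le 2d$); this subgraph is the gadget $\Gamma_v$. Each edge $e$ of $G$ whose half-edges are the $i$-th half-edge at $v$ and the $i'$-th half-edge at $u$ ($u=v$ allowed) becomes an edge of $G^\sigma$ joining $v_{6i-4}$ and $u_{6i'-4}$, still denoted $e$; thus $E(G^\sigma)$ is the disjoint union of $E(G)$ and the $E(\Gamma_v)$. Fix a numbering of the vertices of $G^\sigma$. For an orientation $D$ of $G^\sigma$, the $\sigma$-projected Pfaffian is $F^\sigma_D(x)=\operatorname{Pfaf}\big(A(G^\sigma,D)\big)$ with $x_e=1$ substituted for all $e\in E(G^\sigma)\setminus E(G)$; it is a polynomial in $(x_e)_{e\in E(G)}$. An orientation $D$ of $G^\sigma$ is $\Delta$-admissible if its restriction to every gadget $\Gamma_v$ is $\Delta_v$. -}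

module Defs where

open import Data.Bool using (Bool; true; false; if_then_else_; _∧_)
open import Data.Nat using (ℕ; zero; suc; _+_; _*_; _∸_; _%_; _≡ᵇ_; _^_; _≤_)
import Data.Nat as ℕ
open import Data.Fin using (Fin; zero; suc; toℕ; punchIn)
import Data.Fin as Fin
open import Data.Vec using (Vec; []; _∷_; lookup; zipWith; replicate; tabulate)
open import Data.Vec.Properties using (≡-dec)
open import Data.List using (List; []; _∷_; map; concatMap; foldr; upTo; allFin)
open import Data.Product using (Σ; _×_; _,_; proj₁; proj₂; ∃)
open import Data.Sum using (_⊎_; inj₁; inj₂)
open import Data.Rational using (ℚ; 0ℚ; 1ℚ)
import Data.Rational as ℚ
open import Relation.Nullary using (¬_; does)
open import Relation.Binary.PropositionalEquality using (_≡_; _≢_)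
open import Function.Bundles using (_↔_; Inverse)

-- Polynomials with rational coefficients in variables x_0 … x_{m-1},
-- represented by their coefficient function on exponent vectors.

Mono : ℕ → Set
Mono m = Vec ℕ m

Poly : ℕ → Set
Poly m = Mono m → ℚ

_≈P_ : ∀ {m} → Poly m → Poly m → Set
p ≈P q = ∀ α → p α ≡ q α

monoEq : ∀ {m} → Mono m → Mono m → Bool
monoEq α β = does (≡-dec ℕ._≟_ α β)

0P : ∀ {m} → Poly m
0P _ = 0ℚ

monoP : ∀ {m} → Mono m → Poly m
monoP β α = if monoEq α β then 1ℚ else 0ℚ

1P : ∀ {m} → Poly m
1P {m} = monoP (replicate m 0)

varP : ∀ {m} → Fin m → Poly m
varP {m} e = monoP (tabulate λ i → if does (i Fin.≟ e) then 1 else 0)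

_+P_ : ∀ {m} → Poly m → Poly m → Poly m
(p +P q) α = p α ℚ.+ q α

-P_ : ∀ {m} → Poly m → Poly m
(-P p) α = ℚ.- (p α)

_·P_ : ∀ {m} → ℚ → Poly m → Poly m
(c ·P p) α = c ℚ.* p α

below : ∀ {m} → Mono m → List (Mono m)
below [] = [] ∷ []
below (a ∷ α) = concatMap (λ k → map (k ∷_) (below α)) (upTo (suc a))

sumℚ : List ℚ → ℚ
sumℚ = foldr ℚ._+_ 0ℚ

_*P_ : ∀ {m} → Poly m → Poly m → Poly m
(p *P q) α = sumℚ (map (λ β → p β ℚ.* q (zipWith _∸_ α β)) (below α))

sumFinP : ∀ {m} (k : ℕ) → (Fin k → Poly m) → Poly m
sumFinP zero f = 0P
sumFinP (suc k) f = f zero +P sumFinP k (λ i → f (suc i))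

sumListP : ∀ {m} → List (Poly m) → Poly m
sumListP = foldr _+P_ 0P

-- Pfaffian of a (skew-symmetric) k×k matrix over the polynomial ring,
-- by expansion along the first row:
--   Pf(A) = Σ_{j=2}^{k} (-1)^j a_{1j} Pf(A with rows/cols 1, j removed)
-- (1-based), Pf of the empty matrix = 1, Pf of a 1×1 matrix = 0.

Pf : ∀ {m k} → (Fin k → Fin k → Poly m) → Poly m
Pf {m} {zero} A = 1P
Pf {m} {suc zero} A = 0P
Pf {m} {suc (suc k)} A =
  sumFinP (suc k) λ j →
    (if (toℕ j % 2) ≡ᵇ 0 then (λ p → p) else -P_)
      (A zero (suc j) *P Pf (λ a b → A (suc (punchIn j a)) (suc (punchIn j b))))

-- Finite graphs with loops and multiple edges.
-- Edge e has two half-edges (e , 0) and (e , 1); 'end e k' is the vertex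
-- carrying half-edge (e , k).  A loop has end e 0 ≡ end e 1.

record Graph : Set where
  field
    nV  : ℕ
    nE  : ℕ
    end : Fin nE → Fin 2 → Fin nV
open Graph public

countFin : (k : ℕ) → (Fin k → Bool) → ℕ
countFin zero f = 0
countFin (suc k) f = (if f zero then 1 else 0) + countFin k (λ i → f (suc i))

sumFinℕ : (k : ℕ) → (Fin k → ℕ) → ℕ
sumFinℕ zero f = 0
sumFinℕ (suc k) f = f zero + sumFinℕ k (λ i → f (suc i))

halfAt : (G : Graph) → Fin (nE G) → Fin (nV G) → ℕ
halfAt G e v = countFin 2 (λ k → does (end G e k Fin.≟ v))

deg : (G : Graph) → Fin (nV G) → ℕ
deg G v = sumFinℕ (nE G) (λ e → halfAt G e v)

-- σ: for each vertex v a linear ordering of the half-edges at v, i.e. a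
-- bijection between the half-edges at v and {0,…,deg v − 1}
-- (position 0 = first half-edge h_1).
record HalfEdgeOrdering (G : Graph) : Set where
  field
    pos  : (e : Fin (nE G)) (k : Fin 2) → Fin (deg G (end G e k))
    inj  : ∀ e k e' k' → end G e k ≡ end G e' k' →
             toℕ (pos e k) ≡ toℕ (pos e' k') → (e , k) ≡ (e' , k')
    surj : ∀ v (i : Fin (deg G v)) →
             Σ (Fin (nE G)) λ e → Σ (Fin 2) λ k →
               (end G e k ≡ v) × (toℕ (pos e k) ≡ toℕ i)
open HalfEdgeOrdering public

-- The blow-up G^σ.  Vertex v_i (1 ≤ i ≤ 6d) of G^σ is encoded by the
-- label (v , i − 1).

BVert : Graph → Set
BVert G = Σ (Fin (nV G)) λ v → Fin (6 * deg G v)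

label : (G : Graph) → BVert G → Fin (nV G) × ℕ
label G (v , i) = v , toℕ i

-- edges of the gadget Γ_v (d = deg v):
--   inj₁ j : v_{j+1} v_{j+2}      (0 ≤ j ≤ 6d − 2)
--   inj₂ j : v_{3j+1} v_{3j+3}    (0 ≤ j ≤ 2d − 1)
GadgetEdge : (G : Graph) → Fin (nV G) → Set
GadgetEdge G v = Fin (6 * deg G v ∸ 1) ⊎ Fin (2 * deg G v)

gadgetEnd : (G : Graph) (v : Fin (nV G)) → GadgetEdge G v → Fin 2 → Fin (nV G) × ℕ
gadgetEnd G v (inj₁ j) zero    = v , toℕ j
gadgetEnd G v (inj₁ j) (suc _) = v , suc (toℕ j)
gadgetEnd G v (inj₂ j) zero    = v , 3 * toℕ j
gadgetEnd G v (inj₂ j) (suc _) = v , 3 * toℕ j + 2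

BEdge : Graph → Set
BEdge G = Fin (nE G) ⊎ Σ (Fin (nV G)) (GadgetEdge G)

-- an edge e of G whose k-th half-edge is the i-th half-edge (1-based) at v
-- is attached to v_{6i−4}, i.e. label (v , 6 (i−1) + 1)
bEnd : (G : Graph) → HalfEdgeOrdering G → BEdge G → Fin 2 → Fin (nV G) × ℕ
bEnd G σ (inj₁ e) k = end G e k , 6 * toℕ (pos σ e k) + 1
bEnd G σ (inj₂ (v , g)) k = gadgetEnd G v g k

bWeight : (G : Graph) → BEdge G → Poly (nE G)
bWeight G (inj₁ e) = varP e
bWeight G (inj₂ _) = 1P

-- orientations: true = oriented from endpoint 0 to endpoint 1
Orientation : Graph → Set
Orientation G = BEdge G → Bool

GadgetOrientations : Graph → Set
GadgetOrientations G = (v : Fin (nV G)) → GadgetEdge G v → Bool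

Admissible : (G : Graph) → GadgetOrientations G → Orientation G → Set
Admissible G Δ D = ∀ v g → D (inj₂ (v , g)) ≡ Δ v g

labelEq : {n : ℕ} → Fin n × ℕ → Fin n × ℕ → Bool
labelEq (v , i) (w , j) = does (v Fin.≟ w) ∧ does (i ℕ.≟ j)

sumBEdge : (G : Graph) → (BEdge G → Poly (nE G)) → Poly (nE G)
sumBEdge G f =
  sumFinP (nE G) (λ e → f (inj₁ e)) +P
  sumFinP (nV G) (λ v →
    sumFinP (6 * deg G v ∸ 1) (λ j → f (inj₂ (v , inj₁ j))) +P
    sumFinP (2 * deg G v) (λ j → f (inj₂ (v , inj₂ j))))

-- A(G^σ, D) with x_e := 1 for gadget edges, w.r.t. the numbering num
Amat : (G : Graph) (σ : HalfEdgeOrdering G) (N : ℕ) (num : Fin N ↔ BVert G) →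
       Orientation G → Fin N → Fin N → Poly (nE G)
Amat G σ N num D i j =
  if does (i Fin.≟ j) then 0P else
  sumBEdge G λ e →
    let a = bEnd G σ e zero
        b = bEnd G σ e (suc zero)
        t = if D e then a else b
        h = if D e then b else a
        li = label G (Inverse.to num i)
        lj = label G (Inverse.to num j)
    in if labelEq t li ∧ labelEq h lj then bWeight G e
       else if labelEq t lj ∧ labelEq h li then -P (bWeight G e)
       else 0P

projPf : (G : Graph) (σ : HalfEdgeOrdering G) (N : ℕ) (num : Fin N ↔ BVert G) →
         Orientation G → Poly (nE G)
projPf G σ N num D = Pf (Amat G σ N num D)

allSubsets : (m : ℕ) → List (Vec Bool m)
allSubsets zero = [] ∷ []
allSubsets (suc m) = concatMap (λ b → map (b ∷_) (allSubsets m)) (true ∷ false ∷ [])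

subsetDeg : (G : Graph) → Vec Bool (nE G) → Fin (nV G) → ℕ
subsetDeg G S v = sumFinℕ (nE G) λ e → if lookup S e then halfAt G e v else 0

isEven : (G : Graph) → Vec Bool (nE G) → Bool
isEven G S = foldr _∧_ true (map (λ v → (subsetDeg G S v % 2) ≡ᵇ 0) (allFin (nV G)))

subsetMono : ∀ {m} → Vec Bool m → Mono m
subsetMono [] = []
subsetMono (b ∷ S) = (if b then 1 else 0) ∷ subsetMono S

evenPoly : (G : Graph) → Poly (nE G)
evenPoly G = sumListP (map (λ S → if isEven G S then monoP (subsetMono S) else 0P)
                           (allSubsets (nE G)))

Representable : (G : Graph) (σ : HalfEdgeOrdering G) (Δ : GadgetOrientations G)
                (N : ℕ) (num : Fin N ↔ BVert G) (k : ℕ) → Set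
Representable G σ Δ N num k =
  Σ (Fin k → Orientation G) λ Ds →
    (∀ i → Admissible G Δ (Ds i)) ×
    (∀ i j → i ≢ j → ¬ (∀ e → Ds i e ≡ Ds j e)) ×
    Σ (Fin k → ℚ) λ c →
      evenPoly G ≈P sumFinP k (λ i → c i ·P projPf G σ N num (Ds i))

IsMinRepSize : (G : Graph) (σ : HalfEdgeOrdering G) (Δ : GadgetOrientations G)
               (N : ℕ) (num : Fin N ↔ BVert G) (c : ℕ) → Set
IsMinRepSize G σ Δ N num c =
  Representable G σ Δ N num c × (∀ k → Representable G σ Δ N num k → c ≤ k)

{-# OPTIONS --safe #-}

-- The coefficient of x^S in a projected Pfaffian is nonzero iff S is an even subset, because exactly the even S
-- extend to a perfect matching of the blow-up, and they do so uniquely. The coefficient is (-1)^(Q(S) + o·S),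
-- where o records the orientation on the edges of G. Up to a constant, Q(S) counts the inversions of the word
-- listing the matched pairs and the gadget edges against the orientation. The word can be arranged so that each
-- letter occurs under a condition affine in S, and the gadget edges used in a block of six vertices depend on
-- two bits affine in S; hence Q is quadratic. If the polar form of Q has rank 2t on even sets, splitting off
-- hyperbolic planes gives Q = L + Σ λᵢμᵢ there with L affine, and the t-fold Gauss sum shows that exactly 4^t
-- characters occur in the Fourier expansion of (-1)^Q.
module Submission where

open import Defs
open import Data.Bool using (Bool; T; true; false; if_then_else_; _∧_; not; _xor_)
open import Data.Nat using (ℕ; zero; suc; _^_; _≤_; _<_; _%_; _≡ᵇ_)
import Data.Nat as ℕ
import Data.Nat.Properties as ℕ
import Data.Nat.DivMod as ℕ
open import Data.Fin using (Fin; zero; suc; toℕ; punchIn; fromℕ<; _↑ˡ_; _↑ʳ_; combine; remQuot)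
import Data.Fin as Fin
import Data.Fin.Properties as Fin
open import Data.Vec using (Vec; []; _∷_; zipWith; replicate; lookup)
import Data.Vec as Vec
import Data.Vec.Properties as Vec
open import Data.List using (List; []; _∷_; map; concatMap; _++_; foldr; tabulate; upTo; allFin; length)
import Data.List as List
import Data.List.Properties as List
open import Data.List.Membership.Propositional using (_∈_; find; lose)
open import Data.List.Membership.Propositional.Properties
  using (∈-++⁺ˡ; ∈-++⁺ʳ; ∈-map⁺; ∈-map⁻; ∈-∃++; ∈-tabulate⁺; ∈-tabulate⁻; ∈-allFin; ∈-upTo⁺; ∈-upTo⁻;
         ∈-concatMap⁺; ∈-concatMap⁻; ∈-cartesianProductWith⁺; ∈-cartesianProductWith⁻)
open import Data.List.Relation.Unary.All using (All; []; _∷_)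
import Data.List.Relation.Unary.All as All
import Data.List.Relation.Unary.All.Properties as All
open import Data.List.Relation.Unary.AllPairs using ([]; _∷_)
open import Data.List.Relation.Unary.Any using (here; there)
open import Data.List.Relation.Unary.Unique.Propositional using (Unique)
import Data.List.Relation.Unary.Unique.Propositional.Properties as Unique
open import Data.List.Relation.Binary.Permutation.Propositional using (_↭_; ↭-refl; ↭-sym; ↭-trans; ↭-prep; ↭-swap; ↭-reflexive; ↭⇒↭ₛ)
import Data.List.Relation.Binary.Permutation.Propositional as Perm
import Data.List.Relation.Binary.Permutation.Propositional.Properties as Perm
import Data.List.Relation.Binary.Permutation.Setoid.Properties as PermSetoid
open import Data.List.Relation.Binary.BagAndSetEquality using (∼bag⇒↭)
open import Data.List.Membership.Propositional.Properties.WithK using (unique∧set⇒bag)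
open import Data.Product using (Σ; _×_; _,_; proj₁; proj₂)
import Data.Product.Properties as Product
open import Data.Sum using (_⊎_; inj₁; inj₂)
open import Data.Empty using (⊥; ⊥-elim)
open import Data.Rational using (ℚ; 0ℚ; 1ℚ; ½)
import Data.Rational as ℚ
import Data.Rational.Properties as ℚ
open import Data.Nat.Solver using () renaming (module +-*-Solver to +-*-Solverℕ)
open import Data.Rational.Solver using (module +-*-Solver)
open import Function.Bundles using (_↔_; Inverse; mk⇔)
open import Function using (_∘_)
open import Relation.Nullary using (¬_; Dec; does; yes; no; contradiction)
open import Relation.Nullary.Decidable using (dec-true; dec-false; does-⇔)
open import Relation.Binary.PropositionalEquality
  using (_≡_; _≢_; refl; sym; trans; cong; cong₂; subst; subst₂; module ≡-Reasoning)
import Relation.Binary.PropositionalEquality as ≡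

-- Comparing coefficients of x^S turns a representation into 1 = sum of c_i (-1)^(Q(S) + o_i·S) over
-- even S, that is, an expansion of (-1)^Q in characters of the even space. Every o comes from an
-- admissible orientation, but different o may agree on even sets, so the lower bound must separate
-- characters by their values there. It does so on a complement of the radical, the image of a
-- section of the hyperbolic coordinates, where each Fourier coefficient is a nonvanishing Gauss
-- sum. Conversely the 4^t characters live on the even space and must be extended to all edge sets
-- before they define orientations. Two obstacles shape the Pfaffian half. Matrix entries are sums
-- over edges, so cancellation must be excluded: uniqueness of the matching of a given weight is
-- carried through the row expansion. And Q must be seen to be quadratic for all S at once, hence
-- one fixed word with conditional letters. The six vertices per half-edge are two triangles. A
-- triangle passes on the negation of incoming bit plus external bit; the second one has no external
-- edge and undoes the negation, so the bit leaving the last block is the degree parity.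

-- Boolean identities by truth table

BoolFun : ℕ → Set
BoolFun zero = Bool
BoolFun (suc n) = Bool → BoolFun n

agree : ∀ n → BoolFun n → BoolFun n → Bool
agree zero a b = not (a xor b)
agree (suc n) f g = agree n (f false) (g false) ∧ agree n (f true) (g true)

Pointwise : ∀ n → BoolFun n → BoolFun n → Set
Pointwise zero a b = a ≡ b
Pointwise (suc n) f g = ∀ x → Pointwise n (f x) (g x)

∧-trueˡ : ∀ {a b} → a ∧ b ≡ true → a ≡ true
∧-trueˡ {true} _ = refl

∧-trueʳ : ∀ {a b} → a ∧ b ≡ true → b ≡ true
∧-trueʳ {true} p = p

-- Proof by reflection: `agree` tests all 2^n arguments and computes on closed functions, so `refl`
-- discharges the hypothesis. Most Boolean identities below are settled this way, with the actual
-- terms put in for the variables.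
tautology : ∀ n (f g : BoolFun n) → agree n f g ≡ true → Pointwise n f g
tautology zero true true _ = refl
tautology zero false false _ = refl
tautology (suc n) f g p false = tautology n (f false) (g false) (∧-trueˡ p)
tautology (suc n) f g p true = tautology n (f true) (g true) (∧-trueʳ {agree n (f false) (g false)} p)

false≢true : ∀ {A : Set} {b} → b ≡ false → b ≡ true → A
false≢true refl ()

xor-move : ∀ {a b c} → a xor b ≡ c → a ≡ c xor b
xor-move {a} {b} refl = tautology 2 (λ a b → a) (λ a b → (a xor b) xor b) refl a b

-- The vector space F₂ᵐ

_⊕_ : ∀ {m} → Vec Bool m → Vec Bool m → Vec Bool m
_⊕_ = zipWith _xor_

infixl 6 _⊕_

𝟎 : ∀ {m} → Vec Bool m
𝟎 {m} = replicate m false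

scale : ∀ {m} → Bool → Vec Bool m → Vec Bool m
scale c x = if c then x else 𝟎

⊕-comm : ∀ {m} (x y : Vec Bool m) → x ⊕ y ≡ y ⊕ x
⊕-comm [] [] = refl
⊕-comm (a ∷ x) (b ∷ y) = cong₂ _∷_ (tautology 2 _xor_ (λ a b → b xor a) refl a b) (⊕-comm x y)

⊕-assoc : ∀ {m} (x y z : Vec Bool m) → (x ⊕ y) ⊕ z ≡ x ⊕ (y ⊕ z)
⊕-assoc [] [] [] = refl
⊕-assoc (a ∷ x) (b ∷ y) (c ∷ z) =
  cong₂ _∷_ (tautology 3 (λ a b c → (a xor b) xor c) (λ a b c → a xor (b xor c)) refl a b c) (⊕-assoc x y z)

⊕-self : ∀ {m} (x : Vec Bool m) → x ⊕ x ≡ 𝟎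
⊕-self [] = refl
⊕-self (a ∷ x) = cong₂ _∷_ (tautology 1 (λ a → a xor a) (λ _ → false) refl a) (⊕-self x)

⊕-identityʳ : ∀ {m} (x : Vec Bool m) → x ⊕ 𝟎 ≡ x
⊕-identityʳ [] = refl
⊕-identityʳ (a ∷ x) = cong₂ _∷_ (tautology 1 (λ a → a xor false) (λ a → a) refl a) (⊕-identityʳ x)

⊕-identityˡ : ∀ {m} (x : Vec Bool m) → 𝟎 ⊕ x ≡ x
⊕-identityˡ x = trans (⊕-comm 𝟎 x) (⊕-identityʳ x)

⊕-interchange : ∀ {m} (x y z w : Vec Bool m) → (x ⊕ y) ⊕ (z ⊕ w) ≡ (x ⊕ z) ⊕ (y ⊕ w)
⊕-interchange [] [] [] [] = refl
⊕-interchange (a ∷ x) (b ∷ y) (c ∷ z) (d ∷ w) =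
  cong₂ _∷_ (tautology 4 (λ a b c d → (a xor b) xor (c xor d)) (λ a b c d → (a xor c) xor (b xor d)) refl a b c d)
            (⊕-interchange x y z w)

scale-xor : ∀ {m} c d (x : Vec Bool m) → scale (c xor d) x ≡ scale c x ⊕ scale d x
scale-xor false d x = sym (⊕-identityˡ _)
scale-xor true false x = sym (⊕-identityʳ _)
scale-xor true true x = sym (⊕-self x)

dot : ∀ {m} → Vec Bool m → Vec Bool m → Bool
dot [] [] = false
dot (a ∷ x) (b ∷ y) = (a ∧ b) xor dot x y

dot-⊕ : ∀ {m} (o x y : Vec Bool m) → dot o (x ⊕ y) ≡ dot o x xor dot o y
dot-⊕ [] [] [] = refl
dot-⊕ (c ∷ o) (a ∷ x) (b ∷ y) = trans (cong (λ r → (c ∧ (a xor b)) xor r) (dot-⊕ o x y))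
  (tautology 5 (λ a b c p q → (c ∧ (a xor b)) xor (p xor q)) (λ a b c p q → ((c ∧ a) xor p) xor ((c ∧ b) xor q))
    refl a b c (dot o x) (dot o y))

Additive : ∀ {m} → (Vec Bool m → Bool) → Set
Additive f = ∀ x y → f (x ⊕ y) ≡ f x xor f y

-- For quadratic `Q` this is the associated alternating form; the summand `Q 𝟎` allows for a nonzero
-- constant term.
polar : ∀ {m} → (Vec Bool m → Bool) → Vec Bool m → Vec Bool m → Bool
polar Q x y = Q (x ⊕ y) xor (Q x xor (Q y xor Q 𝟎))

-- Degree at most two, expressed by bilinearity of the polar form; the second argument is covered by
-- `polar-sym`. No basis or monomials have to be chosen.
Quadratic : ∀ {m} → (Vec Bool m → Bool) → Set
Quadratic Q = ∀ x y z → polar Q (x ⊕ y) z ≡ polar Q x z xor polar Q y z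

additive-𝟎 : ∀ {m} (f : Vec Bool m → Bool) → Additive f → f 𝟎 ≡ false
additive-𝟎 f add = begin
  f 𝟎           ≡⟨ tautology 1 (λ a → a) (λ a → (a xor a) xor a) refl (f 𝟎) ⟩
  (f 𝟎 xor f 𝟎) xor f 𝟎 ≡⟨ cong (_xor f 𝟎) (sym (add 𝟎 𝟎)) ⟩
  f (𝟎 ⊕ 𝟎) xor f 𝟎 ≡⟨ cong (λ x → f x xor f 𝟎) (⊕-self 𝟎) ⟩
  f 𝟎 xor f 𝟎   ≡⟨ tautology 1 (λ a → a xor a) (λ _ → false) refl (f 𝟎) ⟩
  false ∎
  where open ≡-Reasoning

additive-scale : ∀ {m} (f : Vec Bool m → Bool) → Additive f → ∀ c x → f (scale c x) ≡ c ∧ f x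
additive-scale f add true x = refl
additive-scale f add false x = additive-𝟎 f add

polar-sym : ∀ {m} (Q : Vec Bool m → Bool) x y → polar Q x y ≡ polar Q y x
polar-sym Q x y = trans (cong (λ v → Q v xor (Q x xor (Q y xor Q 𝟎))) (⊕-comm x y))
  (tautology 4 (λ a b c d → a xor (b xor (c xor d))) (λ a b c d → a xor (c xor (b xor d))) refl
    (Q (y ⊕ x)) (Q x) (Q y) (Q 𝟎))

polar-self : ∀ {m} (Q : Vec Bool m → Bool) x → polar Q x x ≡ false
polar-self Q x = trans (cong (λ v → Q v xor (Q x xor (Q x xor Q 𝟎))) (⊕-self x))
  (tautology 2 (λ a b → a xor (b xor (b xor a))) (λ _ _ → false) refl (Q 𝟎) (Q x))

-- Exhaustive search stands in for excluded middle: both outcomes carry evidence.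
search : ∀ {m} (p : Vec Bool m → Bool) → (Σ (Vec Bool m) λ x → p x ≡ true) ⊎ (∀ x → p x ≡ false)
search {zero} p with p [] in eq
... | true = inj₁ ([] , eq)
... | false = inj₂ λ { [] → eq }
search {suc m} p with search (p ∘ (true ∷_)) | search (p ∘ (false ∷_))
... | inj₁ (x , e) | _ = inj₁ (true ∷ x , e)
... | inj₂ _ | inj₁ (x , e) = inj₁ (false ∷ x , e)
... | inj₂ f | inj₂ g = inj₂ λ { (true ∷ x) → f x ; (false ∷ x) → g x }

record Subspace {m} (P : Vec Bool m → Bool) : Set where
  field
    has-𝟎 : P 𝟎 ≡ true
    closed : ∀ {x y} → P x ≡ true → P y ≡ true → P (x ⊕ y) ≡ true

scale-closed : ∀ {m} {P : Vec Bool m → Bool} → Subspace P → ∀ c {x} → P x ≡ true → P (scale c x) ≡ true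
scale-closed V true p = p
scale-closed V false p = Subspace.has-𝟎 V

-- One coordinate at a time. Vectors of `P` with first bit `true` differ from a chosen `true ∷ y` by
-- a vector of the smaller subspace, so the value at `true ∷ y` fixes the new coefficient; if there
-- is no such vector, any coefficient serves.
extend-functional : ∀ {m} (P : Vec Bool m → Bool) → Subspace P → (f : Vec Bool m → Bool) →
  (∀ {x y} → P x ≡ true → P y ≡ true → f (x ⊕ y) ≡ f x xor f y) →
  Σ (Vec Bool m) λ o → ∀ x → P x ≡ true → f x ≡ dot o x
extend-functional {zero} P V f add = [] , λ { [] p → trans (tautology 1 (λ a → a) (λ a → (a xor a) xor a) refl (f []))
  (trans (cong (_xor f []) (sym (add p p))) (tautology 1 (λ a → a xor a) (λ _ → false) refl (f []))) }
extend-functional {suc m} P V f add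
  with extend-functional (P ∘ (false ∷_)) (record { has-𝟎 = Subspace.has-𝟎 V ; closed = Subspace.closed V })
                         (f ∘ (false ∷_)) add
     | search (P ∘ (true ∷_))
... | o , h | inj₂ none = (false ∷ o) , λ { (false ∷ x) p → h x p ; (true ∷ x) p → false≢true (none x) p }
... | o , h | inj₁ (y , py) = ((f (true ∷ y) xor dot o y) ∷ o) , λ
  { (false ∷ x) p → trans (h x p) (tautology 2 (λ a b → b) (λ a b → (a ∧ false) xor b) refl (f (true ∷ y) xor dot o y) (dot o x))
  ; (true ∷ x) p → begin
      f (true ∷ x) ≡⟨ tautology 2 (λ a b → a) (λ a b → (b xor a) xor b) refl (f (true ∷ x)) (f (true ∷ y)) ⟩
      (f (true ∷ y) xor f (true ∷ x)) xor f (true ∷ y)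
        ≡⟨ cong (_xor f (true ∷ y)) (sym (add py p)) ⟩
      f (false ∷ (y ⊕ x)) xor f (true ∷ y)
        ≡⟨ cong (_xor f (true ∷ y)) (trans (h (y ⊕ x) (Subspace.closed V py p)) (dot-⊕ o y x)) ⟩
      (dot o y xor dot o x) xor f (true ∷ y)
        ≡⟨ tautology 3 (λ a b c → (a xor b) xor c) (λ a b c → ((c xor a) ∧ true) xor b) refl (dot o y) (dot o x) (f (true ∷ y)) ⟩
      ((f (true ∷ y) xor dot o y) ∧ true) xor dot o x ∎ }
  where open ≡-Reasoning

-- Hyperbolic coordinates

Hyp : ℕ → Set
Hyp = Vec (Bool × Bool)

xor² : Bool × Bool → Bool × Bool → Bool × Bool
xor² (a , b) (c , d) = a xor c , b xor d

_⊞_ : ∀ {t} → Hyp t → Hyp t → Hyp t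
_⊞_ = zipWith xor²

infixl 6 _⊞_

arf : ∀ {t} → Hyp t → Bool
arf [] = false
arf ((a , b) ∷ z) = (a ∧ b) xor arf z

-- The ordinary dot product of F₂^2t, not the symplectic polar form of `arf`; it labels the
-- characters of the hyperbolic space by its own points.
pair : ∀ {t} → Hyp t → Hyp t → Bool
pair [] [] = false
pair ((a , b) ∷ w) ((x , y) ∷ z) = ((a ∧ x) xor (b ∧ y)) xor pair w z

⊞-interchange : ∀ {t} (x y z w : Hyp t) → (x ⊞ y) ⊞ (z ⊞ w) ≡ (x ⊞ z) ⊞ (y ⊞ w)
⊞-interchange [] [] [] [] = refl
⊞-interchange ((a , a′) ∷ x) ((b , b′) ∷ y) ((c , c′) ∷ z) ((d , d′) ∷ w) =
  cong₂ _∷_ (cong₂ _,_ (i a b c d) (i a′ b′ c′ d′)) (⊞-interchange x y z w)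
  where i = tautology 4 (λ a b c d → (a xor b) xor (c xor d)) (λ a b c d → (a xor c) xor (b xor d)) refl

⊞-cancel : ∀ {t} (x y : Hyp t) → x ⊞ (y ⊞ x) ≡ y
⊞-cancel [] [] = refl
⊞-cancel ((a , a′) ∷ x) ((b , b′) ∷ y) = cong₂ _∷_ (cong₂ _,_ (i a b) (i a′ b′)) (⊞-cancel x y)
  where i = tautology 2 (λ a b → a xor (b xor a)) (λ a b → b) refl

pair-⊞ : ∀ {t} (w x y : Hyp t) → pair w (x ⊞ y) ≡ pair w x xor pair w y
pair-⊞ [] [] [] = refl
pair-⊞ ((a , b) ∷ w) ((x , x′) ∷ z) ((y , y′) ∷ u) =
  trans (cong (λ r → ((a ∧ (x xor y)) xor (b ∧ (x′ xor y′))) xor r) (pair-⊞ w z u))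
    (tautology 8 (λ a b x x′ y y′ p q → ((a ∧ (x xor y)) xor (b ∧ (x′ xor y′))) xor (p xor q))
      (λ a b x x′ y y′ p q → (((a ∧ x) xor (b ∧ x′)) xor p) xor (((a ∧ y) xor (b ∧ y′)) xor q)) refl
      a b x x′ y y′ (pair w z) (pair w u))

Radical : ∀ {m} (P L : Vec Bool m → Bool) → Vec Bool m → Set
Radical P L x = ∀ y → P y ≡ true → polar L x y ≡ false

-- The state of a symplectic Gram-Schmidt process. `L` is the part of `Q` not yet split, `π` reads
-- the coordinates in the planes split so far, and `s` lifts them back to vectors of `P` that are
-- radical for `L`. Once `done` lists every vector, `L` is affine on `P`.
record Decomposition {m} (P Q : Vec Bool m → Bool) (done : List (Vec Bool m)) : Set where
  field
    {t} : ℕ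
    L : Vec Bool m → Bool
    L-quadratic : Quadratic L
    π : Vec Bool m → Hyp t
    π-⊕ : ∀ x y → π (x ⊕ y) ≡ π x ⊞ π y
    split : ∀ x → Q x ≡ L x xor arf (π x)
    s : Hyp t → Vec Bool m
    s-⊞ : ∀ z w → s (z ⊞ w) ≡ s z ⊕ s w
    s∈P : ∀ z → P (s z) ≡ true
    π∘s : ∀ z → π (s z) ≡ z
    s-radical : ∀ z → Radical P L (s z)
    done-radical : All (λ x → P x ≡ true → Radical P L x) done

module _ {m} {P Q : Vec Bool m → Bool} (V : Subspace P) {done : List (Vec Bool m)}
         (D : Decomposition P Q done) (a b : Vec Bool m) (pa : P a ≡ true) (pb : P b ≡ true)
         (ab : polar (Decomposition.L D) a b ≡ true) where
  open Decomposition D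

  private
    B : Vec Bool m → Vec Bool m → Bool
    B = polar L

    Badd : ∀ y → Additive (λ x → B x y)
    Badd y x x′ = L-quadratic x x′ y

  -- As `a` and `b` pair to 1, adding the product of the pairings with `a` and `b` makes both
  -- vectors radical: the plane they span moves from `L` into `arf`.
  shear : Vec Bool m → Bool
  shear x = L x xor (B x a ∧ B x b)

  polar-shear : ∀ x y → polar shear x y ≡ B x y xor ((B x a ∧ B y b) xor (B y a ∧ B x b))
  polar-shear x y = trans
    (cong₂ (λ p q → (L (x ⊕ y) xor p) xor (shear x xor (shear y xor (L 𝟎 xor q))))
      (cong₂ _∧_ (Badd a x y) (Badd b x y)) (cong (_∧ B 𝟎 b) (additive-𝟎 (λ x → B x a) (Badd a))))
    (tautology 8 (λ l₁ l₂ l₃ l₄ xa ya xb yb →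
        (l₁ xor ((xa xor ya) ∧ (xb xor yb))) xor ((l₂ xor (xa ∧ xb)) xor ((l₃ xor (ya ∧ yb)) xor (l₄ xor false))))
      (λ l₁ l₂ l₃ l₄ xa ya xb yb → (l₁ xor (l₂ xor (l₃ xor l₄))) xor ((xa ∧ yb) xor (ya ∧ xb))) refl
      (L (x ⊕ y)) (L x) (L y) (L 𝟎) (B x a) (B y a) (B x b) (B y b))

  shear-quadratic : Quadratic shear
  shear-quadratic x y z = begin
    polar shear (x ⊕ y) z
      ≡⟨ polar-shear (x ⊕ y) z ⟩
    B (x ⊕ y) z xor ((B (x ⊕ y) a ∧ B z b) xor (B z a ∧ B (x ⊕ y) b))
      ≡⟨ cong₂ _xor_ (Badd z x y) (cong₂ _xor_ (cong (_∧ B z b) (Badd a x y)) (cong (B z a ∧_) (Badd b x y))) ⟩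
    (B x z xor B y z) xor (((B x a xor B y a) ∧ B z b) xor (B z a ∧ (B x b xor B y b)))
      ≡⟨ tautology 8 (λ xz yz xa ya xb yb za zb → (xz xor yz) xor (((xa xor ya) ∧ zb) xor (za ∧ (xb xor yb))))
           (λ xz yz xa ya xb yb za zb → (xz xor ((xa ∧ zb) xor (za ∧ xb))) xor (yz xor ((ya ∧ zb) xor (za ∧ yb)))) refl
           (B x z) (B y z) (B x a) (B y a) (B x b) (B y b) (B z a) (B z b) ⟩
    (B x z xor ((B x a ∧ B z b) xor (B z a ∧ B x b))) xor (B y z xor ((B y a ∧ B z b) xor (B z a ∧ B y b)))
      ≡⟨ sym (cong₂ _xor_ (polar-shear x z) (polar-shear y z)) ⟩
    polar shear x z xor polar shear y z ∎
    where open ≡-Reasoning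

  -- A radical vector is orthogonal to `a` and `b`, so the correction in `polar-shear` vanishes on
  -- it and earlier progress is kept.
  radical-shear : ∀ {x} → Radical P L x → Radical P shear x
  radical-shear {x} r y py = trans (polar-shear x y)
    (trans (cong₂ (λ p q → p xor ((q ∧ B y b) xor (B y a ∧ B x b))) (r y py) (r a pa))
      (trans (cong (λ p → false xor ((false ∧ B y b) xor (B y a ∧ p))) (r b pb))
        (tautology 1 (λ c → c ∧ false) (λ _ → false) refl (B y a))))

  radical-a : Radical P shear a
  radical-a y py = trans (polar-shear a y)
    (trans (cong₂ (λ p q → B a y xor ((p ∧ B y b) xor (B y a ∧ q))) (polar-self L a) ab)
      (trans (cong (λ p → p xor (false xor (B y a ∧ true))) (polar-sym L a y))
        (tautology 1 (λ c → c xor (c ∧ true)) (λ _ → false) refl (B y a))))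

  radical-b : Radical P shear b
  radical-b y py = trans (polar-shear b y)
    (trans (cong₂ (λ p q → B b y xor ((p ∧ B y b) xor (B y a ∧ q))) (trans (polar-sym L b a) ab) (polar-self L b))
      (trans (cong (λ p → p xor ((true ∧ B y b) xor (B y a ∧ false))) (polar-sym L b y))
        (tautology 2 (λ c d → c xor ((true ∧ c) xor (d ∧ false))) (λ _ _ → false) refl (B y b) (B y a))))

  private
    -- The new coordinates are the pairings with `a` and with `b`, so the dual basis is crossed: the
    -- first coordinate multiplies `b`, the second `a`.
    lin : Bool → Bool → Vec Bool m
    lin p q = scale q a ⊕ scale p b

    lin-xor : ∀ p q p′ q′ → lin (p xor p′) (q xor q′) ≡ lin p q ⊕ lin p′ q′
    lin-xor p q p′ q′ = trans (cong₂ _⊕_ (scale-xor q q′ a) (scale-xor p p′ b)) (⊕-interchange _ _ _ _)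

    lin∈P : ∀ p q → P (lin p q) ≡ true
    lin∈P p q = Subspace.closed V (scale-closed V q pa) (scale-closed V p pb)

    -- `lin p q` may have nonzero old coordinates. The added lift corrects them to `z`, and being
    -- radical for `L` it leaves the two new coordinates alone.
    s′ : Hyp (suc t) → Vec Bool m
    s′ ((p , q) ∷ z) = lin p q ⊕ s (z ⊞ π (lin p q))

    B-lin : ∀ p q {y} → B (lin p q) y ≡ (q ∧ B a y) xor (p ∧ B b y)
    B-lin p q {y} = trans (Badd y (scale q a) (scale p b))
      (cong₂ _xor_ (additive-scale (λ x → B x y) (Badd y) q a) (additive-scale (λ x → B x y) (Badd y) p b))

    B-s′ : ∀ p q z {y} → P y ≡ true → B (s′ ((p , q) ∷ z)) y ≡ (q ∧ B a y) xor (p ∧ B b y)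
    B-s′ p q z {y} py = trans (Badd y (lin p q) (s (z ⊞ π (lin p q))))
      (trans (cong₂ _xor_ (B-lin p q) (s-radical (z ⊞ π (lin p q)) y py))
        (tautology 1 (λ c → c xor false) (λ c → c) refl _))

  split-off : Decomposition P Q (a ∷ done)
  split-off = record
    { t = suc t
    ; L = shear
    ; L-quadratic = shear-quadratic
    ; π = λ x → (B x a , B x b) ∷ π x
    ; π-⊕ = λ x y → cong₂ _∷_ (cong₂ _,_ (Badd a x y) (Badd b x y)) (π-⊕ x y)
    ; split = λ x → trans (split x)
        (tautology 3 (λ l c r → l xor r) (λ l c r → (l xor c) xor (c xor r)) refl (L x) (B x a ∧ B x b) (arf (π x)))
    ; s = s′
    ; s-⊞ = λ { ((p , q) ∷ z) ((p′ , q′) ∷ w) → trans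
        (cong₂ _⊕_ (lin-xor p q p′ q′)
          (trans (cong (λ u → s ((z ⊞ w) ⊞ u)) (trans (cong π (lin-xor p q p′ q′)) (π-⊕ _ _)))
            (trans (cong s (⊞-interchange z w _ _)) (s-⊞ _ _))))
        (⊕-interchange _ _ _ _) }
    ; s∈P = λ { ((p , q) ∷ z) → Subspace.closed V (lin∈P p q) (s∈P _) }
    ; π∘s = λ { ((p , q) ∷ z) → cong₂ _∷_
        (cong₂ _,_
          (trans (B-s′ p q z pa) (trans (cong₂ (λ c d → (q ∧ c) xor (p ∧ d)) (polar-self L a) (trans (polar-sym L b a) ab))
            (tautology 2 (λ p q → (q ∧ false) xor (p ∧ true)) (λ p q → p) refl p q)))
          (trans (B-s′ p q z pb) (trans (cong₂ (λ c d → (q ∧ c) xor (p ∧ d)) ab (polar-self L b))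
            (tautology 2 (λ p q → (q ∧ true) xor (p ∧ false)) (λ p q → q) refl p q))))
        (trans (π-⊕ (lin p q) _) (trans (cong (π (lin p q) ⊞_) (π∘s _)) (⊞-cancel (π (lin p q)) z))) }
    ; s-radical = λ { ((p , q) ∷ z) y py → let add = λ x x′ → shear-quadratic x x′ y in
        trans (add (lin p q) (s (z ⊞ π (lin p q))))
        (trans (cong₂ _xor_
          (trans (add (scale q a) (scale p b)) (cong₂ _xor_
            (trans (additive-scale (λ x → polar shear x y) add q a) (cong (q ∧_) (radical-a y py)))
            (trans (additive-scale (λ x → polar shear x y) add p b) (cong (p ∧_) (radical-b y py)))))
          (radical-shear (s-radical _) y py))
        (tautology 2 (λ p q → ((q ∧ false) xor (p ∧ false)) xor false) (λ p q → false) refl p q)) }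
    ; done-radical = (λ _ → radical-a) ∷ All.map (λ r px → radical-shear (r px)) done-radical
    }

-- Each listed vector costs at most one splitting: if it lies in `P` and pairs to 1 with some `y` in
-- `P`, the two span a hyperbolic plane; otherwise it lies outside `P` or is radical already.
decompose : ∀ {m} {P Q : Vec Bool m → Bool} → Subspace P → Quadratic Q → ∀ done → Decomposition P Q done
decompose {Q = Q} V quad [] = record
  { t = 0 ; L = Q ; L-quadratic = quad ; π = λ _ → [] ; π-⊕ = λ _ _ → refl
  ; split = λ x → tautology 1 (λ a → a) (λ a → a xor false) refl (Q x)
  ; s = λ _ → 𝟎 ; s-⊞ = λ _ _ → sym (⊕-self 𝟎) ; s∈P = λ _ → Subspace.has-𝟎 V
  ; π∘s = λ { [] → refl } ; s-radical = λ _ y _ → additive-𝟎 (λ x → polar Q x y) (λ x x′ → quad x x′ y) ; done-radical = [] }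
decompose {P = P} V quad (x ∷ done) with decompose V quad done
... | D with P x in px
...   | false = record { Decomposition D ; done-radical = (λ px′ → false≢true px px′) ∷ Decomposition.done-radical D }
...   | true with search (λ y → P y ∧ polar (Decomposition.L D) x y)
...     | inj₁ (y , e) = split-off V D x y px (∧-trueˡ e) (∧-trueʳ {P y} e)
...     | inj₂ none = record { Decomposition D
          ; done-radical = (λ _ y py → trans (sym (cong (_∧ _) py)) (none y)) ∷ Decomposition.done-radical D }

-- Sums of signs over the hyperbolic space

sg : Bool → ℚ
sg false = 1ℚ
sg true = ℚ.- 1ℚ

sg-xor : ∀ a b → sg (a xor b) ≡ sg a ℚ.* sg b
sg-xor false false = refl
sg-xor false true = refl
sg-xor true false = refl
sg-xor true true = refl

sg-square : ∀ a → sg a ℚ.* sg a ≡ 1ℚ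
sg-square false = refl
sg-square true = refl

sumF : (k : ℕ) → (Fin k → ℚ) → ℚ
sumF zero f = 0ℚ
sumF (suc k) f = f zero ℚ.+ sumF k (λ i → f (suc i))

sumF-cong : ∀ k {f g : Fin k → ℚ} → (∀ i → f i ≡ g i) → sumF k f ≡ sumF k g
sumF-cong zero h = refl
sumF-cong (suc k) h = cong₂ ℚ._+_ (h zero) (sumF-cong k (λ i → h (suc i)))

sumF-zero : ∀ k {f : Fin k → ℚ} → (∀ i → f i ≡ 0ℚ) → sumF k f ≡ 0ℚ
sumF-zero zero h = refl
sumF-zero (suc k) h = cong₂ ℚ._+_ (h zero) (sumF-zero k (λ i → h (suc i)))

sumF-scale : ∀ k c (f : Fin k → ℚ) → sumF k (λ i → c ℚ.* f i) ≡ c ℚ.* sumF k f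
sumF-scale zero c f = sym (ℚ.*-zeroʳ c)
sumF-scale (suc k) c f = trans (cong (c ℚ.* f zero ℚ.+_) (sumF-scale k c (λ i → f (suc i))))
  (sym (ℚ.*-distribˡ-+ c (f zero) _))

sumF-++ : ∀ a b (f : Fin (a ℕ.+ b) → ℚ) → sumF (a ℕ.+ b) f ≡ sumF a (λ i → f (i ↑ˡ b)) ℚ.+ sumF b (λ i → f (a ↑ʳ i))
sumF-++ zero b f = sym (ℚ.+-identityˡ _)
sumF-++ (suc a) b f = trans (cong (f zero ℚ.+_) (sumF-++ a b (λ i → f (suc i)))) (sym (ℚ.+-assoc (f zero) _ _))

sumF-combine : ∀ k n (f : Fin (k ℕ.* n) → ℚ) → sumF (k ℕ.* n) f ≡ sumF k (λ i → sumF n (λ j → f (combine i j)))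
sumF-combine zero n f = refl
sumF-combine (suc k) n f = trans (sumF-++ n (k ℕ.* n) f)
  (cong (sumF n (λ i → f (i ↑ˡ (k ℕ.* n))) ℚ.+_) (sumF-combine k n (λ i → f (n ↑ʳ i))))

sumB : (Bool → ℚ) → ℚ
sumB f = f false ℚ.+ f true

sumHyp : ∀ t → (Hyp t → ℚ) → ℚ
sumHyp zero f = f []
sumHyp (suc t) f = sumB λ x → sumB λ y → sumHyp t λ z → f ((x , y) ∷ z)

sumB-cong : ∀ {f g : Bool → ℚ} → (∀ b → f b ≡ g b) → sumB f ≡ sumB g
sumB-cong h = cong₂ ℚ._+_ (h false) (h true)

sumHyp-cong : ∀ t {f g : Hyp t → ℚ} → (∀ z → f z ≡ g z) → sumHyp t f ≡ sumHyp t g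
sumHyp-cong zero h = h []
sumHyp-cong (suc t) h = sumB-cong λ x → sumB-cong λ y → sumHyp-cong t λ z → h ((x , y) ∷ z)

sumB-scale : ∀ c (f : Bool → ℚ) → sumB (λ b → c ℚ.* f b) ≡ c ℚ.* sumB f
sumB-scale c f = sym (ℚ.*-distribˡ-+ c _ _)

sumHyp-scale : ∀ t c (f : Hyp t → ℚ) → sumHyp t (λ z → c ℚ.* f z) ≡ c ℚ.* sumHyp t f
sumHyp-scale zero c f = refl
sumHyp-scale (suc t) c f = trans
  (sumB-cong λ x → trans (sumB-cong λ y → sumHyp-scale t c (λ z → f ((x , y) ∷ z)))
    (sumB-scale c (λ y → sumHyp t λ z → f ((x , y) ∷ z))))
  (sumB-scale c (λ x → sumB λ y → sumHyp t λ z → f ((x , y) ∷ z)))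

sumB-+ : ∀ (f g : Bool → ℚ) → sumB (λ b → f b ℚ.+ g b) ≡ sumB f ℚ.+ sumB g
sumB-+ f g = solve 4 (λ a b c d → (a :+ b) :+ (c :+ d) := (a :+ c) :+ (b :+ d)) refl
  (f false) (g false) (f true) (g true)
  where open +-*-Solver

sumHyp-+ : ∀ t (f g : Hyp t → ℚ) → sumHyp t (λ z → f z ℚ.+ g z) ≡ sumHyp t f ℚ.+ sumHyp t g
sumHyp-+ zero f g = refl
sumHyp-+ (suc t) f g = trans
  (sumB-cong λ x → trans (sumB-cong λ y → sumHyp-+ t (λ z → f ((x , y) ∷ z)) (λ z → g ((x , y) ∷ z)))
    (sumB-+ (λ y → sumHyp t λ z → f ((x , y) ∷ z)) (λ y → sumHyp t λ z → g ((x , y) ∷ z))))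
  (sumB-+ (λ x → sumB λ y → sumHyp t λ z → f ((x , y) ∷ z)) (λ x → sumB λ y → sumHyp t λ z → g ((x , y) ∷ z)))

sumHyp-zero : ∀ t → sumHyp t (λ _ → 0ℚ) ≡ 0ℚ
sumHyp-zero zero = refl
sumHyp-zero (suc t) rewrite sumHyp-zero t = refl

sumHyp-sumF : ∀ t k (f : Fin k → Hyp t → ℚ) →
  sumHyp t (λ z → sumF k (λ i → f i z)) ≡ sumF k (λ i → sumHyp t (f i))
sumHyp-sumF t zero f = sumHyp-zero t
sumHyp-sumF t (suc k) f = trans (sumHyp-+ t (f zero) _)
  (cong (sumHyp t (f zero) ℚ.+_) (sumHyp-sumF t k (λ i → f (suc i))))

sumB-shift : ∀ b (f : Bool → ℚ) → sumB (λ x → f (x xor b)) ≡ sumB f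
sumB-shift false f = refl
sumB-shift true f = ℚ.+-comm (f true) (f false)

sumHyp-shift : ∀ t w (f : Hyp t → ℚ) → sumHyp t (λ z → f (z ⊞ w)) ≡ sumHyp t f
sumHyp-shift zero [] f = refl
sumHyp-shift (suc t) ((u , v) ∷ w) f = trans
  (sumB-cong λ x → trans (sumB-cong λ y → sumHyp-shift t w (λ z → f ((x xor u , y xor v) ∷ z)))
    (sumB-shift v (λ y → sumHyp t λ z → f ((x xor u , y) ∷ z))))
  (sumB-shift u (λ x → sumB λ y → sumHyp t λ z → f ((x , y) ∷ z)))

-- Shifting by a point where χ is odd negates the sum.
character-sum : ∀ t (χ : Hyp t → Bool) → (∀ z w → χ (z ⊞ w) ≡ χ z xor χ w) →
  ∀ w → χ w ≡ true → sumHyp t (λ z → sg (χ z)) ≡ 0ℚ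
character-sum t χ add w odd = begin
  S                      ≡⟨ solve 1 (λ x → x := con ½ :* (x :+ x)) refl S ⟩
  ½ ℚ.* (S ℚ.+ S)        ≡⟨ cong (λ r → ½ ℚ.* (S ℚ.+ r)) flip ⟩
  ½ ℚ.* (S ℚ.+ (ℚ.- 1ℚ) ℚ.* S) ≡⟨ solve 1 (λ x → con ½ :* (x :+ con (ℚ.- 1ℚ) :* x) := con 0ℚ) refl S ⟩
  0ℚ ∎
  where
  open ≡-Reasoning
  open +-*-Solver
  S = sumHyp t (λ z → sg (χ z))
  flip : S ≡ (ℚ.- 1ℚ) ℚ.* S
  flip = begin
    S ≡⟨ sym (sumHyp-shift t w (λ z → sg (χ z))) ⟩
    sumHyp t (λ z → sg (χ (z ⊞ w))) ≡⟨ sumHyp-cong t (λ z → trans (cong sg (trans (add z w) (trans (cong (χ z xor_) odd)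
        (tautology 1 (λ a → a xor true) (λ a → true xor a) refl (χ z))))) (sg-xor true (χ z))) ⟩
    sumHyp t (λ z → (ℚ.- 1ℚ) ℚ.* sg (χ z)) ≡⟨ sumHyp-scale t (ℚ.- 1ℚ) _ ⟩
    (ℚ.- 1ℚ) ℚ.* S ∎

two : ℕ → ℚ
two zero = 1ℚ
two (suc t) = (1ℚ ℚ.+ 1ℚ) ℚ.* two t

half : ℕ → ℚ
half zero = 1ℚ
half (suc t) = ½ ℚ.* half t

half*two : ∀ t → half t ℚ.* two t ≡ 1ℚ
half*two zero = refl
half*two (suc t) = trans (solve 2 (λ h w → (con ½ :* h) :* ((con 1ℚ :+ con 1ℚ) :* w) := h :* w) refl (half t) (two t))
  (half*two t)
  where open +-*-Solver

-- The sum factors over the planes, and each plane contributes the sum of (-1)^(ux + vy + xy), which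
-- is 2 (-1)^(uv). So `arf` is its own Fourier transform up to the factor 2^t, and none of its 4^t
-- coefficients vanishes.
gauss-sum : ∀ t (w : Hyp t) → sumHyp t (λ z → sg (pair w z xor arf z)) ≡ two t ℚ.* sg (arf w)
gauss-sum zero [] = refl
gauss-sum (suc t) ((u , v) ∷ w) = begin
  sumB (λ x → sumB λ y → sumHyp t λ z → sg (pair ((u , v) ∷ w) ((x , y) ∷ z) xor arf ((x , y) ∷ z)))
    ≡⟨ sumB-cong (λ x → sumB-cong λ y → trans
         (sumHyp-cong t λ z → trans (cong sg (regroup u v x y (pair w z) (arf z))) (sg-xor (e x y) _))
         (trans (sumHyp-scale t (sg (e x y)) _) (cong (sg (e x y) ℚ.*_) (gauss-sum t w)))) ⟩
  sumB (λ x → sumB λ y → sg (e x y) ℚ.* (two t ℚ.* sg (arf w)))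
    ≡⟨ solve 6 (λ a b c d p q → (a :* (p :* q) :+ b :* (p :* q)) :+ (c :* (p :* q) :+ d :* (p :* q))
                    := ((a :+ b) :+ (c :+ d)) :* (p :* q)) refl
        (sg (e false false)) (sg (e false true)) (sg (e true false)) (sg (e true true)) (two t) (sg (arf w)) ⟩
  sumB (λ x → sumB λ y → sg (e x y)) ℚ.* (two t ℚ.* sg (arf w))
    ≡⟨ cong (ℚ._* (two t ℚ.* sg (arf w))) (base u v) ⟩
  ((1ℚ ℚ.+ 1ℚ) ℚ.* sg (u ∧ v)) ℚ.* (two t ℚ.* sg (arf w))
    ≡⟨ solve 4 (λ a b c d → (a :* b) :* (c :* d) := (a :* c) :* (b :* d)) refl (1ℚ ℚ.+ 1ℚ) (sg (u ∧ v)) (two t) (sg (arf w)) ⟩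
  ((1ℚ ℚ.+ 1ℚ) ℚ.* two t) ℚ.* (sg (u ∧ v) ℚ.* sg (arf w))
    ≡⟨ cong (two (suc t) ℚ.*_) (sym (sg-xor (u ∧ v) (arf w))) ⟩
  two (suc t) ℚ.* sg ((u ∧ v) xor arf w) ∎
  where
  open ≡-Reasoning
  open +-*-Solver
  e : Bool → Bool → Bool
  e x y = ((u ∧ x) xor (v ∧ y)) xor (x ∧ y)
  regroup : ∀ u v x y r s → (((u ∧ x) xor (v ∧ y)) xor r) xor ((x ∧ y) xor s) ≡ (((u ∧ x) xor (v ∧ y)) xor (x ∧ y)) xor (r xor s)
  regroup = tautology 6 (λ u v x y r s → (((u ∧ x) xor (v ∧ y)) xor r) xor ((x ∧ y) xor s))
    (λ u v x y r s → (((u ∧ x) xor (v ∧ y)) xor (x ∧ y)) xor (r xor s)) refl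
  base : ∀ u v → sumB (λ x → sumB λ y → sg (((u ∧ x) xor (v ∧ y)) xor (x ∧ y))) ≡ (1ℚ ℚ.+ 1ℚ) ℚ.* sg (u ∧ v)
  base false false = refl
  base false true = refl
  base true false = refl
  base true true = refl

pair-sym : ∀ {t} (w z : Hyp t) → pair w z ≡ pair z w
pair-sym [] [] = refl
pair-sym ((a , b) ∷ w) ((x , y) ∷ z) = trans (cong (((a ∧ x) xor (b ∧ y)) xor_) (pair-sym w z))
  (tautology 5 (λ a b x y r → ((a ∧ x) xor (b ∧ y)) xor r) (λ a b x y r → ((x ∧ a) xor (y ∧ b)) xor r) refl a b x y (pair z w))

pair-𝟎 : ∀ {t} (w : Hyp t) → pair w (replicate t (false , false)) ≡ false
pair-𝟎 [] = refl
pair-𝟎 ((a , b) ∷ w) = trans (cong (((a ∧ false) xor (b ∧ false)) xor_) (pair-𝟎 w))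
  (tautology 2 (λ a b → ((a ∧ false) xor (b ∧ false)) xor false) (λ _ _ → false) refl a b)

pair-nondegenerate : ∀ {t} (w w′ : Hyp t) → (∀ z → pair w z ≡ pair w′ z) → w ≡ w′
pair-nondegenerate [] [] h = refl
pair-nondegenerate ((a , b) ∷ w) ((a′ , b′) ∷ w′) h = cong₂ _∷_
  (cong₂ _,_ (probe true false (λ a b → a) refl)
             (probe false true (λ a b → b) refl))
  (pair-nondegenerate w w′ λ z → trans (sym (at-origin a b (pair w z))) (trans (h ((false , false) ∷ z)) (at-origin a′ b′ (pair w′ z))))
  where
  at-origin : ∀ a b r → ((a ∧ false) xor (b ∧ false)) xor r ≡ r
  at-origin = tautology 3 (λ a b r → ((a ∧ false) xor (b ∧ false)) xor r) (λ a b r → r) refl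
  probe : ∀ x y (p : Bool → Bool → Bool) → agree 2 (λ a b → ((a ∧ x) xor (b ∧ y)) xor false) p ≡ true → p a b ≡ p a′ b′
  probe x y p chk = trans (sym (ev a b w)) (trans (h ((x , y) ∷ replicate _ (false , false))) (ev a′ b′ w′))
    where
    ev : ∀ a b w → pair ((a , b) ∷ w) ((x , y) ∷ replicate _ (false , false)) ≡ p a b
    ev a b w = trans (cong (((a ∧ x) xor (b ∧ y)) xor_) (pair-𝟎 w)) (tautology 2 (λ a b → ((a ∧ x) xor (b ∧ y)) xor false) p chk a b)

searchHyp : ∀ t (p : Hyp t → Bool) → (Σ (Hyp t) λ z → p z ≡ true) ⊎ (∀ z → p z ≡ false)
searchHyp zero p with p [] in eq
... | true = inj₁ ([] , eq)
... | false = inj₂ λ { [] → eq }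
searchHyp (suc t) p with searchHyp t (λ z → p ((false , false) ∷ z)) | searchHyp t (λ z → p ((false , true) ∷ z))
                       | searchHyp t (λ z → p ((true , false) ∷ z)) | searchHyp t (λ z → p ((true , true) ∷ z))
... | inj₁ (z , e) | _ | _ | _ = inj₁ ((false , false) ∷ z , e)
... | inj₂ _ | inj₁ (z , e) | _ | _ = inj₁ ((false , true) ∷ z , e)
... | inj₂ _ | inj₂ _ | inj₁ (z , e) | _ = inj₁ ((true , false) ∷ z , e)
... | inj₂ _ | inj₂ _ | inj₂ _ | inj₁ (z , e) = inj₁ ((true , true) ∷ z , e)
... | inj₂ a | inj₂ b | inj₂ c | inj₂ d = inj₂ λ
  { ((false , false) ∷ z) → a z ; ((false , true) ∷ z) → b z ; ((true , false) ∷ z) → c z ; ((true , true) ∷ z) → d z }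

-- Enumeration of the hyperbolic space by 4^t indices

encode² : Bool × Bool → Fin 4
encode² (false , false) = zero
encode² (false , true) = suc zero
encode² (true , false) = suc (suc zero)
encode² (true , true) = suc (suc (suc zero))

decode² : Fin 4 → Bool × Bool
decode² zero = false , false
decode² (suc zero) = false , true
decode² (suc (suc zero)) = true , false
decode² (suc (suc (suc zero))) = true , true

decode²-injective : ∀ i j → decode² i ≡ decode² j → i ≡ j
decode²-injective i j e = trans (sym (enc i)) (trans (cong encode² e) (enc j))
  where
  enc : ∀ i → encode² (decode² i) ≡ i
  enc zero = refl
  enc (suc zero) = refl
  enc (suc (suc zero)) = refl
  enc (suc (suc (suc zero))) = refl

decode : ∀ t → Fin (4 ^ t) → Hyp t
decode zero i = []
decode (suc t) i = decode² (proj₁ (remQuot {4} (4 ^ t) i)) ∷ decode t (proj₂ (remQuot {4} (4 ^ t) i))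

decode-injective : ∀ t i j → decode t i ≡ decode t j → i ≡ j
decode-injective zero zero zero e = refl
decode-injective (suc t) i j e = begin
  i ≡⟨ sym (Fin.combine-remQuot {4} (4 ^ t) i) ⟩
  combine (proj₁ (remQuot {4} (4 ^ t) i)) (proj₂ (remQuot {4} (4 ^ t) i))
    ≡⟨ cong₂ combine (decode²-injective _ _ (cong Vec.head e)) (decode-injective t _ _ (cong Vec.tail e)) ⟩
  combine (proj₁ (remQuot {4} (4 ^ t) j)) (proj₂ (remQuot {4} (4 ^ t) j))
    ≡⟨ Fin.combine-remQuot {4} (4 ^ t) j ⟩
  j ∎
  where
  open ≡-Reasoning

sumF-decode : ∀ t (f : Hyp t → ℚ) → sumF (4 ^ t) (λ i → f (decode t i)) ≡ sumHyp t f
sumF-decode zero f = ℚ.+-identityʳ (f [])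
sumF-decode (suc t) f = begin
  sumF (4 ℕ.* 4 ^ t) (λ i → f (decode (suc t) i))
    ≡⟨ sumF-combine 4 (4 ^ t) _ ⟩
  sumF 4 (λ q → sumF (4 ^ t) (λ r → f (decode (suc t) (combine q r))))
    ≡⟨ sumF-cong 4 (λ q → trans
         (sumF-cong (4 ^ t) λ r → cong (λ qr → f (decode² (proj₁ qr) ∷ decode t (proj₂ qr))) (Fin.remQuot-combine q r))
         (sumF-decode t (λ z → f (decode² q ∷ z)))) ⟩
  sumF 4 (λ q → sumHyp t (λ z → f (decode² q ∷ z)))
    ≡⟨ solve 4 (λ a b c d → a :+ (b :+ (c :+ (d :+ con 0ℚ))) := (a :+ b) :+ (c :+ d)) refl
         (g zero) (g (suc zero)) (g (suc (suc zero))) (g (suc (suc (suc zero)))) ⟩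
  sumHyp (suc t) f ∎
  where
  open ≡-Reasoning
  open +-*-Solver
  g : Fin 4 → ℚ
  g q = sumHyp t (λ z → f (decode² q ∷ z))

-- Existence and minimality of the Fourier expansion

∈-allSubsets : ∀ {m} (x : Vec Bool m) → x ∈ allSubsets m
∈-allSubsets [] = here refl
∈-allSubsets {suc m} (true ∷ x) = ∈-++⁺ˡ (∈-map⁺ (true ∷_) (∈-allSubsets x))
∈-allSubsets {suc m} (false ∷ x) =
  ∈-++⁺ʳ (map (true ∷_) (allSubsets m)) (∈-++⁺ˡ (∈-map⁺ (false ∷_) (∈-allSubsets x)))

module _ {m} {P Q : Vec Bool m → Bool} (V : Subspace P) (D : Decomposition P Q (allSubsets m)) where
  open Decomposition D

  private
    L₀ : Vec Bool m → Bool
    L₀ x = L x xor L 𝟎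

    -- Every vector has been processed, so all of `P` is radical for `L`; a vanishing polar form
    -- says that `L` is additive up to its constant.
    L₀-additive : ∀ {x y} → P x ≡ true → P y ≡ true → L₀ (x ⊕ y) ≡ L₀ x xor L₀ y
    L₀-additive {x} {y} px py = trans (cong (_xor L 𝟎) (xor-move {L (x ⊕ y)} (All.lookup done-radical (∈-allSubsets x) px y py)))
      (tautology 3 (λ a b c → (false xor (a xor (b xor c))) xor c) (λ a b c → (a xor c) xor (b xor c)) refl (L x) (L y) (L 𝟎))

    -- The Gauss sum writes (-1)^arf through the characters `pair w`; multiplying by the linear part
    -- of `L` gives the characters that occur in (-1)^Q.
    functional : Hyp t → Vec Bool m → Bool
    functional w x = pair w (π x) xor L₀ x

    functional-additive : ∀ w {x y} → P x ≡ true → P y ≡ true →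
      functional w (x ⊕ y) ≡ functional w x xor functional w y
    functional-additive w {x} {y} px py =
      trans (cong₂ _xor_ (trans (cong (pair w) (π-⊕ x y)) (pair-⊞ w (π x) (π y))) (L₀-additive px py))
        (tautology 4 (λ a b c d → (a xor b) xor (c xor d)) (λ a b c d → (a xor c) xor (b xor d)) refl
          (pair w (π x)) (pair w (π y)) (L₀ x) (L₀ y))

    dual : (w : Hyp t) → Σ (Vec Bool m) λ o → ∀ x → P x ≡ true → functional w x ≡ dot o x
    dual w = extend-functional P V (functional w) (functional-additive w)

    -- The section turns the extended functional back into `pair w`, since on `s z` the summand `L₀`
    -- is common to all `w`. The choices made in the extension therefore cannot merge two
    -- characters.
    dual-injective : ∀ w w′ → proj₁ (dual w) ≡ proj₁ (dual w′) → w ≡ w′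
    dual-injective w w′ e = pair-nondegenerate w w′ λ z → begin
      pair w z ≡⟨ cong (pair w) (sym (π∘s z)) ⟩
      pair w (π (s z)) ≡⟨ xor-move {pair w (π (s z))} {L₀ (s z)} (proj₂ (dual w) (s z) (s∈P z)) ⟩
      dot (proj₁ (dual w)) (s z) xor L₀ (s z) ≡⟨ cong (λ o → dot o (s z) xor L₀ (s z)) e ⟩
      dot (proj₁ (dual w′)) (s z) xor L₀ (s z) ≡⟨ sym (xor-move {pair w′ (π (s z))} {L₀ (s z)} (proj₂ (dual w′) (s z) (s∈P z))) ⟩
      pair w′ (π (s z)) ≡⟨ cong (pair w′) (π∘s z) ⟩
      pair w′ z ∎
      where open ≡-Reasoning

  characters : Fin (4 ^ t) → Vec Bool m
  characters i = proj₁ (dual (decode t i))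

  characters-injective : ∀ i j → characters i ≡ characters j → i ≡ j
  characters-injective i j e = decode-injective t i j (dual-injective _ _ e)

  -- Fourier inversion of the Gauss sum: 2^-t times the sign of `arf`, and the constant sign of `L`.
  coefficients : Fin (4 ^ t) → ℚ
  coefficients i = sg (L 𝟎) ℚ.* (half t ℚ.* sg (arf (decode t i)))

  -- Once the linear part of `L` cancels, the sum over `w` is the Gauss sum at `π x`; its sign meets
  -- the remaining sign of `arf (π x)` and squares to 1.
  fourier-expansion : ∀ x → P x ≡ true →
    sumF (4 ^ t) (λ i → coefficients i ℚ.* sg (Q x xor dot (characters i) x)) ≡ 1ℚ
  fourier-expansion x px = begin
    sumF (4 ^ t) (λ i → coefficients i ℚ.* sg (Q x xor dot (characters i) x))
      ≡⟨ sumF-decode t (λ w → (sg (L 𝟎) ℚ.* (half t ℚ.* sg (arf w))) ℚ.* sg (Q x xor dot (proj₁ (dual w)) x)) ⟩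
    sumHyp t (λ w → (sg (L 𝟎) ℚ.* (half t ℚ.* sg (arf w))) ℚ.* sg (Q x xor dot (proj₁ (dual w)) x))
      ≡⟨ sumHyp-cong t term ⟩
    sumHyp t (λ w → (half t ℚ.* sg (arf (π x))) ℚ.* sg (pair (π x) w xor arf w))
      ≡⟨ sumHyp-scale t (half t ℚ.* sg (arf (π x))) (λ w → sg (pair (π x) w xor arf w)) ⟩
    (half t ℚ.* sg (arf (π x))) ℚ.* sumHyp t (λ w → sg (pair (π x) w xor arf w))
      ≡⟨ cong ((half t ℚ.* sg (arf (π x))) ℚ.*_) (gauss-sum t (π x)) ⟩
    (half t ℚ.* sg (arf (π x))) ℚ.* (two t ℚ.* sg (arf (π x)))
      ≡⟨ solve 3 (λ h s w → (h :* s) :* (w :* s) := (h :* w) :* (s :* s)) refl (half t) (sg (arf (π x))) (two t) ⟩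
    (half t ℚ.* two t) ℚ.* (sg (arf (π x)) ℚ.* sg (arf (π x)))
      ≡⟨ cong₂ ℚ._*_ (half*two t) (sg-square (arf (π x))) ⟩
    1ℚ ∎
    where
    open ≡-Reasoning
    open +-*-Solver
    bits : ∀ w → Q x xor dot (proj₁ (dual w)) x ≡ (arf (π x) xor L 𝟎) xor pair (π x) w
    bits w = trans (cong₂ _xor_ (split x) (sym (proj₂ (dual w) x px)))
      (trans (cong (λ r → (L x xor arf (π x)) xor (r xor (L x xor L 𝟎))) (pair-sym w (π x)))
      (tautology 4 (λ l a r o → (l xor a) xor (r xor (l xor o))) (λ l a r o → (a xor o) xor r) refl
        (L x) (arf (π x)) (pair (π x) w) (L 𝟎)))
    term : ∀ w → (sg (L 𝟎) ℚ.* (half t ℚ.* sg (arf w))) ℚ.* sg (Q x xor dot (proj₁ (dual w)) x)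
               ≡ (half t ℚ.* sg (arf (π x))) ℚ.* sg (pair (π x) w xor arf w)
    term w = begin
      (sg (L 𝟎) ℚ.* (half t ℚ.* sg (arf w))) ℚ.* sg (Q x xor dot (proj₁ (dual w)) x)
        ≡⟨ cong ((sg (L 𝟎) ℚ.* (half t ℚ.* sg (arf w))) ℚ.*_) (trans (cong sg (bits w))
             (trans (sg-xor (arf (π x) xor L 𝟎) _) (cong (ℚ._* sg (pair (π x) w)) (sg-xor (arf (π x)) (L 𝟎))))) ⟩
      (sg (L 𝟎) ℚ.* (half t ℚ.* sg (arf w))) ℚ.* ((sg (arf (π x)) ℚ.* sg (L 𝟎)) ℚ.* sg (pair (π x) w))
        ≡⟨ solve 5 (λ l h a b p → (l :* (h :* a)) :* ((b :* l) :* p) := (l :* l) :* ((h :* b) :* (p :* a))) refl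
             (sg (L 𝟎)) (half t) (sg (arf w)) (sg (arf (π x))) (sg (pair (π x) w)) ⟩
      (sg (L 𝟎) ℚ.* sg (L 𝟎)) ℚ.* ((half t ℚ.* sg (arf (π x))) ℚ.* (sg (pair (π x) w) ℚ.* sg (arf w)))
        ≡⟨ cong₂ ℚ._*_ (sg-square (L 𝟎)) (cong ((half t ℚ.* sg (arf (π x))) ℚ.*_) (sym (sg-xor (pair (π x) w) (arf w)))) ⟩
      1ℚ ℚ.* ((half t ℚ.* sg (arf (π x))) ℚ.* sg (pair (π x) w xor arf w))
        ≡⟨ ℚ.*-identityˡ _ ⟩
      (half t ℚ.* sg (arf (π x))) ℚ.* sg (pair (π x) w xor arf w) ∎

  module _ {k} (o : Fin k → Vec Bool m) (c : Fin k → ℚ)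
           (expansion : ∀ x → P x ≡ true → sumF k (λ i → c i ℚ.* sg (Q x xor dot (o i) x)) ≡ 1ℚ) where
    private
      -- The discrepancy, along the section, between the i-th given character and `functional w`. It
      -- is additive, so its signs sum to zero unless it vanishes identically.
      residual : Hyp t → Fin k → Hyp t → Bool
      residual w i z = functional w (s z) xor dot (o i) (s z)

      residual-additive : ∀ w i z z′ → residual w i (z ⊞ z′) ≡ residual w i z xor residual w i z′
      residual-additive w i z z′ = trans
        (trans (cong (λ x → functional w x xor dot (o i) x) (s-⊞ z z′))
          (cong₂ _xor_ (functional-additive w (s∈P z) (s∈P z′)) (dot-⊕ (o i) (s z) (s z′))))
        (tautology 4 (λ a b c d → (a xor b) xor (c xor d)) (λ a b c d → (a xor c) xor (b xor d)) refl
          (functional w (s z)) (functional w (s z′)) (dot (o i) (s z)) (dot (o i) (s z′)))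

      search-index : ∀ {n} (p : Fin n → Hyp t → Bool) →
        (Σ (Fin n) λ i → ∀ z → p i z ≡ false) ⊎ (∀ i → Σ (Hyp t) λ z → p i z ≡ true)
      search-index {zero} p = inj₂ λ ()
      search-index {suc n} p with searchHyp t (p zero) | search-index (λ i → p (suc i))
      ... | inj₂ none | _ = inj₁ (zero , none)
      ... | inj₁ _ | inj₁ (i , h) = inj₁ (suc i , h)
      ... | inj₁ w | inj₂ h = inj₂ λ { zero → w ; (suc i) → h i }

      -- The given expansion is tested at `s z` against the sign of `pair w z xor arf z` and summed
      -- over `z`. This reads off a Fourier coefficient without summing over all of `P`.
      gauss-expansion : ∀ w → two t ℚ.* sg (arf w) ≡
        sumF k (λ i → (c i ℚ.* sg (L 𝟎)) ℚ.* sumHyp t (λ z → sg (residual w i z)))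
      gauss-expansion w = begin
        two t ℚ.* sg (arf w) ≡⟨ sym (gauss-sum t w) ⟩
        sumHyp t (λ z → sg (pair w z xor arf z))
          ≡⟨ sumHyp-cong t (λ z → trans (sym (ℚ.*-identityʳ _)) (cong (sg (pair w z xor arf z) ℚ.*_) (sym (expansion (s z) (s∈P z))))) ⟩
        sumHyp t (λ z → sg (pair w z xor arf z) ℚ.* sumF k (λ i → c i ℚ.* sg (Q (s z) xor dot (o i) (s z))))
          ≡⟨ sumHyp-cong t (λ z → trans (sym (sumF-scale k (sg (pair w z xor arf z)) _)) (sumF-cong k (term z))) ⟩
        sumHyp t (λ z → sumF k (λ i → (c i ℚ.* sg (L 𝟎)) ℚ.* sg (residual w i z)))
          ≡⟨ sumHyp-sumF t k (λ i z → (c i ℚ.* sg (L 𝟎)) ℚ.* sg (residual w i z)) ⟩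
        sumF k (λ i → sumHyp t (λ z → (c i ℚ.* sg (L 𝟎)) ℚ.* sg (residual w i z)))
          ≡⟨ sumF-cong k (λ i → sumHyp-scale t (c i ℚ.* sg (L 𝟎)) _) ⟩
        sumF k (λ i → (c i ℚ.* sg (L 𝟎)) ℚ.* sumHyp t (λ z → sg (residual w i z))) ∎
        where
        open ≡-Reasoning
        open +-*-Solver
        bits : ∀ z i → (pair w z xor arf z) xor (Q (s z) xor dot (o i) (s z)) ≡ L 𝟎 xor residual w i z
        bits z i = trans (cong (λ q → (pair w z xor arf z) xor (q xor dot (o i) (s z)))
            (trans (split (s z)) (cong (λ r → L (s z) xor arf r) (π∘s z))))
          (trans (tautology 5 (λ p a l d o → (p xor a) xor ((l xor a) xor d)) (λ p a l d o → o xor ((p xor (l xor o)) xor d)) refl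
            (pair w z) (arf z) (L (s z)) (dot (o i) (s z)) (L 𝟎))
            (cong (λ r → L 𝟎 xor ((pair w r xor L₀ (s z)) xor dot (o i) (s z))) (sym (π∘s z))))
        term : ∀ z i → sg (pair w z xor arf z) ℚ.* (c i ℚ.* sg (Q (s z) xor dot (o i) (s z))) ≡ (c i ℚ.* sg (L 𝟎)) ℚ.* sg (residual w i z)
        term z i = begin
          sg (pair w z xor arf z) ℚ.* (c i ℚ.* sg (Q (s z) xor dot (o i) (s z)))
            ≡⟨ solve 3 (λ a b d → a :* (b :* d) := b :* (a :* d)) refl (sg (pair w z xor arf z)) (c i) (sg (Q (s z) xor dot (o i) (s z))) ⟩
          c i ℚ.* (sg (pair w z xor arf z) ℚ.* sg (Q (s z) xor dot (o i) (s z)))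
            ≡⟨ cong (c i ℚ.*_) (trans (sym (sg-xor (pair w z xor arf z) _)) (trans (cong sg (bits z i)) (sg-xor (L 𝟎) _))) ⟩
          c i ℚ.* (sg (L 𝟎) ℚ.* sg (residual w i z))
            ≡⟨ sym (ℚ.*-assoc (c i) _ _) ⟩
          (c i ℚ.* sg (L 𝟎)) ℚ.* sg (residual w i z) ∎

      gauss≢0 : ∀ (w : Hyp t) → two t ℚ.* sg (arf w) ≢ 0ℚ
      gauss≢0 w e = contradiction (begin
        1ℚ ≡⟨ sym (cong₂ ℚ._*_ (half*two t) (sg-square (arf w))) ⟩
        (half t ℚ.* two t) ℚ.* (sg (arf w) ℚ.* sg (arf w))
          ≡⟨ solve 3 (λ h s w → (h :* w) :* (s :* s) := (h :* s) :* (w :* s)) refl (half t) (sg (arf w)) (two t) ⟩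
        (half t ℚ.* sg (arf w)) ℚ.* (two t ℚ.* sg (arf w)) ≡⟨ cong ((half t ℚ.* sg (arf w)) ℚ.*_) e ⟩
        (half t ℚ.* sg (arf w)) ℚ.* 0ℚ ≡⟨ ℚ.*-zeroʳ (half t ℚ.* sg (arf w)) ⟩
        0ℚ ∎) λ ()
        where
        open ≡-Reasoning
        open +-*-Solver

      index : ∀ (w : Hyp t) → Σ (Fin k) λ i → ∀ z → residual w i z ≡ false
      index w with search-index (residual w)
      ... | inj₁ h = h
      -- Were every residual odd somewhere, all character sums on the right would vanish, against
      -- the nonzero Gauss sum on the left.
      ... | inj₂ odd = ⊥-elim (gauss≢0 w (trans (gauss-expansion w) (sumF-zero k λ i →
              trans (cong ((c i ℚ.* sg (L 𝟎)) ℚ.*_)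
                (character-sum t (residual w i) (residual-additive w i) (proj₁ (odd i)) (proj₂ (odd i))))
              (ℚ.*-zeroʳ (c i ℚ.* sg (L 𝟎))))))

      -- One given character cannot serve two points: where its residual vanishes, it determines
      -- `pair w` through the section.
      index-injective : ∀ w w′ → proj₁ (index w) ≡ proj₁ (index w′) → w ≡ w′
      index-injective w w′ e = pair-nondegenerate w w′ λ z → begin
        pair w z ≡⟨ recover w z ⟩
        (false xor dot (o (proj₁ (index w))) (s z)) xor L₀ (s z) ≡⟨ cong (λ i → (false xor dot (o i) (s z)) xor L₀ (s z)) e ⟩
        (false xor dot (o (proj₁ (index w′))) (s z)) xor L₀ (s z) ≡⟨ sym (recover w′ z) ⟩
        pair w′ z ∎
        where
        open ≡-Reasoning
        recover : ∀ w z → pair w z ≡ (false xor dot (o (proj₁ (index w))) (s z)) xor L₀ (s z)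
        recover w z = trans (cong (pair w) (sym (π∘s z)))
          (xor-move {pair w (π (s z))} {L₀ (s z)} (xor-move {functional w (s z)} (proj₂ (index w) z)))

    fourier-minimality : 4 ^ t ≤ k
    fourier-minimality = Fin.injective⇒≤ {f = λ i → proj₁ (index (decode t i))}
      λ {i} {j} e → decode-injective t i j (index-injective _ _ e)

-- Sums with at most one nonzero term, and sums over the edges of the blow-up

sumF-single : ∀ k (f : Fin k → ℚ) i → (∀ j → j ≢ i → f j ≡ 0ℚ) → sumF k f ≡ f i
sumF-single (suc k) f zero h = trans (cong (f zero ℚ.+_) (sumF-zero k λ i → h (suc i) λ ())) (ℚ.+-identityʳ (f zero))
sumF-single (suc k) f (suc i) h = trans (cong₂ ℚ._+_ (h zero λ ())
  (sumF-single k (f ∘ suc) i λ j j≢i → h (suc j) λ e → j≢i (Fin.suc-injective e))) (ℚ.+-identityˡ (f (suc i)))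

sumF-nonzero : ∀ k (f : Fin k → ℚ) → sumF k f ≢ 0ℚ → Σ (Fin k) λ i → f i ≢ 0ℚ
sumF-nonzero zero f h = contradiction refl h
sumF-nonzero (suc k) f h with f zero ℚ.≟ 0ℚ
... | no nz = zero , nz
... | yes z with sumF-nonzero k (f ∘ suc) (λ e → h (cong₂ ℚ._+_ z e))
...   | i , nz = suc i , nz

sumFinP-eval : ∀ {m} k (f : Fin k → Poly m) α → sumFinP k f α ≡ sumF k (λ i → f i α)
sumFinP-eval zero f α = refl
sumFinP-eval (suc k) f α = cong (f zero α ℚ.+_) (sumFinP-eval k (f ∘ suc) α)

module _ {A : Set} where

  listSum : (A → ℚ) → List A → ℚ
  listSum g l = sumℚ (map g l)

  listSum-zero : ∀ (g : A → ℚ) l → (∀ {b} → b ∈ l → g b ≡ 0ℚ) → listSum g l ≡ 0ℚ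
  listSum-zero g [] h = refl
  listSum-zero g (x ∷ l) h = cong₂ ℚ._+_ (h (here refl)) (listSum-zero g l (h ∘ there))

  listSum-single : ∀ (g : A → ℚ) {l b} → Unique l → b ∈ l → (∀ {b′} → b′ ∈ l → b′ ≢ b → g b′ ≡ 0ℚ) → listSum g l ≡ g b
  listSum-single g {x ∷ l} (x∉l ∷ u) (here refl) h =
    trans (cong (g x ℚ.+_) (listSum-zero g l λ b∈l → h (there b∈l) (λ e → All.lookup x∉l b∈l (sym e)))) (ℚ.+-identityʳ (g x))
  listSum-single g {x ∷ l} (x∉l ∷ u) (there b∈l) h =
    trans (cong₂ ℚ._+_ (h (here refl) (All.lookup x∉l b∈l)) (listSum-single g u b∈l (h ∘ there))) (ℚ.+-identityˡ _)

  listSum-nonzero : ∀ (g : A → ℚ) l → listSum g l ≢ 0ℚ → Σ A λ b → (b ∈ l) × (g b ≢ 0ℚ)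
  listSum-nonzero g [] h = contradiction refl h
  listSum-nonzero g (x ∷ l) h with g x ℚ.≟ 0ℚ
  ... | no nz = x , here refl , nz
  ... | yes z with listSum-nonzero g l (λ e → h (cong₂ ℚ._+_ z e))
  ...   | b , b∈l , nz = b , there b∈l , nz

  listSum-+ : ∀ (f g : A → ℚ) l → listSum (λ b → f b ℚ.+ g b) l ≡ listSum f l ℚ.+ listSum g l
  listSum-+ f g [] = refl
  listSum-+ f g (x ∷ l) = trans (cong (f x ℚ.+ g x ℚ.+_) (listSum-+ f g l))
    (solve 4 (λ a b c d → (a :+ b) :+ (c :+ d) := (a :+ c) :+ (b :+ d)) refl (f x) (g x) (listSum f l) (listSum g l))
    where open +-*-Solver

  listSum-neg : ∀ (f : A → ℚ) l → listSum (λ b → ℚ.- f b) l ≡ ℚ.- listSum f l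
  listSum-neg f [] = refl
  listSum-neg f (x ∷ l) = trans (cong (ℚ.- f x ℚ.+_) (listSum-neg f l)) (sym (ℚ.neg-distrib-+ (f x) (listSum f l)))

  listSum-cong : ∀ {f g : A → ℚ} l → (∀ b → f b ≡ g b) → listSum f l ≡ listSum g l
  listSum-cong l h = cong sumℚ (List.map-cong h l)

-- Products with monomials

concatMap-map : ∀ {A B C : Set} (f : A → B → C) xs ys → concatMap (λ x → map (f x) ys) xs ≡ List.cartesianProductWith f xs ys
concatMap-map f [] ys = refl
concatMap-map f (x ∷ xs) ys = cong (map (f x) ys ++_) (concatMap-map f xs ys)

below-unique : ∀ {m} (α : Mono m) → Unique (below α)
below-unique [] = [] ∷ []
below-unique (a ∷ α) = subst Unique (sym (concatMap-map _∷_ (upTo (suc a)) (below α)))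
  (Unique.cartesianProductWith⁺ _∷_ (λ { refl → refl , refl }) (Unique.upTo⁺ (suc a)) (below-unique α))

_⊹_ : ∀ {m} → Mono m → Mono m → Mono m
_⊹_ = zipWith ℕ._+_

infixr 6 _⊹_

∈-below : ∀ {m} (β γ : Mono m) → β ∈ below (β ⊹ γ)
∈-below [] [] = here refl
∈-below (b ∷ β) (c ∷ γ) = subst ((b ∷ β) ∈_) (sym (concatMap-map _∷_ (upTo (suc (b ℕ.+ c))) (below (β ⊹ γ))))
  (∈-cartesianProductWith⁺ _∷_ (∈-upTo⁺ (ℕ.s≤s (ℕ.m≤m+n b c))) (∈-below β γ))

below-∈ : ∀ {m} {α β : Mono m} → β ∈ below α → α ≡ β ⊹ zipWith ℕ._∸_ α β
below-∈ {α = []} {[]} _ = refl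
below-∈ {α = a ∷ α} {b ∷ β} h
  with ∈-cartesianProductWith⁻ _∷_ (upTo (suc a)) (below α) (subst ((b ∷ β) ∈_) (concatMap-map _∷_ (upTo (suc a)) (below α)) h)
... | _ , _ , p , q , refl = cong₂ _∷_ (sym (ℕ.m+[n∸m]≡n (ℕ.s≤s⁻¹ (∈-upTo⁻ p)))) (below-∈ q)

⊹-∸ : ∀ {m} (β γ : Mono m) → zipWith ℕ._∸_ (β ⊹ γ) β ≡ γ
⊹-∸ [] [] = refl
⊹-∸ (b ∷ β) (c ∷ γ) = cong₂ _∷_ (ℕ.m+n∸m≡n b c) (⊹-∸ β γ)

monoP-hit : ∀ {m} (β : Mono m) → monoP β β ≡ 1ℚ
monoP-hit β = cong (if_then 1ℚ else 0ℚ) (dec-true (Vec.≡-dec ℕ._≟_ β β) refl)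

monoP-miss : ∀ {m} {β α : Mono m} → β ≢ α → monoP β α ≡ 0ℚ
monoP-miss {β = β} {α} h = cong (if_then 1ℚ else 0ℚ) (dec-false (Vec.≡-dec ℕ._≟_ α β) (h ∘ sym))

-- In the convolution over the exponents below `β ⊹ γ` only the divisor `β` contributes.
-- Coefficients of the Pfaffian expansion are reached through this and distributivity.
monoP-* : ∀ {m} (β γ : Mono m) (q : Poly m) → (monoP β *P q) (β ⊹ γ) ≡ q γ
monoP-* β γ q = trans
  (listSum-single (λ δ → monoP β δ ℚ.* q (zipWith ℕ._∸_ (β ⊹ γ) δ)) (below-unique (β ⊹ γ)) (∈-below β γ)
    λ {δ} _ δ≢β → trans (cong (ℚ._* q (zipWith ℕ._∸_ (β ⊹ γ) δ)) (monoP-miss (δ≢β ∘ sym))) (ℚ.*-zeroˡ (q (zipWith ℕ._∸_ (β ⊹ γ) δ))))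
  (trans (cong₂ ℚ._*_ (monoP-hit β) (cong q (⊹-∸ β γ))) (ℚ.*-identityˡ (q γ)))

monoP-*-nonzero : ∀ {m} (β α : Mono m) (q : Poly m) → (monoP β *P q) α ≢ 0ℚ → Σ (Mono m) λ γ → (α ≡ β ⊹ γ) × (q γ ≢ 0ℚ)
monoP-*-nonzero β α q h with listSum-nonzero (λ δ → monoP β δ ℚ.* q (zipWith ℕ._∸_ α δ)) (below α) h
... | δ , δ∈ , nz with Vec.≡-dec ℕ._≟_ β δ
...   | no β≢δ = contradiction (trans (cong (ℚ._* q (zipWith ℕ._∸_ α δ)) (monoP-miss β≢δ)) (ℚ.*-zeroˡ (q (zipWith ℕ._∸_ α δ)))) nz
...   | yes refl = zipWith ℕ._∸_ α β , below-∈ δ∈ , λ e → nz (trans (cong (monoP β β ℚ.*_) e) (ℚ.*-zeroʳ (monoP β β)))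

0P-* : ∀ {m} (q : Poly m) α → (0P *P q) α ≡ 0ℚ
0P-* q α = listSum-zero _ (below α) λ {δ} _ → ℚ.*-zeroˡ (q (zipWith ℕ._∸_ α δ))

neg-* : ∀ {m} (p q : Poly m) α → ((-P p) *P q) α ≡ ℚ.- (p *P q) α
neg-* p q α = trans (listSum-cong (below α) λ δ → sym (ℚ.neg-distribˡ-* (p δ) _)) (listSum-neg _ (below α))

+P-* : ∀ {m} (p p′ q : Poly m) α → ((p +P p′) *P q) α ≡ (p *P q) α ℚ.+ (p′ *P q) α
+P-* p p′ q α = trans (listSum-cong (below α) λ δ → ℚ.*-distribʳ-+ _ (p δ) (p′ δ)) (listSum-+ _ _ (below α))

sumFinP-* : ∀ {m} k (f : Fin k → Poly m) q α → (sumFinP k f *P q) α ≡ sumF k (λ i → (f i *P q) α)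
sumFinP-* zero f q α = 0P-* q α
sumFinP-* (suc k) f q α = trans (+P-* (f zero) (sumFinP k (f ∘ suc)) q α) (cong ((f zero *P q) α ℚ.+_) (sumFinP-* k (f ∘ suc) q α))

module _ (G : Graph) where

  gadgetSum : ∀ v → (GadgetEdge G v → ℚ) → ℚ
  gadgetSum v f = sumF (6 ℕ.* deg G v ℕ.∸ 1) (λ j → f (inj₁ j)) ℚ.+ sumF (2 ℕ.* deg G v) (λ j → f (inj₂ j))

  edgeSum : (BEdge G → ℚ) → ℚ
  edgeSum f = sumF (nE G) (λ e → f (inj₁ e)) ℚ.+ sumF (nV G) (λ v → gadgetSum v (λ g → f (inj₂ (v , g))))

  sumBEdge-* : ∀ f q α → (sumBEdge G f *P q) α ≡ edgeSum (λ e → (f e *P q) α)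
  sumBEdge-* f q α = trans (+P-* (sumFinP (nE G) λ e → f (inj₁ e)) (sumFinP (nV G) λ v → paths v +P chords v) q α)
    (cong₂ ℚ._+_ (sumFinP-* (nE G) (λ e → f (inj₁ e)) q α)
      (trans (sumFinP-* (nV G) (λ v → paths v +P chords v) q α) (sumF-cong (nV G) λ v → trans (+P-* (paths v) (chords v) q α)
        (cong₂ ℚ._+_ (sumFinP-* (6 ℕ.* deg G v ℕ.∸ 1) (λ j → f (inj₂ (v , inj₁ j))) q α)
                     (sumFinP-* (2 ℕ.* deg G v) (λ j → f (inj₂ (v , inj₂ j))) q α)))))
    where
    paths chords : Fin (nV G) → Poly (nE G)
    paths v = sumFinP (6 ℕ.* deg G v ℕ.∸ 1) λ j → f (inj₂ (v , inj₁ j))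
    chords v = sumFinP (2 ℕ.* deg G v) λ j → f (inj₂ (v , inj₂ j))

  +-nonzero : ∀ {p q} → p ℚ.+ q ≢ 0ℚ → (p ≢ 0ℚ) ⊎ (q ≢ 0ℚ)
  +-nonzero {p} {q} h with p ℚ.≟ 0ℚ
  ... | no nz = inj₁ nz
  ... | yes z = inj₂ λ e → h (cong₂ ℚ._+_ z e)

  edgeSum-nonzero : ∀ f → edgeSum f ≢ 0ℚ → Σ (BEdge G) λ e → f e ≢ 0ℚ
  edgeSum-nonzero f h with +-nonzero {sumF (nE G) (λ e → f (inj₁ e))} h
  ... | inj₁ nz with sumF-nonzero (nE G) _ nz
  ...   | e , nz′ = inj₁ e , nz′
  edgeSum-nonzero f h | inj₂ nz with sumF-nonzero (nV G) _ nz
  ... | v , nz′ with +-nonzero {sumF (6 ℕ.* deg G v ℕ.∸ 1) (λ j → f (inj₂ (v , inj₁ j)))} nz′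
  ...   | inj₁ nz″ with sumF-nonzero (6 ℕ.* deg G v ℕ.∸ 1) _ nz″
  ...     | j , nz‴ = inj₂ (v , inj₁ j) , nz‴
  edgeSum-nonzero f h | inj₂ nz | v , nz′ | inj₂ nz″ with sumF-nonzero (2 ℕ.* deg G v) _ nz″
  ... | j , nz‴ = inj₂ (v , inj₂ j) , nz‴

  gadgetSum-zero : ∀ v f → (∀ g → f g ≡ 0ℚ) → gadgetSum v f ≡ 0ℚ
  gadgetSum-zero v f h = cong₂ ℚ._+_ (sumF-zero (6 ℕ.* deg G v ℕ.∸ 1) (λ j → h (inj₁ j))) (sumF-zero (2 ℕ.* deg G v) (λ j → h (inj₂ j)))

  edgeSum-single : ∀ f e → (∀ e′ → e′ ≢ e → f e′ ≡ 0ℚ) → edgeSum f ≡ f e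
  edgeSum-single f (inj₁ e) h = trans
    (cong₂ ℚ._+_ (sumF-single (nE G) _ e λ j j≢e → h (inj₁ j) λ { refl → j≢e refl })
                 (sumF-zero (nV G) λ v → gadgetSum-zero v _ λ g → h (inj₂ (v , g)) λ ()))
    (ℚ.+-identityʳ _)
  edgeSum-single f (inj₂ (v , g)) h = trans
    (cong₂ ℚ._+_ (sumF-zero (nE G) λ j → h (inj₁ j) λ ())
      (trans (sumF-single (nV G) _ v λ w w≢v → gadgetSum-zero w _ λ g → h (inj₂ (w , g)) λ { refl → w≢v refl }) (inner g h)))
    (ℚ.+-identityˡ _)
    where
    inner : ∀ g → (∀ e′ → e′ ≢ inj₂ (v , g) → f e′ ≡ 0ℚ) → gadgetSum v (λ g → f (inj₂ (v , g))) ≡ f (inj₂ (v , g))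
    inner (inj₁ j) h = trans (cong₂ ℚ._+_
      (sumF-single (6 ℕ.* deg G v ℕ.∸ 1) _ j λ j′ ne → h (inj₂ (v , inj₁ j′)) λ { refl → ne refl })
      (sumF-zero (2 ℕ.* deg G v) λ j′ → h (inj₂ (v , inj₂ j′)) λ ())) (ℚ.+-identityʳ _)
    inner (inj₂ j) h = trans (cong₂ ℚ._+_
      (sumF-zero (6 ℕ.* deg G v ℕ.∸ 1) λ j′ → h (inj₂ (v , inj₁ j′)) λ ())
      (sumF-single (2 ℕ.* deg G v) _ j λ j′ ne → h (inj₂ (v , inj₂ j′)) λ { refl → ne refl })) (ℚ.+-identityˡ _)

-- Signs of orderings

oddℕ : ℕ → Bool
oddℕ zero = false
oddℕ (suc n) = not (oddℕ n)

oddℕ-+ : ∀ a b → oddℕ (a ℕ.+ b) ≡ oddℕ a xor oddℕ b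
oddℕ-+ zero b = refl
oddℕ-+ (suc a) b = trans (cong not (oddℕ-+ a b)) (tautology 2 (λ a b → not (a xor b)) (λ a b → not a xor b) refl (oddℕ a) (oddℕ b))

%2-odd : ∀ n → ((n % 2) ≡ᵇ 0) ≡ not (oddℕ n)
%2-odd zero = refl
%2-odd (suc zero) = refl
%2-odd (suc (suc n)) = trans (cong (_≡ᵇ 0) (trans (cong (_% 2) (ℕ.+-comm 2 n)) (ℕ.[m+n]%n≡m%n n 2)))
  (trans (%2-odd n) (tautology 1 not (λ a → not (not (not a))) refl (oddℕ n)))

unique-↭ : ∀ {A : Set} {xs ys : List A} → xs ↭ ys → Unique xs → Unique ys
unique-↭ {A} p = PermSetoid.Unique-resp-↭ (≡.setoid A) (↭⇒↭ₛ p)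

tabulate-↭ : ∀ {A : Set} {k} (f : Fin (suc k) → A) j → tabulate f ↭ f j ∷ tabulate (f ∘ punchIn j)
tabulate-↭ f zero = ↭-refl
tabulate-↭ {k = suc k} f (suc j) = ↭-trans (↭-prep (f zero) (tabulate-↭ (f ∘ suc) j)) (↭-swap (f zero) (f (suc j)) ↭-refl)

module Inversions {X : Set} (T : X → X → Bool) (tournament : ∀ {p q} → p ≢ q → T q p ≡ not (T p q)) where

  before : X → List X → Bool
  before x [] = false
  before x (y ∷ l) = T y x xor before x l

  -- Reading `T y x` as "y precedes x", this is the number of inversions mod 2, the sign exponent of
  -- a word relative to `T`.
  inv : List X → Bool
  inv [] = false
  inv (x ∷ l) = before x l xor inv l

  before-↭ : ∀ x {l l′} → l ↭ l′ → before x l ≡ before x l′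
  before-↭ x Perm.refl = refl
  before-↭ x (Perm.prep y p) = cong (T y x xor_) (before-↭ x p)
  before-↭ x (Perm.swap {l} {l′} y z p) = trans (cong (λ r → T y x xor (T z x xor r)) (before-↭ x p))
    (tautology 3 (λ a b c → a xor (b xor c)) (λ a b c → b xor (a xor c)) refl (T y x) (T z x) (before x l′))
  before-↭ x (Perm.trans p q) = trans (before-↭ x p) (before-↭ x q)

  inv-swap : ∀ {x y} l → x ≢ y → inv (y ∷ x ∷ l) ≡ not (inv (x ∷ y ∷ l))
  inv-swap {x} {y} l x≢y = trans
    (tautology 4 (λ t a b c → (t xor a) xor (b xor c)) (λ t a b c → not ((not t xor b) xor (a xor c))) refl
      (T x y) (before y l) (before x l) (inv l))
    (cong (λ t → not ((t xor before x l) xor (before y l xor inv l))) (sym (tournament x≢y)))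

  -- Moving entry `j` to the front takes j adjacent swaps, whose parity is the sign of the j-th term
  -- in the row expansion of the Pfaffian.
  inv-tabulate : ∀ {k} (f : Fin (suc k) → X) → (∀ {i j} → f i ≡ f j → i ≡ j) → ∀ j →
    inv (tabulate f) ≡ oddℕ (toℕ j) xor inv (f j ∷ tabulate (f ∘ punchIn j))
  inv-tabulate f inj zero = refl
  inv-tabulate {suc k} f inj (suc j) = begin
    before (f zero) (tabulate (f ∘ suc)) xor inv (tabulate (f ∘ suc))
      ≡⟨ cong₂ _xor_ (before-↭ (f zero) (tabulate-↭ (f ∘ suc) j)) (inv-tabulate (f ∘ suc) (Fin.suc-injective ∘ inj) j) ⟩
    before (f zero) (f (suc j) ∷ r) xor (oddℕ (toℕ j) xor inv (f (suc j) ∷ r))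
      ≡⟨ tautology 3 (λ a b c → a xor (b xor c)) (λ a b c → not b xor (not (a xor c))) refl
          (before (f zero) (f (suc j) ∷ r)) (oddℕ (toℕ j)) (inv (f (suc j) ∷ r)) ⟩
    not (oddℕ (toℕ j)) xor not (inv (f zero ∷ f (suc j) ∷ r))
      ≡⟨ cong (not (oddℕ (toℕ j)) xor_) (sym (inv-swap {f zero} {f (suc j)} r λ e → contradiction (inj e) λ ())) ⟩
    not (oddℕ (toℕ j)) xor inv (f (suc j) ∷ f zero ∷ r) ∎
    where
    open ≡-Reasoning
    r : List X
    r = tabulate (f ∘ suc ∘ punchIn j)

  module Pairs {E : Set} (tl hd : E → X) where

    verts : List E → List X
    verts [] = []
    verts (e ∷ es) = tl e ∷ hd e ∷ verts es

    verts-↭ : ∀ {es es′} → es ↭ es′ → verts es ↭ verts es′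
    verts-↭ Perm.refl = ↭-refl
    verts-↭ (Perm.prep e p) = ↭-prep _ (↭-prep _ (verts-↭ p))
    verts-↭ (Perm.swap e f p) = ↭-trans (↭-prep _ (↭-prep _ (↭-prep _ (↭-prep _ (verts-↭ p)))))
      (Perm.shifts (tl e ∷ hd e ∷ []) (tl f ∷ hd f ∷ []))
    verts-↭ (Perm.trans p q) = ↭-trans (verts-↭ p) (verts-↭ q)

    verts-++ : ∀ es fs → verts (es ++ fs) ≡ verts es ++ verts fs
    verts-++ [] fs = refl
    verts-++ (e ∷ es) fs = cong (λ l → tl e ∷ hd e ∷ l) (verts-++ es fs)

    ∈-verts : ∀ {e x es} → e ∈ es → (x ≡ tl e) ⊎ (x ≡ hd e) → x ∈ verts es
    ∈-verts (here refl) (inj₁ p) = here p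
    ∈-verts (here refl) (inj₂ p) = there (here p)
    ∈-verts (there i) p = there (there (∈-verts i p))

    verts-∈ : ∀ {x} es → x ∈ verts es → Σ E λ e → (e ∈ es) × ((x ≡ tl e) ⊎ (x ≡ hd e))
    verts-∈ (e ∷ es) (here p) = e , here refl , inj₁ p
    verts-∈ (e ∷ es) (there (here p)) = e , here refl , inj₂ p
    verts-∈ (e ∷ es) (there (there i)) with verts-∈ es i
    ... | f , f∈ , p = f , there f∈ , p

    -- Pairs have even length, so permuting them does not change the sign.
    inv-verts-↭ : ∀ {es es′} → es ↭ es′ → Unique (verts es) → inv (verts es) ≡ inv (verts es′)
    inv-verts-↭ Perm.refl u = refl
    inv-verts-↭ (Perm.prep e p) (_ ∷ _ ∷ u) =
      cong₂ (λ a b → (T (hd e) (tl e) xor a) xor b) (before-↭ (tl e) (verts-↭ p))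
        (cong₂ _xor_ (before-↭ (hd e) (verts-↭ p)) (inv-verts-↭ p u))
    inv-verts-↭ (Perm.swap {es} {es′} e f p) ((_ ∷ ac ∷ ad ∷ _) ∷ (bc ∷ bd ∷ _) ∷ _ ∷ _ ∷ u) = begin
      (T b a xor (T c a xor (T d a xor before a V))) xor
        ((T c b xor (T d b xor before b V)) xor ((T d c xor before c V) xor (before d V xor inv V)))
        ≡⟨ cong₂ (λ s t → (T b a xor (T c a xor (T d a xor before a V))) xor
             ((T c b xor (T d b xor before b V)) xor ((T d c xor s) xor t)))
             (before-↭ c (verts-↭ p)) (cong₂ _xor_ (before-↭ d (verts-↭ p)) (inv-verts-↭ p u)) ⟩
      (T b a xor (T c a xor (T d a xor before a V))) xor
        ((T c b xor (T d b xor before b V)) xor ((T d c xor before c V′) xor (before d V′ xor inv V′)))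
        ≡⟨ cong₂ (λ s t → (T b a xor (T c a xor (T d a xor s))) xor
             ((T c b xor (T d b xor t)) xor ((T d c xor before c V′) xor (before d V′ xor inv V′))))
             (before-↭ a (verts-↭ p)) (before-↭ b (verts-↭ p)) ⟩
      (T b a xor (T c a xor (T d a xor before a V′))) xor
        ((T c b xor (T d b xor before b V′)) xor ((T d c xor before c V′) xor R))
        ≡⟨ cong₂ (λ s t → (T b a xor (s xor (t xor before a V′))) xor
             ((T c b xor (T d b xor before b V′)) xor ((T d c xor before c V′) xor R))) (tournament ac) (tournament ad) ⟩
      (T b a xor (not (T a c) xor (not (T a d) xor before a V′))) xor
        ((T c b xor (T d b xor before b V′)) xor ((T d c xor before c V′) xor R))
        ≡⟨ cong₂ (λ s t → (T b a xor (not (T a c) xor (not (T a d) xor before a V′))) xor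
             ((s xor (t xor before b V′)) xor ((T d c xor before c V′) xor R))) (tournament bc) (tournament bd) ⟩
      (T b a xor (not (T a c) xor (not (T a d) xor before a V′))) xor
        ((not (T b c) xor (not (T b d) xor before b V′)) xor ((T d c xor before c V′) xor R))
        ≡⟨ tautology 10 (λ ba ac ad bc bd dc pa pb pc r →
             (ba xor (not ac xor (not ad xor pa))) xor ((not bc xor (not bd xor pb)) xor ((dc xor pc) xor r)))
             (λ ba ac ad bc bd dc pa pb pc r →
             (dc xor (ac xor (bc xor pc))) xor ((ad xor (bd xor r)) xor ((ba xor pa) xor pb))) refl
             (T b a) (T a c) (T a d) (T b c) (T b d) (T d c) (before a V′) (before b V′) (before c V′) R ⟩
      (T d c xor (T a c xor (T b c xor before c V′))) xor
        ((T a d xor (T b d xor R)) xor ((T b a xor before a V′) xor before b V′))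
        ≡⟨ tautology 8 (λ x ad bd pd i ba pa pb → x xor ((ad xor (bd xor (pd xor i))) xor ((ba xor pa) xor pb)))
             (λ x ad bd pd i ba pa pb → x xor ((ad xor (bd xor pd)) xor ((ba xor pa) xor (pb xor i)))) refl
             (T d c xor (T a c xor (T b c xor before c V′))) (T a d) (T b d) (before d V′) (inv V′) (T b a) (before a V′) (before b V′) ⟩
      (T d c xor (T a c xor (T b c xor before c V′))) xor
        ((T a d xor (T b d xor before d V′)) xor ((T b a xor before a V′) xor (before b V′ xor inv V′))) ∎
      where
      open ≡-Reasoning
      a b c d : X
      a = tl e
      b = hd e
      c = tl f
      d = hd f
      V V′ : List X
      V = verts es
      V′ = verts es′
      R : Bool
      R = before d V′ xor inv V′
    inv-verts-↭ (Perm.trans p q) u = trans (inv-verts-↭ p u) (inv-verts-↭ q (unique-↭ (verts-↭ p) u))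

-- Coefficients of Pfaffians

odd-sign : ℕ → ℚ → ℚ
odd-sign j x = sg (oddℕ j) ℚ.* x

Pf-sign : ∀ {m} j (p : Poly m) α → (if (j % 2) ≡ᵇ 0 then (λ p → p) else -P_) p α ≡ odd-sign j (p α)
Pf-sign j p α rewrite %2-odd j with oddℕ j
... | false = sym (ℚ.*-identityˡ (p α))
... | true = trans (cong ℚ.-_ (sym (ℚ.*-identityˡ (p α)))) (ℚ.neg-distribˡ-* 1ℚ (p α))

-- The Boolean is `true` when `e` runs from `y` to `x`, so `sg` of it is the sign with which `e`
-- enters the matrix entry at (x, y).
Joins : {E X : Set} (tl hd : E → X) → E → X → X → Bool → Set
Joins tl hd e x y false = (tl e ≡ x) × (hd e ≡ y)
Joins tl hd e x y true = (tl e ≡ y) × (hd e ≡ x)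

module Weights {E : Set} {m : ℕ} (wt : E → Mono m) where

  weight : List E → Mono m
  weight [] = replicate m 0
  weight (e ∷ es) = wt e ⊹ weight es

  weight-↭ : ∀ {es es′} → es ↭ es′ → weight es ≡ weight es′
  weight-↭ Perm.refl = refl
  weight-↭ (Perm.prep e p) = cong (wt e ⊹_) (weight-↭ p)
  weight-↭ (Perm.swap {es} {es′} e f p) = trans (cong (λ w → wt e ⊹ wt f ⊹ w) (weight-↭ p)) (exchange (wt e) (wt f) (weight es′))
    where
    exchange : ∀ {m} (a b c : Mono m) → a ⊹ b ⊹ c ≡ b ⊹ a ⊹ c
    exchange [] [] [] = refl
    exchange (a ∷ as) (b ∷ bs) (c ∷ cs) = cong₂ _∷_
      (trans (sym (ℕ.+-assoc a b c)) (trans (cong (ℕ._+ c) (ℕ.+-comm a b)) (ℕ.+-assoc b a c))) (exchange as bs cs)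
  weight-↭ (Perm.trans p q) = trans (weight-↭ p) (weight-↭ q)

-- Entries are described through their products with a further factor `q`, as the row expansion
-- meets them. The uniqueness premise of `entry-single` excludes another edge between the same
-- vertices that gives the same monomial with a nonzero cofactor, hence any cancellation inside an
-- entry.
module PfaffianExpansion
  {E X : Set} (T : X → X → Bool) (tournament : ∀ {p q} → p ≢ q → T q p ≡ not (T p q))
  (tl hd : E → X) {m N : ℕ} (wt : E → Mono m)
  (ℓ : Fin N → X) (ℓ-injective : ∀ {i j} → ℓ i ≡ ℓ j → i ≡ j) (A : Fin N → Fin N → Poly m)
  (entry-nonzero : ∀ i j q α → (A i j *P q) α ≢ 0ℚ →
    Σ E λ e → Σ Bool λ b → Σ (Mono m) λ γ → Joins tl hd e (ℓ i) (ℓ j) b × (α ≡ wt e ⊹ γ) × (q γ ≢ 0ℚ))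
  (entry-single : ∀ i j e b q γ → i ≢ j → Joins tl hd e (ℓ i) (ℓ j) b →
    (∀ e′ b′ γ′ → Joins tl hd e′ (ℓ i) (ℓ j) b′ → wt e ⊹ γ ≡ wt e′ ⊹ γ′ → q γ′ ≢ 0ℚ → e′ ≡ e) →
    (A i j *P q) (wt e ⊹ γ) ≡ sg b ℚ.* q γ)
  where
  open Inversions T tournament
  open Pairs tl hd
  open Weights wt

  private
    sub : ∀ {k} → (Fin k → Fin N) → Fin k → Fin k → Poly m
    sub ι a b = A (ι a) (ι b)

    drop : ∀ {k} → (Fin (suc (suc k)) → Fin N) → Fin (suc k) → Fin k → Fin N
    drop ι j a = ι (suc (punchIn j a))

    Pf-term : ∀ {k} (ι : Fin (suc (suc k)) → Fin N) α j → ℚ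
    Pf-term ι α j = odd-sign (toℕ j) ((A (ι zero) (ι (suc j)) *P Pf (sub (drop ι j))) α)

    Pf-expand : ∀ {k} (ι : Fin (suc (suc k)) → Fin N) α → Pf (sub ι) α ≡ sumF (suc k) (Pf-term ι α)
    Pf-expand {k} ι α = trans (sumFinP-eval (suc k) (λ j → (if (toℕ j % 2) ≡ᵇ 0 then (λ p → p) else -P_) (A (ι zero) (ι (suc j)) *P Pf (sub (drop ι j)))) α)
      (sumF-cong (suc k) λ j → Pf-sign (toℕ j) (A (ι zero) (ι (suc j)) *P Pf (sub (drop ι j))) α)

    term-nonzero : ∀ {k} (ι : Fin (suc (suc k)) → Fin N) α j → Pf-term ι α j ≢ 0ℚ →
      (A (ι zero) (ι (suc j)) *P Pf (sub (drop ι j))) α ≢ 0ℚ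
    term-nonzero ι α j nz e = nz (trans (cong (odd-sign (toℕ j)) e) (ℚ.*-zeroʳ (sg (oddℕ (toℕ j)))))

    vertices : ∀ {k} → (Fin k → Fin N) → List X
    vertices ι = tabulate (ℓ ∘ ι)

    vertices-↭ : ∀ {k} (ι : Fin (suc (suc k)) → Fin N) j →
      vertices ι ↭ ℓ (ι zero) ∷ ℓ (ι (suc j)) ∷ vertices (drop ι j)
    vertices-↭ ι j = ↭-prep _ (tabulate-↭ (ℓ ∘ ι ∘ suc) j)

    ends-↭ : ∀ {e x y b} l → Joins tl hd e x y b → tl e ∷ hd e ∷ l ↭ x ∷ y ∷ l
    ends-↭ {b = false} l (refl , refl) = ↭-refl
    ends-↭ {b = true} l (refl , refl) = ↭-swap _ _ ↭-refl

    extend-cover : ∀ {k} (ι : Fin (suc (suc k)) → Fin N) j {e b es} → Joins tl hd e (ℓ (ι zero)) (ℓ (ι (suc j))) b →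
      verts es ↭ vertices (drop ι j) → verts (e ∷ es) ↭ vertices ι
    extend-cover ι j {es = es} h p = ↭-trans (ends-↭ (verts es) h) (↭-trans (↭-prep _ (↭-prep _ p)) (↭-sym (vertices-↭ ι j)))

  -- A nonzero sum has a nonzero term; following such terms down the row expansion collects the
  -- edges of a cover, whatever happens to the other terms.
  Pf-nonzero : ∀ {k} (ι : Fin k → Fin N) α → Pf (sub ι) α ≢ 0ℚ →
    Σ (List E) λ es → (verts es ↭ vertices ι) × (weight es ≡ α)
  Pf-nonzero {zero} ι α nz with Vec.≡-dec ℕ._≟_ (replicate m 0) α
  ... | yes e = [] , ↭-refl , e
  ... | no ne = contradiction (monoP-miss ne) nz
  Pf-nonzero {suc zero} ι α nz = contradiction refl nz
  Pf-nonzero {suc (suc k)} ι α nz with sumF-nonzero (suc k) (Pf-term ι α) (λ e → nz (trans (Pf-expand ι α) e))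
  ... | j , nzⱼ with entry-nonzero (ι zero) (ι (suc j)) (Pf (sub (drop ι j))) α (term-nonzero ι α j nzⱼ)
  ...   | e , b , γ , h , αγ , nz′ with Pf-nonzero (drop ι j) γ nz′
  ...     | es , p , w = e ∷ es , extend-cover ι j h p , trans (cong (wt e ⊹_) w) (sym αγ)

  private
    Conclusion : ∀ {k} (ι : Fin k → Fin N) → List E → Set
    Conclusion ι es = Pf (sub ι) (weight es) ≡ sg (inv (verts es) xor inv (vertices ι))

    -- Uniqueness up to order. It is inherited when the leading edge is removed (`rest-only`), which
    -- lets the induction follow the row expansion.
    IsOnly : ∀ {k} (ι : Fin k → Fin N) → List E → Set
    IsOnly ι es = ∀ es′ → verts es′ ↭ vertices ι → weight es′ ≡ weight es → es′ ↭ es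

    other-end : ∀ {e x} → (x ≡ tl e) ⊎ (x ≡ hd e) → Σ X λ y → Σ Bool λ b → Joins tl hd e x y b
    other-end {e} (inj₁ p) = hd e , false , sym p , refl
    other-end {e} (inj₂ p) = tl e , true , refl , sym p

    joins-end : ∀ {e x y} b → Joins tl hd e x y b → (x ≡ tl e) ⊎ (x ≡ hd e)
    joins-end false (p , _) = inj₁ (sym p)
    joins-end true (_ , q) = inj₂ (sym q)

    joins-unique : ∀ {e x y y′} b b′ → Joins tl hd e x y b → Joins tl hd e x y′ b′ → x ≢ y → y ≡ y′
    joins-unique false false (_ , q) (_ , q′) _ = trans (sym q) q′
    joins-unique false true (p , q) (p′ , q′) ne = contradiction (trans (sym q′) q) ne
    joins-unique true false (p , q) (p′ , q′) ne = contradiction (trans (sym p′) p) ne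
    joins-unique true true (p , _) (p′ , _) _ = trans (sym p) p′

    first-two : ∀ {x y} {l : List X} → Unique (x ∷ y ∷ l) → x ≢ y
    first-two ((p ∷ _) ∷ _) = p

    module Step {k} (ι : Fin (suc (suc k)) → Fin N) (ι-injective : ∀ {i j} → ι i ≡ ι j → i ≡ j)
      (e : E) (es : List E) (cover : verts (e ∷ es) ↭ vertices ι) (only : IsOnly ι (e ∷ es))
      (j : Fin (suc k)) (b : Bool) (h : Joins tl hd e (ℓ (ι zero)) (ℓ (ι (suc j))) b) where

      x y : X
      x = ℓ (ι zero)
      y = ℓ (ι (suc j))

      x≢y : x ≢ y
      x≢y p with ι-injective (ℓ-injective p)
      ... | ()

      distinct : Unique (x ∷ y ∷ verts es)
      distinct = unique-↭ (↭-trans (↭-sym cover) (ends-↭ (verts es) h)) (Unique.tabulate⁺ (ι-injective ∘ ℓ-injective)) 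

      rest-cover : verts es ↭ vertices (drop ι j)
      rest-cover = Perm.drop-∷ (Perm.drop-∷ (↭-trans (↭-sym (ends-↭ (verts es) h)) (↭-trans cover (vertices-↭ ι j))))

      at-x : ∀ {e′} → e′ ∈ e ∷ es → (x ≡ tl e′) ⊎ (x ≡ hd e′) → e′ ≡ e
      at-x (here p) _ = p
      at-x (there i) p with distinct
      ... | (_ ∷ x∉) ∷ _ = contradiction refl (All.lookup x∉ (∈-verts i p))

      -- An edge at `x` with a nonzero cofactor extends by `Pf-nonzero` to a cover of the same
      -- weight, hence to a reordering of `e ∷ es`, in which `e` alone touches `x`.
      rigid : ∀ j′ e′ b′ γ′ → Joins tl hd e′ x (ℓ (ι (suc j′))) b′ → weight (e ∷ es) ≡ wt e′ ⊹ γ′ →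
        Pf (sub (drop ι j′)) γ′ ≢ 0ℚ → e′ ≡ e
      rigid j′ e′ b′ γ′ h′ w nz with Pf-nonzero (drop ι j′) γ′ nz
      ... | es′ , p , w′ = at-x (Perm.∈-resp-↭ (only (e′ ∷ es′) (extend-cover ι j′ h′ p) (trans (cong (wt e′ ⊹_) w′) (sym w))) (here refl))
                               (joins-end b′ h′)

      other-terms : ∀ j′ → j′ ≢ j → Pf-term ι (weight (e ∷ es)) j′ ≡ 0ℚ
      other-terms j′ j′≢j with Pf-term ι (weight (e ∷ es)) j′ ℚ.≟ 0ℚ
      ... | yes z = z
      ... | no nz with entry-nonzero (ι zero) (ι (suc j′)) (Pf (sub (drop ι j′))) (weight (e ∷ es)) (term-nonzero ι (weight (e ∷ es)) j′ nz)
      ...   | e′ , b′ , γ′ , h′ , w , nz′ with rigid j′ e′ b′ γ′ h′ w nz′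
      ...     | refl = contradiction (Fin.suc-injective (ι-injective (ℓ-injective (sym (joins-unique b b′ h h′ x≢y))))) j′≢j

      rest-only : IsOnly (drop ι j) es
      rest-only es′ p w = Perm.drop-∷ (only (e ∷ es′) (extend-cover ι j h p) (cong (wt e ⊹_) w))

      inv-ends : inv (verts (e ∷ es)) ≡ b xor inv (x ∷ y ∷ verts es)
      inv-ends = by b h
        where
        by : ∀ b → Joins tl hd e x y b → inv (verts (e ∷ es)) ≡ b xor inv (x ∷ y ∷ verts es)
        by false (p , q) = cong₂ (λ a c → inv (a ∷ c ∷ verts es)) p q
        by true (p , q) = trans (cong₂ (λ a c → inv (a ∷ c ∷ verts es)) p q) (inv-swap (verts es) x≢y)

      -- Taking `x` and `y` off the front removes the same inversions from both words, because
      -- `before` depends only on which labels remain. What is left is the direction bit and the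
      -- position `j`.
      sign : oddℕ (toℕ j) xor (b xor (inv (verts es) xor inv (vertices (drop ι j)))) ≡ inv (verts (e ∷ es)) xor inv (vertices ι)
      sign = sym (begin
        inv (verts (e ∷ es)) xor inv (vertices ι)
          ≡⟨ cong₂ _xor_ inv-ends (cong₂ _xor_ (before-↭ x (tabulate-↭ (ℓ ∘ ι ∘ suc) j))
               (inv-tabulate (ℓ ∘ ι ∘ suc) (Fin.suc-injective ∘ ι-injective ∘ ℓ-injective) j)) ⟩
        (b xor ((T y x xor before x (verts es)) xor (before y (verts es) xor inv (verts es)))) xor
          ((T y x xor before x R) xor (oddℕ (toℕ j) xor (before y R xor inv R)))
          ≡⟨ cong₂ (λ s t → (b xor ((T y x xor s) xor (t xor inv (verts es)))) xor
               ((T y x xor before x R) xor (oddℕ (toℕ j) xor (before y R xor inv R))))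
               (before-↭ x rest-cover) (before-↭ y rest-cover) ⟩
        (b xor ((T y x xor before x R) xor (before y R xor inv (verts es)))) xor
          ((T y x xor before x R) xor (oddℕ (toℕ j) xor (before y R xor inv R)))
          ≡⟨ tautology 6 (λ b p q i o r → (b xor (p xor (q xor i))) xor (p xor (o xor (q xor r))))
               (λ b p q i o r → o xor (b xor (i xor r))) refl
               b (T y x xor before x R) (before y R) (inv (verts es)) (oddℕ (toℕ j)) (inv R) ⟩
        oddℕ (toℕ j) xor (b xor (inv (verts es) xor inv R)) ∎)
        where
        open ≡-Reasoning
        R : List X
        R = vertices (drop ι j)

      conclude : Conclusion (drop ι j) es → Conclusion ι (e ∷ es)
      conclude ih = begin
        Pf (sub ι) (weight (e ∷ es))
          ≡⟨ Pf-expand ι (weight (e ∷ es)) ⟩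
        sumF (suc k) (Pf-term ι (weight (e ∷ es)))
          ≡⟨ sumF-single (suc k) (Pf-term ι (weight (e ∷ es))) j other-terms ⟩
        sg (oddℕ (toℕ j)) ℚ.* (A (ι zero) (ι (suc j)) *P Pf (sub (drop ι j))) (weight (e ∷ es))
          ≡⟨ cong (sg (oddℕ (toℕ j)) ℚ.*_) (entry-single (ι zero) (ι (suc j)) e b (Pf (sub (drop ι j))) (weight es)
               (λ p → contradiction (ι-injective p) λ ()) h (rigid j)) ⟩
        sg (oddℕ (toℕ j)) ℚ.* (sg b ℚ.* Pf (sub (drop ι j)) (weight es))
          ≡⟨ cong (λ r → sg (oddℕ (toℕ j)) ℚ.* (sg b ℚ.* r)) ih ⟩
        sg (oddℕ (toℕ j)) ℚ.* (sg b ℚ.* sg (inv (verts es) xor inv (vertices (drop ι j))))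
          ≡⟨ sym (trans (sg-xor (oddℕ (toℕ j)) _) (cong (sg (oddℕ (toℕ j)) ℚ.*_) (sg-xor b _))) ⟩
        sg (oddℕ (toℕ j) xor (b xor (inv (verts es) xor inv (vertices (drop ι j)))))
          ≡⟨ cong sg sign ⟩
        sg (inv (verts (e ∷ es)) xor inv (vertices ι)) ∎
        where open ≡-Reasoning

  Pf-coefficient : ∀ {k} (ι : Fin k → Fin N) → (∀ {i j} → ι i ≡ ι j → i ≡ j) → ∀ es →
    verts es ↭ vertices ι → IsOnly ι es → Conclusion ι es
  Pf-coefficient {zero} ι ι-injective [] cover only = monoP-hit (replicate m 0)
  Pf-coefficient {zero} ι ι-injective (e ∷ es) cover only = contradiction (Perm.↭-length cover) λ ()
  Pf-coefficient {suc zero} ι ι-injective [] cover only = contradiction (Perm.↭-length cover) λ ()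
  Pf-coefficient {suc zero} ι ι-injective (e ∷ es) cover only = contradiction (Perm.↭-length cover) λ ()
  -- The row expansion is about the first vertex, so the edge covering it is brought to the front;
  -- its other end names the column `j` that contributes.
  Pf-coefficient {suc (suc k)} ι ι-injective es cover only
    with verts-∈ es (Perm.∈-resp-↭ (↭-sym cover) (here refl))
  ... | e , e∈es , end with ∈-∃++ e∈es | other-end end
  ...   | as , bs , refl | y , b , h with ↭-trans (verts-↭ (↭-sym (Perm.shift e as bs))) cover
  ...     | cover′ with ∈-tabulate⁻ {f = ℓ ∘ ι} (Perm.∈-resp-↭ (↭-trans (↭-sym (ends-↭ (verts (as ++ bs)) h)) cover′) (there (here refl)))
  ...       | zero , refl = contradiction refl (first-two (unique-↭ (↭-trans (↭-sym cover′) (ends-↭ (verts (as ++ bs)) h))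
                (Unique.tabulate⁺ (ι-injective ∘ ℓ-injective))))
  ...       | suc j , refl = begin
    Pf (sub ι) (weight (as ++ e ∷ bs)) ≡⟨ cong (Pf (sub ι)) (weight-↭ σ) ⟩
    Pf (sub ι) (weight (e ∷ as ++ bs)) ≡⟨ Step.conclude ι ι-injective e (as ++ bs) cover′ only′ j b h
        (Pf-coefficient (drop ι j) (Fin.punchIn-injective j _ _ ∘ Fin.suc-injective ∘ ι-injective) (as ++ bs)
          (Step.rest-cover ι ι-injective e (as ++ bs) cover′ only′ j b h) (Step.rest-only ι ι-injective e (as ++ bs) cover′ only′ j b h)) ⟩
    sg (inv (verts (e ∷ as ++ bs)) xor inv (vertices ι))
      ≡⟨ cong (λ r → sg (r xor inv (vertices ι))) (inv-verts-↭ (↭-sym σ) (unique-↭ (↭-sym cover′) (Unique.tabulate⁺ (ι-injective ∘ ℓ-injective)))) ⟩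
    sg (inv (verts (as ++ e ∷ bs)) xor inv (vertices ι)) ∎
    where
    open ≡-Reasoning
    σ : as ++ e ∷ bs ↭ e ∷ as ++ bs
    σ = Perm.shift e as bs
    only′ : IsOnly ι (e ∷ as ++ bs)
    only′ es′ p w = ↭-trans (only es′ p (trans w (sym (weight-↭ σ)))) σ

-- The Pfaffian of the blow-up

<ᵇ-flip : ∀ {a b} → a ≢ b → (b ℕ.<ᵇ a) ≡ not (a ℕ.<ᵇ b)
<ᵇ-flip {zero} {zero} h = contradiction refl h
<ᵇ-flip {zero} {suc b} h = refl
<ᵇ-flip {suc a} {zero} h = refl
<ᵇ-flip {suc a} {suc b} h = <ᵇ-flip {a} {b} (h ∘ cong suc)

-- Lexicographic order on labels. Signs are measured against it and not against `num`, so the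
-- numbering enters only through the constant `inv vertexList`.
earlier : ∀ {n} → Fin n × ℕ → Fin n × ℕ → Bool
earlier (v , i) (w , j) = if does (v Fin.≟ w) then i ℕ.<ᵇ j else toℕ v ℕ.<ᵇ toℕ w

earlier-tournament : ∀ {n} {p q : Fin n × ℕ} → p ≢ q → earlier q p ≡ not (earlier p q)
earlier-tournament {p = v , i} {w , j} p≢q with v Fin.≟ w | w Fin.≟ v
... | yes e | yes _ = <ᵇ-flip {i} {j} λ i≡j → p≢q (cong₂ _,_ e i≡j)
... | yes e | no ne = contradiction (sym e) ne
... | no ne | yes e = contradiction (sym e) ne
... | no ne | no _ = <ᵇ-flip {toℕ v} {toℕ w} (ne ∘ Fin.toℕ-injective)

labelEq-sound : ∀ {n} {p q : Fin n × ℕ} → labelEq p q ≡ true → p ≡ q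
labelEq-sound {p = v , i} {w , j} e with v Fin.≟ w
... | yes refl = cong (v ,_) (ℕ.≡ᵇ⇒≡ i j (subst T (sym e) _))

labelEq-refl : ∀ {n} (p : Fin n × ℕ) → labelEq p p ≡ true
labelEq-refl (v , i) = cong₂ _∧_ (dec-true (v Fin.≟ v) refl) (dec-true (i ℕ.≟ i) refl)

labelEq-miss : ∀ {n} {p q : Fin n × ℕ} → p ≢ q → labelEq p q ≡ false
labelEq-miss {p = p} {q} h with labelEq p q in e
... | true = contradiction (labelEq-sound e) h
... | false = refl

Label : Graph → Set
Label G = Fin (nV G) × ℕ

edgeWeight : ∀ G → BEdge G → Mono (nE G)
edgeWeight G (inj₁ e) = Vec.tabulate λ i → if does (i Fin.≟ e) then 1 else 0
edgeWeight G (inj₂ _) = replicate (nE G) 0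

bWeight-monoP : ∀ G e → bWeight G e ≡ monoP (edgeWeight G e)
bWeight-monoP G (inj₁ e) = refl
bWeight-monoP G (inj₂ _) = refl

module BlowUp (G : Graph) (σ : HalfEdgeOrdering G) (N : ℕ) (num : Fin N ↔ BVert G) where
  open Inversions {Label G} earlier earlier-tournament using (before; inv; before-↭; inv-swap) public
  open module Std = Inversions.Pairs {Label G} earlier earlier-tournament (λ e → bEnd G σ e zero) (λ e → bEnd G σ e (suc zero))
    using (verts; verts-↭; verts-++) public
  open Weights (edgeWeight G) public

  ℓ : Fin N → Label G
  ℓ i = label G (Inverse.to num i)

  ℓ-injective : ∀ {i j} → ℓ i ≡ ℓ j → i ≡ j
  ℓ-injective {i} {j} e = trans (sym (Inverse.strictlyInverseʳ num i)) (trans (cong (Inverse.from num) (label-injective e)) (Inverse.strictlyInverseʳ num j))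
    where
    label-injective : ∀ {p q} → label G p ≡ label G q → p ≡ q
    label-injective {v , a} {w , b} e with Product.,-injectiveˡ e
    ... | refl = cong (v ,_) (Fin.toℕ-injective (Product.,-injectiveʳ e))

  vertexList : List (Label G)
  vertexList = tabulate ℓ

  vertexList-unique : Unique vertexList
  vertexList-unique = Unique.tabulate⁺ ℓ-injective

  Covers : List (BEdge G) → Set
  Covers es = verts es ↭ vertexList

  reversed : Orientation G → List (BEdge G) → Bool
  reversed D [] = false
  reversed D (e ∷ es) = not (D e) xor reversed D es

  module _ (D : Orientation G) where
    private
      tl hd : BEdge G → Label G
      tl e = if D e then bEnd G σ e zero else bEnd G σ e (suc zero)
      hd e = if D e then bEnd G σ e (suc zero) else bEnd G σ e zero

      entry : Fin N → Fin N → BEdge G → Poly (nE G)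
      entry i j e = if labelEq (tl e) (ℓ i) ∧ labelEq (hd e) (ℓ j) then bWeight G e
                    else if labelEq (tl e) (ℓ j) ∧ labelEq (hd e) (ℓ i) then -P (bWeight G e) else 0P

      A : Fin N → Fin N → Poly (nE G)
      A = Amat G σ N num D

      weight-nonzero : ∀ e q α → (bWeight G e *P q) α ≢ 0ℚ → Σ (Mono (nE G)) λ γ → (α ≡ edgeWeight G e ⊹ γ) × (q γ ≢ 0ℚ)
      weight-nonzero e q α nz rewrite bWeight-monoP G e = monoP-*-nonzero (edgeWeight G e) α q nz

      entry-term-nonzero : ∀ i j e q α → (entry i j e *P q) α ≢ 0ℚ →
        Σ Bool λ b → Σ (Mono (nE G)) λ γ → Joins tl hd e (ℓ i) (ℓ j) b × (α ≡ edgeWeight G e ⊹ γ) × (q γ ≢ 0ℚ)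
      entry-term-nonzero i j e q α nz with labelEq (tl e) (ℓ i) ∧ labelEq (hd e) (ℓ j) in p
      ... | true with weight-nonzero e q α nz
      ...   | γ , w , nz′ = false , γ , (labelEq-sound (∧-trueˡ p) , labelEq-sound (∧-trueʳ {labelEq (tl e) (ℓ i)} p)) , w , nz′
      entry-term-nonzero i j e q α nz | false with labelEq (tl e) (ℓ j) ∧ labelEq (hd e) (ℓ i) in p′
      ... | false = contradiction (0P-* q α) nz
      ... | true with weight-nonzero e q α (λ z → nz (trans (neg-* (bWeight G e) q α) (cong ℚ.-_ z)))
      ...   | γ , w , nz′ = true , γ , (labelEq-sound (∧-trueˡ p′) , labelEq-sound (∧-trueʳ {labelEq (tl e) (ℓ j)} p′)) , w , nz′

      A-diagonal : ∀ {i j} → i ≡ j → ∀ q α → (A i j *P q) α ≡ 0ℚ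
      A-diagonal {i} {j} i≡j q α with i Fin.≟ j
      ... | yes _ = 0P-* q α
      ... | no ne = contradiction i≡j ne

      A-off-diagonal : ∀ {i j} → i ≢ j → ∀ q α → (A i j *P q) α ≡ edgeSum G (λ e → (entry i j e *P q) α)
      A-off-diagonal {i} {j} i≢j q α with i Fin.≟ j
      ... | yes p = contradiction p i≢j
      ... | no _ = sumBEdge-* G (entry i j) q α

      entry-nonzero : ∀ i j q α → (A i j *P q) α ≢ 0ℚ →
        Σ (BEdge G) λ e → Σ Bool λ b → Σ (Mono (nE G)) λ γ →
          Joins tl hd e (ℓ i) (ℓ j) b × (α ≡ edgeWeight G e ⊹ γ) × (q γ ≢ 0ℚ)
      entry-nonzero i j q α nz = by (i Fin.≟ j)
        where
        by : Dec (i ≡ j) → _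
        by (yes p) = contradiction (A-diagonal p q α) nz
        by (no ne) with edgeSum-nonzero G (λ e → (entry i j e *P q) α) (λ z → nz (trans (A-off-diagonal ne q α) z))
        ... | e , nz′ = e , entry-term-nonzero i j e q α nz′

      entry-single : ∀ i j e b q γ → i ≢ j → Joins tl hd e (ℓ i) (ℓ j) b →
        (∀ e′ b′ γ′ → Joins tl hd e′ (ℓ i) (ℓ j) b′ → edgeWeight G e ⊹ γ ≡ edgeWeight G e′ ⊹ γ′ → q γ′ ≢ 0ℚ → e′ ≡ e) →
        (A i j *P q) (edgeWeight G e ⊹ γ) ≡ sg b ℚ.* q γ
      entry-single i j e b q γ i≢j h only = trans (A-off-diagonal i≢j q α)
        (trans (edgeSum-single G (λ e′ → (entry i j e′ *P q) α) e others) (value b h))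
        where
        α : Mono (nE G)
        α = edgeWeight G e ⊹ γ
        others : ∀ e′ → e′ ≢ e → (entry i j e′ *P q) α ≡ 0ℚ
        others e′ e′≢e with (entry i j e′ *P q) α ℚ.≟ 0ℚ
        ... | yes z = z
        ... | no nz with entry-term-nonzero i j e′ q α nz
        ...   | b′ , γ′ , h′ , w , nz′ = contradiction (only e′ b′ γ′ h′ w nz′) e′≢e
        weighted : (bWeight G e *P q) α ≡ q γ
        weighted rewrite bWeight-monoP G e = monoP-* (edgeWeight G e) γ q
        value : ∀ b → Joins tl hd e (ℓ i) (ℓ j) b → (entry i j e *P q) α ≡ sg b ℚ.* q γ
        value false (p , p′) = trans (cong (λ r → (r *P q) α) (forward p p′)) (trans weighted (sym (ℚ.*-identityˡ (q γ))))
          where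
          forward : tl e ≡ ℓ i → hd e ≡ ℓ j → entry i j e ≡ bWeight G e
          forward p p′ rewrite p | p′ | labelEq-refl (ℓ i) | labelEq-refl (ℓ j) = refl
        value true (p , p′) = trans (cong (λ r → (r *P q) α) (backward p p′)) (trans (neg-* (bWeight G e) q α)
          (trans (cong ℚ.-_ (trans weighted (sym (ℚ.*-identityˡ (q γ))))) (ℚ.neg-distribˡ-* 1ℚ (q γ))))
          where
          backward : tl e ≡ ℓ j → hd e ≡ ℓ i → entry i j e ≡ -P (bWeight G e)
          backward p p′ rewrite p | p′ | labelEq-refl (ℓ i) | labelEq-refl (ℓ j)
            | labelEq-miss {p = ℓ j} {ℓ i} (λ r → i≢j (sym (ℓ-injective r))) = refl

      open module Oriented = Inversions.Pairs {Label G} earlier earlier-tournament tl hd using () renaming (verts to vertsᴰ)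
      open PfaffianExpansion {BEdge G} {Label G} earlier earlier-tournament tl hd (edgeWeight G) ℓ ℓ-injective A entry-nonzero entry-single
        using (Pf-nonzero; Pf-coefficient)

      reorient-↭ : ∀ es → vertsᴰ es ↭ verts es
      reorient-↭ [] = ↭-refl
      reorient-↭ (e ∷ es) with D e
      ... | true = ↭-prep _ (↭-prep _ (reorient-↭ es))
      ... | false = ↭-swap _ _ (reorient-↭ es)

      -- An edge oriented against its listing exchanges two adjacent letters. This confines the
      -- dependence on `D` to a count of reversed edges.
      inv-reorient : ∀ es → Unique (verts es) → inv (vertsᴰ es) ≡ inv (verts es) xor reversed D es
      inv-reorient [] u = refl
      inv-reorient (e ∷ es) ((a≢b ∷ _) ∷ _ ∷ u) with D e
      ... | true = trans (cong₂ (λ p q → (earlier b a xor p) xor q) (before-↭ a (reorient-↭ es))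
          (cong₂ _xor_ (before-↭ b (reorient-↭ es)) (inv-reorient es u)))
          (tautology 4 (λ t q i r → t xor (q xor (i xor r))) (λ t q i r → (t xor (q xor i)) xor (false xor r)) refl
            (earlier b a xor before a (verts es)) (before b (verts es)) (inv (verts es)) (reversed D es))
        where
        a b : Label G
        a = bEnd G σ e zero
        b = bEnd G σ e (suc zero)
      ... | false = trans (cong₂ (λ p q → (earlier a b xor p) xor q) (before-↭ b (reorient-↭ es))
          (cong₂ _xor_ (before-↭ a (reorient-↭ es)) (inv-reorient es u)))
          (trans (tautology 4 (λ t q i r → t xor (q xor (i xor r))) (λ t q i r → (t xor (q xor i)) xor r) refl
            (earlier a b xor before b (verts es)) (before a (verts es)) (inv (verts es)) (reversed D es))
          (trans (cong (_xor reversed D es) (inv-swap (verts es) a≢b))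
            (tautology 2 (λ i r → not i xor r) (λ i r → i xor (true xor r)) refl (inv (a ∷ b ∷ verts es)) (reversed D es))))
        where
        a b : Label G
        a = bEnd G σ e zero
        b = bEnd G σ e (suc zero)

    projPf-nonzero : ∀ α → projPf G σ N num D α ≢ 0ℚ → Σ (List (BEdge G)) λ es → Covers es × (weight es ≡ α)
    projPf-nonzero α nz with Pf-nonzero (λ i → i) α nz
    ... | es , p , w = es , ↭-trans (↭-sym (reorient-↭ es)) p , w

    projPf-coefficient : ∀ es → Covers es → (∀ es′ → Covers es′ → weight es′ ≡ weight es → es′ ↭ es) →
      projPf G σ N num D (weight es) ≡ sg ((inv (verts es) xor reversed D es) xor inv vertexList)
    projPf-coefficient es cover only = trans
      (Pf-coefficient (λ i → i) (λ e → e) es (↭-trans (reorient-↭ es) cover)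
        (λ es′ p → only es′ (↭-trans (↭-sym (reorient-↭ es′)) p)))
      (cong (λ r → sg (r xor inv vertexList)) (inv-reorient es (unique-↭ (↭-sym cover) vertexList-unique)))

-- Perfect matchings of the blow-up are determined by their weight

indicator : Bool → ℕ
indicator b = if b then 1 else 0

count : {A : Set} → (A → Bool) → List A → ℕ
count f [] = 0
count f (x ∷ l) = indicator (f x) ℕ.+ count f l

count-zero : ∀ {A : Set} (f : A → Bool) l → (∀ {x} → x ∈ l → f x ≡ false) → count f l ≡ 0
count-zero f [] h = refl
count-zero f (x ∷ l) h rewrite h (here refl) = count-zero f l (h ∘ there)

count-single : ∀ {A : Set} (f : A → Bool) {l x} → Unique l → x ∈ l → f x ≡ true → (∀ {y} → y ∈ l → f y ≡ true → y ≡ x) → count f l ≡ 1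
count-single f {x ∷ l} (x∉ ∷ u) (here refl) fx h rewrite fx = cong suc (count-zero f l none)
  where
  none : ∀ {y} → y ∈ l → f y ≡ false
  none {y} i with f y in e
  ... | false = refl
  ... | true = contradiction (sym (h (there i) e)) (All.lookup x∉ i)
count-single f {y ∷ l} (y∉ ∷ u) (there i) fx h with f y in e
... | true = contradiction (h (here refl) e) (All.lookup y∉ i)
... | false = count-single f u i fx (h ∘ there)

count-positive : ∀ {A : Set} (f : A → Bool) {l x} → x ∈ l → f x ≡ true → count f l ≢ 0
count-positive f (here refl) fx rewrite fx = λ ()
count-positive f {y ∷ l} (there i) fx with f y
... | true = λ ()
... | false = count-positive f i fx

count-witness : ∀ {A : Set} (f : A → Bool) l → count f l ≢ 0 → Σ A λ x → (x ∈ l) × (f x ≡ true)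
count-witness f [] h = contradiction refl h
count-witness f (x ∷ l) h with f x in e
... | true = x , here refl , e
... | false with count-witness f l h
...   | y , i , fy = y , there i , fy

unique-concatMap : ∀ {A B : Set} (f : A → List B) {xs} → Unique xs → (∀ x → Unique (f x)) →
  (∀ {x y z} → z ∈ f x → z ∈ f y → x ≡ y) → Unique (concatMap f xs)
unique-concatMap f {[]} u uf sep = []
unique-concatMap f {x ∷ xs} (x∉ ∷ u) uf sep = Unique.++⁺ (uf x) (unique-concatMap f u uf sep) disjoint
  where
  disjoint : ∀ {z} → ¬ ((z ∈ f x) × (z ∈ concatMap f xs))
  disjoint {z} (i , j) with find (∈-concatMap⁻ f {xs = xs} j)
  ... | y , y∈ , k = All.lookup x∉ y∈ (sep i k)

same-members-↭ : ∀ {A : Set} {xs ys : List A} → Unique xs → Unique ys →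
  (∀ {x} → x ∈ xs → x ∈ ys) → (∀ {x} → x ∈ ys → x ∈ xs) → xs ↭ ys
same-members-↭ u v f g = ∼bag⇒↭ (unique∧set⇒bag u v (mk⇔ f g))

-- Labels mod 3 give the place in a triangle: 0 and 2 are the ends of a chord, 1 is the middle, and
-- external edges end at middles (`residue₆`).
residue : ∀ k r → (3 ℕ.* k ℕ.+ r) % 3 ≡ r % 3
residue k r = trans (cong (_% 3) (trans (ℕ.+-comm (3 ℕ.* k) r) (cong (r ℕ.+_) (ℕ.*-comm 3 k)))) (ℕ.[m+kn]%n≡m%n r k 3)

residue₀ : ∀ k → (3 ℕ.* k) % 3 ≡ 0
residue₀ k = trans (cong (_% 3) (sym (ℕ.+-identityʳ (3 ℕ.* k)))) (residue k 0)

residue₆ : ∀ p → (6 ℕ.* p ℕ.+ 1) % 3 ≡ 1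
residue₆ p = trans (cong (λ n → (n ℕ.+ 1) % 3) (ℕ.*-assoc 3 2 p)) (residue (2 ℕ.* p) 1)

labelEq-second : ∀ {n} (v w : Fin n) {a b c d} → (a ≡ b → c ≡ d) → (c ≡ d → a ≡ b) → labelEq (v , a) (w , b) ≡ labelEq (v , c) (w , d)
labelEq-second v w {a} {b} {c} {d} f g = cong (does (v Fin.≟ w) ∧_) (does-⇔ (mk⇔ f g) (a ℕ.≟ b) (c ℕ.≟ d))

labelEq-mod : ∀ {n} (v w : Fin n) {a b} → a % 3 ≢ b % 3 → labelEq (v , a) (w , b) ≡ false
labelEq-mod v w {a} {b} h = labelEq-miss {p = v , a} {w , b} λ e → h (cong (λ p → proj₂ p % 3) e)

-- The solutions of the three degree equations of a triangle. The counts `s` and `e` determine the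
-- others, and `s′` is 1 exactly when they agree.
data Triangle : ℕ → ℕ → ℕ → ℕ → ℕ → ℕ → Set where
  neither : Triangle 0 0 1 0 0 1
  middle : Triangle 0 1 0 0 1 0
  left : Triangle 1 0 0 1 0 0
  both : Triangle 1 1 0 0 0 1

-- A triangle L M R with outer edges s at L, e at M, s′ at R and inner edges a = LM, b = MR, c = LR.
triangle : ∀ s e a b c s′ → (s ℕ.+ a) ℕ.+ c ≡ 1 → (a ℕ.+ b) ℕ.+ e ≡ 1 → (b ℕ.+ s′) ℕ.+ c ≡ 1 → Triangle s e a b c s′
triangle 0 0 0 1 1 s′ refl refl p = contradiction (trans (sym p) (ℕ.+-comm (1 ℕ.+ s′) 1)) λ ()
triangle 0 0 0 0 c s′ _ () _
triangle 0 0 0 (suc (suc _)) c s′ _ () _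
triangle 0 0 1 0 0 0 refl refl ()
triangle 0 0 1 0 0 1 refl refl refl = neither
triangle 0 0 1 0 0 (suc (suc _)) refl refl ()
triangle 0 0 1 (suc _) c s′ _ () _
triangle 0 0 1 0 (suc _) s′ () _ _
triangle 0 0 (suc (suc _)) b c s′ () _ _
triangle 0 1 0 0 1 0 refl refl refl = middle
triangle 0 1 0 0 1 (suc s′) refl refl p = contradiction (trans (sym p) (ℕ.+-comm (suc s′) 1)) λ ()
triangle 0 1 0 (suc b) c s′ _ q _ = contradiction (trans (sym q) (ℕ.+-comm (suc b) 1)) λ ()
triangle 0 1 (suc a) b c s′ _ q _ = contradiction (trans (sym q) (ℕ.+-comm (suc a ℕ.+ b) 1)) λ ()
triangle s (suc (suc e)) a b c s′ _ q _ = contradiction (trans (sym q) (ℕ.+-comm (a ℕ.+ b) (suc (suc e)))) λ ()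
triangle 1 0 0 1 0 0 refl refl refl = left
triangle 1 0 0 1 0 (suc _) refl refl ()
triangle 1 0 0 0 0 s′ refl () _
triangle 1 0 0 (suc (suc _)) 0 s′ refl () _
triangle 1 1 0 0 0 0 refl refl ()
triangle 1 1 0 0 0 1 refl refl refl = both
triangle 1 1 0 0 0 (suc (suc _)) refl refl ()
triangle 1 1 0 (suc b) 0 s′ refl q _ = contradiction (trans (sym q) (ℕ.+-comm (suc b) 1)) λ ()
triangle 1 e 0 b (suc _) s′ () _ _
triangle 1 e (suc _) b c s′ () _ _
triangle (suc (suc _)) e a b c s′ () _ _

triangle-unique : ∀ {s e a b c s′ a₁ b₁ c₁ s₁′} → Triangle s e a b c s′ → Triangle s e a₁ b₁ c₁ s₁′ →
  (a ≡ a₁) × (b ≡ b₁) × (c ≡ c₁) × (s′ ≡ s₁′)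
triangle-unique neither neither = refl , refl , refl , refl
triangle-unique middle middle = refl , refl , refl , refl
triangle-unique left left = refl , refl , refl , refl
triangle-unique both both = refl , refl , refl , refl

sumFinℕ-cong : ∀ k {f g : Fin k → ℕ} → (∀ i → f i ≡ g i) → sumFinℕ k f ≡ sumFinℕ k g
sumFinℕ-cong zero h = refl
sumFinℕ-cong (suc k) h = cong₂ ℕ._+_ (h zero) (sumFinℕ-cong k (h ∘ suc))

sumFinℕ-zero : ∀ k {f : Fin k → ℕ} → (∀ i → f i ≡ 0) → sumFinℕ k f ≡ 0
sumFinℕ-zero zero h = refl
sumFinℕ-zero (suc k) h = cong₂ ℕ._+_ (h zero) (sumFinℕ-zero k (h ∘ suc))

weighted-zero : ∀ m (g : Fin m → ℕ) → sumFinℕ m (λ e → lookup (replicate m 0) e ℕ.* g e) ≡ 0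
weighted-zero zero g = refl
weighted-zero (suc m) g = weighted-zero m (g ∘ suc)

weighted-+ : ∀ {m} (α β : Mono m) (g : Fin m → ℕ) →
  sumFinℕ m (λ e → lookup (α ⊹ β) e ℕ.* g e) ≡ sumFinℕ m (λ e → lookup α e ℕ.* g e) ℕ.+ sumFinℕ m (λ e → lookup β e ℕ.* g e)
weighted-+ [] [] g = refl
weighted-+ (a ∷ α) (b ∷ β) g = trans (cong₂ ℕ._+_ (ℕ.*-distribʳ-+ (g zero) a b) (weighted-+ α β (g ∘ suc)))
  (interchange (a ℕ.* g zero) (b ℕ.* g zero) _ _)
  where
  open +-*-Solverℕ
  interchange : ∀ a b c d → (a ℕ.+ b) ℕ.+ (c ℕ.+ d) ≡ (a ℕ.+ c) ℕ.+ (b ℕ.+ d)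
  interchange = solve 4 (λ a b c d → (a :+ b) :+ (c :+ d) := (a :+ c) :+ (b :+ d)) refl

unit-zero : ∀ {m} (e : Fin m) i → i ≢ e → lookup (Vec.tabulate λ i → if does (i Fin.≟ e) then 1 else 0) i ≡ 0
unit-zero e i h = trans (Vec.lookup∘tabulate (λ i → if does (i Fin.≟ e) then 1 else 0) i) (cong (if_then 1 else 0) (dec-false (i Fin.≟ e) h))

unit-one : ∀ {m} (e : Fin m) → lookup (Vec.tabulate λ i → if does (i Fin.≟ e) then 1 else 0) e ≡ 1
unit-one e = trans (Vec.lookup∘tabulate (λ i → if does (i Fin.≟ e) then 1 else 0) e) (cong (if_then 1 else 0) (dec-true (e Fin.≟ e) refl))

sumFinℕ-single : ∀ k (f : Fin k → ℕ) i → (∀ j → j ≢ i → f j ≡ 0) → sumFinℕ k f ≡ f i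
sumFinℕ-single (suc k) f zero h = trans (cong (f zero ℕ.+_) (sumFinℕ-zero k λ i → h (suc i) λ ())) (ℕ.+-identityʳ (f zero))
sumFinℕ-single (suc k) f (suc i) h = cong₂ ℕ._+_ (h zero λ ()) (sumFinℕ-single k (f ∘ suc) i λ j ne → h (suc j) (ne ∘ Fin.suc-injective))

-- Counting the labels of one gadget mod 2 is how evenness is detected: a gadget has 6d labels, and
-- its own edges take them two at a time.
parityAt : ∀ {n} → Fin n → List (Fin n × ℕ) → Bool
parityAt v [] = false
parityAt v ((w , _) ∷ l) = does (w Fin.≟ v) xor parityAt v l

parityAt-↭ : ∀ {n} (v : Fin n) {l l′} → l ↭ l′ → parityAt v l ≡ parityAt v l′
parityAt-↭ v Perm.refl = refl
parityAt-↭ v (Perm.prep (w , _) p) = cong (does (w Fin.≟ v) xor_) (parityAt-↭ v p)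
parityAt-↭ v (Perm.swap {l} {l′} (w , _) (u , _) p) = trans (cong (λ r → does (w Fin.≟ v) xor (does (u Fin.≟ v) xor r)) (parityAt-↭ v p))
  (tautology 3 (λ a b c → a xor (b xor c)) (λ a b c → b xor (a xor c)) refl (does (w Fin.≟ v)) (does (u Fin.≟ v)) (parityAt v l′))
parityAt-↭ v (Perm.trans p q) = trans (parityAt-↭ v p) (parityAt-↭ v q)

parityAt-++ : ∀ {n} (v : Fin n) l l′ → parityAt v (l ++ l′) ≡ parityAt v l xor parityAt v l′
parityAt-++ v [] l′ = refl
parityAt-++ v ((w , _) ∷ l) l′ = trans (cong (does (w Fin.≟ v) xor_) (parityAt-++ v l l′))
  (tautology 3 (λ a b c → a xor (b xor c)) (λ a b c → (a xor b) xor c) refl (does (w Fin.≟ v)) (parityAt v l) (parityAt v l′))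

parityAt-map : ∀ {n} (v w : Fin n) l → parityAt v (map (w ,_) l) ≡ does (w Fin.≟ v) ∧ oddℕ (length l)
parityAt-map v w [] = tautology 1 (λ _ → false) (λ a → a ∧ false) refl (does (w Fin.≟ v))
parityAt-map v w (x ∷ l) = trans (cong (does (w Fin.≟ v) xor_) (parityAt-map v w l))
  (tautology 2 (λ a b → a xor (a ∧ b)) (λ a b → a ∧ not b) refl (does (w Fin.≟ v)) (oddℕ (length l)))

oddℕ-6* : ∀ d → oddℕ (6 ℕ.* d) ≡ false
oddℕ-6* d = trans (cong oddℕ (trans (ℕ.*-assoc 2 3 d) (cong (3 ℕ.* d ℕ.+_) (ℕ.+-identityʳ (3 ℕ.* d)))))
  (trans (oddℕ-+ (3 ℕ.* d) (3 ℕ.* d)) (tautology 1 (λ a → a xor a) (λ _ → false) refl (oddℕ (3 ℕ.* d))))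

gadgetLabels : (G : Graph) → Fin (nV G) → List (Label G)
gadgetLabels G v = map (v ,_) (upTo (6 ℕ.* deg G v))

allLabels : (G : Graph) → List (Label G)
allLabels G = concatMap (gadgetLabels G) (allFin (nV G))

∈-allLabels : ∀ G {v n} → n < 6 ℕ.* deg G v → (v , n) ∈ allLabels G
∈-allLabels G {v} lt = ∈-concatMap⁺ (gadgetLabels G) (lose (∈-allFin v) (∈-map⁺ (v ,_) (∈-upTo⁺ lt)))

allLabels-∈ : ∀ G {v n} → (v , n) ∈ allLabels G → n < 6 ℕ.* deg G v
allLabels-∈ G i with find (∈-concatMap⁻ (gadgetLabels G) {xs = allFin (nV G)} i)
... | w , _ , j with ∈-map⁻ (w ,_) j
...   | n , k , refl = ∈-upTo⁻ k

allLabels-unique : ∀ G → Unique (allLabels G)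
allLabels-unique G = unique-concatMap (gadgetLabels G) (Unique.allFin⁺ (nV G))
  (λ v → Unique.map⁺ Product.,-injectiveʳ (Unique.upTo⁺ (6 ℕ.* deg G v)))
  (λ {x} {y} i j → trans (sym (first x i)) (first y j))
  where
  first : ∀ w {z} → z ∈ gadgetLabels G w → proj₁ z ≡ w
  first w i with ∈-map⁻ (w ,_) i
  ... | _ , _ , refl = refl

allLabels-even : ∀ G v → parityAt v (allLabels G) ≡ false
allLabels-even G v = go (allFin (nV G))
  where
  go : ∀ ws → parityAt v (concatMap (gadgetLabels G) ws) ≡ false
  go [] = refl
  go (w ∷ ws) = trans (parityAt-++ v (gadgetLabels G w) _) (cong₂ _xor_
    (trans (parityAt-map v w (upTo (6 ℕ.* deg G w))) (trans (cong (does (w Fin.≟ v) ∧_)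
      (trans (cong oddℕ (List.length-upTo (6 ℕ.* deg G w))) (oddℕ-6* (deg G w))))
      (tautology 1 (λ a → a ∧ false) (λ _ → false) refl (does (w Fin.≟ v))))) (go ws))

module Matchings (G : Graph) (σ : HalfEdgeOrdering G) (N : ℕ) (num : Fin N ↔ BVert G) where
  open BlowUp G σ N num

  private
    D : Fin (nV G) → ℕ
    D = deg G

  vertexList-↭ : vertexList ↭ allLabels G
  vertexList-↭ = same-members-↭ vertexList-unique (allLabels-unique G) to from
    where
    to : ∀ {x} → x ∈ vertexList → x ∈ allLabels G
    to i with ∈-tabulate⁻ {f = ℓ} i
    ... | k , refl = ∈-allLabels G (Fin.toℕ<n (proj₂ (Inverse.to num k)))
    from : ∀ {x} → x ∈ allLabels G → x ∈ vertexList
    from {v , n} i = subst (_∈ vertexList) (trans (cong (label G) (Inverse.strictlyInverseˡ num p)) (cong (v ,_) (Fin.toℕ-fromℕ< lt)))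
      (∈-tabulate⁺ {f = ℓ} (Inverse.from num p))
      where
      lt : n < 6 ℕ.* D v
      lt = allLabels-∈ G i
      p : BVert G
      p = v , fromℕ< lt

  -- Edges are tested by number and not by an element of `Fin`, so that the tests make sense past
  -- the last path edge, where the count is zero.
  isPath isChord : Fin (nV G) → ℕ → BEdge G → Bool
  isPath v n (inj₂ (w , inj₁ j)) = labelEq (w , toℕ j) (v , n)
  isPath v n _ = false
  isChord v n (inj₂ (w , inj₂ j)) = labelEq (w , toℕ j) (v , n)
  isChord v n _ = false

  -- The path edge entering label `n` from below. Label 0 has none, which is why it gets its own
  -- clause in place of a truncated `n ℕ.∸ 1`.
  arrives : Fin (nV G) → ℕ → BEdge G → Bool
  arrives v zero e = false
  arrives v (suc n) e = isPath v n e

  external : (Fin (nE G) → ℕ) → List (BEdge G) → ℕ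
  external g [] = 0
  external g (inj₁ e ∷ es) = g e ℕ.+ external g es
  external g (inj₂ _ ∷ es) = external g es

  halvesAt : Label G → Fin (nE G) → ℕ
  halvesAt x e = indicator (labelEq (bEnd G σ (inj₁ e) zero) x) ℕ.+ indicator (labelEq (bEnd G σ (inj₁ e) (suc zero)) x)

  degreeAt : Label G → List (BEdge G) → ℕ
  degreeAt x es = count (λ y → labelEq y x) (verts es)

  private
    incidence : Label G → BEdge G → ℕ
    incidence x e = indicator (labelEq (bEnd G σ e zero) x) ℕ.+ indicator (labelEq (bEnd G σ e (suc zero)) x)

    externalOf : (Fin (nE G) → ℕ) → BEdge G → ℕ
    externalOf g (inj₁ e) = g e
    externalOf g (inj₂ _) = 0

    external-∷ : ∀ g e es → external g (e ∷ es) ≡ externalOf g e ℕ.+ external g es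
    external-∷ g (inj₁ e) es = refl
    external-∷ g (inj₂ _) es = refl

    -- Degrees are sums over edges, so each degree equation reduces to one identity per edge. The
    -- term `r` is abstract because the third edge is a chord at the ends of a triangle and an
    -- external edge at its middle.
    degree-split : ∀ x (p q : BEdge G → Bool) (r : List (BEdge G) → ℕ) (r₁ : BEdge G → ℕ) →
      r [] ≡ 0 → (∀ e es → r (e ∷ es) ≡ r₁ e ℕ.+ r es) →
      (∀ e → incidence x e ≡ (indicator (p e) ℕ.+ indicator (q e)) ℕ.+ r₁ e) →
      ∀ es → degreeAt x es ≡ (count p es ℕ.+ count q es) ℕ.+ r es
    degree-split x p q r r₁ r[] r∷ h [] = sym r[]
    degree-split x p q r r₁ r[] r∷ h (e ∷ es) = begin
      i₀ ℕ.+ (i₁ ℕ.+ degreeAt x es)                  ≡⟨ sym (ℕ.+-assoc i₀ i₁ _) ⟩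
      incidence x e ℕ.+ degreeAt x es                ≡⟨ cong₂ ℕ._+_ (h e) (degree-split x p q r r₁ r[] r∷ h es) ⟩
      ((indicator (p e) ℕ.+ indicator (q e)) ℕ.+ r₁ e) ℕ.+ ((count p es ℕ.+ count q es) ℕ.+ r es)
        ≡⟨ solve 6 (λ a b c d f g → ((a :+ b) :+ c) :+ ((d :+ f) :+ g) := ((a :+ d) :+ (b :+ f)) :+ (c :+ g)) refl
             (indicator (p e)) (indicator (q e)) (r₁ e) (count p es) (count q es) (r es) ⟩
      (count p (e ∷ es) ℕ.+ count q (e ∷ es)) ℕ.+ (r₁ e ℕ.+ r es) ≡⟨ cong (count p (e ∷ es) ℕ.+ count q (e ∷ es) ℕ.+_) (sym (r∷ e es)) ⟩
      (count p (e ∷ es) ℕ.+ count q (e ∷ es)) ℕ.+ r (e ∷ es) ∎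
      where
      open ≡-Reasoning
      open +-*-Solverℕ
      i₀ i₁ : ℕ
      i₀ = indicator (labelEq (bEnd G σ e zero) x)
      i₁ = indicator (labelEq (bEnd G σ e (suc zero)) x)

    six≠ : ∀ {v n} e k → n % 3 ≢ 1 → labelEq (bEnd G σ (inj₁ e) k) (v , n) ≡ false
    six≠ {v} {n} e k h = labelEq-mod (end G e k) v {6 ℕ.* toℕ (pos σ e k) ℕ.+ 1} {n} λ p → h (trans (sym p) (residue₆ (toℕ (pos σ e k))))

    both-ends : ∀ x e a b → labelEq (bEnd G σ e zero) x ≡ a → labelEq (bEnd G σ e (suc zero)) x ≡ b →
      incidence x e ≡ indicator a ℕ.+ indicator b
    both-ends x e a b p q = cong₂ (λ a b → indicator a ℕ.+ indicator b) p q

    path-incidence : ∀ v n w (j : Fin (6 ℕ.* D w ℕ.∸ 1)) →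
      incidence (v , n) (inj₂ (w , inj₁ j)) ≡ indicator (arrives v n (inj₂ (w , inj₁ j))) ℕ.+ indicator (isPath v n (inj₂ (w , inj₁ j)))
    path-incidence v zero w j = trans (cong (λ b → indicator (labelEq (w , toℕ j) (v , 0)) ℕ.+ indicator b)
      (labelEq-miss {p = w , suc (toℕ j)} {v , 0} λ ())) (ℕ.+-identityʳ _)
    path-incidence v (suc n) w j = ℕ.+-comm (indicator (labelEq (w , toℕ j) (v , suc n))) _

    chord-end : ∀ (v : Fin (nV G)) j (w : Fin (nV G)) k → labelEq (w , 3 ℕ.* k) (v , 3 ℕ.* j) ≡ labelEq (w , k) (v , j)
    chord-end v j w k = labelEq-second w v (ℕ.*-cancelˡ-≡ k j 3) (cong (3 ℕ.*_))

    chord-end₂ : ∀ (v : Fin (nV G)) j (w : Fin (nV G)) k → labelEq (w , 3 ℕ.* k ℕ.+ 2) (v , 3 ℕ.* j ℕ.+ 2) ≡ labelEq (w , k) (v , j)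
    chord-end₂ v j w k = labelEq-second w v (λ p → ℕ.*-cancelˡ-≡ k j 3 (ℕ.+-cancelʳ-≡ 2 _ _ p)) (cong (λ n → 3 ℕ.* n ℕ.+ 2))

  degree-left : ∀ v j es → degreeAt (v , 3 ℕ.* j) es ≡
    (count (arrives v (3 ℕ.* j)) es ℕ.+ count (isPath v (3 ℕ.* j)) es) ℕ.+ count (isChord v j) es
  degree-left v j = degree-split (v , 3 ℕ.* j) (arrives v (3 ℕ.* j)) (isPath v (3 ℕ.* j)) (count (isChord v j)) (indicator ∘ isChord v j)
    refl (λ _ _ → refl) step
    where
    arrives-ext : ∀ n e → arrives v n (inj₁ e) ≡ false
    arrives-ext zero e = refl
    arrives-ext (suc n) e = refl
    arrives-chord : ∀ n w k → arrives v n (inj₂ (w , inj₂ k)) ≡ false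
    arrives-chord zero w k = refl
    arrives-chord (suc n) w k = refl
    ≢1 : (3 ℕ.* j) % 3 ≢ 1
    ≢1 p = contradiction (trans (sym (residue₀ j)) p) λ ()
    step : ∀ e → _
    step (inj₁ e) = trans (both-ends (v , 3 ℕ.* j) (inj₁ e) false false (six≠ {v} e zero ≢1) (six≠ {v} e (suc zero) ≢1))
      (cong (λ b → (indicator b ℕ.+ 0) ℕ.+ 0) (sym (arrives-ext (3 ℕ.* j) e)))
    step (inj₂ (w , inj₁ k)) = trans (path-incidence v (3 ℕ.* j) w k) (sym (ℕ.+-identityʳ _))
    step (inj₂ (w , inj₂ k)) = trans (both-ends (v , 3 ℕ.* j) (inj₂ (w , inj₂ k)) (labelEq (w , toℕ k) (v , j)) false (chord-end v j w (toℕ k))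
      (labelEq-mod w v {3 ℕ.* toℕ k ℕ.+ 2} {3 ℕ.* j} (λ p → contradiction (trans (sym (residue (toℕ k) 2)) (trans p (residue₀ j))) λ ())))
      (trans (ℕ.+-identityʳ _) (cong (λ b → (indicator b ℕ.+ 0) ℕ.+ indicator (labelEq (w , toℕ k) (v , j))) (sym (arrives-chord (3 ℕ.* j) w k))))

  degree-middle : ∀ v j es → degreeAt (v , suc (3 ℕ.* j)) es ≡
    (count (isPath v (3 ℕ.* j)) es ℕ.+ count (isPath v (suc (3 ℕ.* j))) es) ℕ.+ external (halvesAt (v , suc (3 ℕ.* j))) es
  degree-middle v j = degree-split (v , suc (3 ℕ.* j)) (isPath v (3 ℕ.* j)) (isPath v (suc (3 ℕ.* j))) (external _) (externalOf (halvesAt (v , suc (3 ℕ.* j))))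
    refl (external-∷ _) step
    where
    mod1 : suc (3 ℕ.* j) % 3 ≡ 1
    mod1 = trans (cong (_% 3) (ℕ.+-comm 1 (3 ℕ.* j))) (residue j 1)
    step : ∀ e → _
    step (inj₁ e) = refl
    step (inj₂ (w , inj₁ k)) = trans (path-incidence v (suc (3 ℕ.* j)) w k) (sym (ℕ.+-identityʳ _))
    step (inj₂ (w , inj₂ k)) = both-ends (v , suc (3 ℕ.* j)) (inj₂ (w , inj₂ k)) false false
      (labelEq-mod w v {3 ℕ.* toℕ k} {suc (3 ℕ.* j)} (λ p → contradiction (trans (sym (residue₀ (toℕ k))) (trans p mod1)) λ ()))
      (labelEq-mod w v {3 ℕ.* toℕ k ℕ.+ 2} {suc (3 ℕ.* j)} (λ p → contradiction (trans (sym (residue (toℕ k) 2)) (trans p mod1)) λ ()))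

  degree-right : ∀ v j es → degreeAt (v , suc (suc (3 ℕ.* j))) es ≡
    (count (isPath v (suc (3 ℕ.* j))) es ℕ.+ count (isPath v (suc (suc (3 ℕ.* j)))) es) ℕ.+ count (isChord v j) es
  degree-right v j = degree-split (v , suc (suc (3 ℕ.* j))) (isPath v (suc (3 ℕ.* j))) (isPath v (suc (suc (3 ℕ.* j)))) (count (isChord v j)) (indicator ∘ isChord v j)
    refl (λ _ _ → refl) step
    where
    mod2 : suc (suc (3 ℕ.* j)) % 3 ≡ 2
    mod2 = trans (cong (_% 3) (ℕ.+-comm 2 (3 ℕ.* j))) (residue j 2)
    ≢1 : suc (suc (3 ℕ.* j)) % 3 ≢ 1
    ≢1 p = contradiction (trans (sym mod2) p) λ ()
    step : ∀ e → _
    step (inj₁ e) = both-ends (v , suc (suc (3 ℕ.* j))) (inj₁ e) false false (six≠ {v} e zero ≢1) (six≠ {v} e (suc zero) ≢1)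
    step (inj₂ (w , inj₁ k)) = trans (path-incidence v (suc (suc (3 ℕ.* j))) w k) (sym (ℕ.+-identityʳ _))
    step (inj₂ (w , inj₂ k)) = both-ends (v , suc (suc (3 ℕ.* j))) (inj₂ (w , inj₂ k)) false (labelEq (w , toℕ k) (v , j))
      (labelEq-mod w v {3 ℕ.* toℕ k} {suc (suc (3 ℕ.* j))} (λ p → contradiction (trans (sym (residue₀ (toℕ k))) (trans p mod2)) λ ()))
      (trans (cong (λ n → labelEq (w , 3 ℕ.* toℕ k ℕ.+ 2) (v , n)) (ℕ.+-comm 2 (3 ℕ.* j))) (chord-end₂ v j w (toℕ k)))

  -- External edges enter the degree equations only through the weight, so covers of equal weight
  -- have equal external counts at every label.
  external-weight : ∀ g es → external g es ≡ sumFinℕ (nE G) (λ e → lookup (weight es) e ℕ.* g e)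
  external-weight g [] = sym (weighted-zero (nE G) g)
  external-weight g (inj₁ e ∷ es) = trans (cong₂ ℕ._+_ (sym unit) (external-weight g es)) (sym (weighted-+ (edgeWeight G (inj₁ e)) (weight es) g))
    where
    unit : sumFinℕ (nE G) (λ i → lookup (edgeWeight G (inj₁ e)) i ℕ.* g i) ≡ g e
    unit = trans (sumFinℕ-single (nE G) _ e λ i i≢e → cong (ℕ._* g i) (unit-zero e i i≢e))
      (trans (cong (ℕ._* g e) (unit-one e)) (ℕ.+-identityʳ (g e)))
  external-weight g (inj₂ x ∷ es) = trans (external-weight g es) (sym (trans (weighted-+ (replicate (nE G) 0) (weight es) g)
    (cong (ℕ._+ sumFinℕ (nE G) (λ e → lookup (weight es) e ℕ.* g e)) (weighted-zero (nE G) g))))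

  isExternal : Fin (nE G) → BEdge G → Bool
  isExternal e (inj₁ e′) = does (e′ Fin.≟ e)
  isExternal e (inj₂ _) = false

  weight-count : ∀ e es → lookup (weight es) e ≡ count (isExternal e) es
  weight-count e [] = Vec.lookup-replicate e 0
  weight-count e (f ∷ es) = trans (Vec.lookup-zipWith ℕ._+_ e (edgeWeight G f) (weight es)) (cong₂ ℕ._+_ (head f) (weight-count e es))
    where
    head : ∀ f → lookup (edgeWeight G f) e ≡ indicator (isExternal e f)
    head (inj₁ e′) with e′ Fin.≟ e
    ... | yes refl = unit-one e
    ... | no ne = unit-zero e′ e (ne ∘ sym)
    head (inj₂ _) = Vec.lookup-replicate e 0

  isExternal-sound : ∀ {e} f → isExternal e f ≡ true → f ≡ inj₁ e
  isExternal-sound {e} (inj₁ e′) h with e′ Fin.≟ e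
  ... | yes refl = refl

  module _ {es : List (BEdge G)} (cover : Covers es) where

    cover-unique-verts : Unique (verts es)
    cover-unique-verts = unique-↭ (↭-sym cover) vertexList-unique

    cover-unique-edges : Unique es
    cover-unique-edges = go es cover-unique-verts
      where
      go : ∀ es → Unique (verts es) → Unique es
      go [] u = []
      go (e ∷ es) ((_ ∷ p) ∷ _ ∷ u) = All.tabulate (λ {f} f∈ e≡f → All.lookup p (Std.∈-verts f∈ (inj₁ (cong (λ g → bEnd G σ g zero) e≡f))) refl) ∷ go es u

    degree-one : ∀ v n → n < 6 ℕ.* D v → degreeAt (v , n) es ≡ 1
    degree-one v n lt = count-single _ cover-unique-verts (Perm.∈-resp-↭ (↭-sym cover) (Perm.∈-resp-↭ (↭-sym vertexList-↭) (∈-allLabels G lt)))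
      (labelEq-refl (v , n)) λ _ → labelEq-sound

    triangleAt : ∀ v k → k < 2 ℕ.* D v → Triangle (count (arrives v (3 ℕ.* k)) es) (external (halvesAt (v , suc (3 ℕ.* k))) es)
      (count (isPath v (3 ℕ.* k)) es) (count (isPath v (suc (3 ℕ.* k))) es) (count (isChord v k) es) (count (isPath v (suc (suc (3 ℕ.* k)))) es)
    triangleAt v k lt = triangle _ _ _ _ _ _
      (trans (sym (degree-left v k es)) (degree-one v _ (ℕ.≤-trans (ℕ.m≤n+m _ 2) last)))
      (trans (sym (degree-middle v k es)) (degree-one v _ (ℕ.≤-trans (ℕ.n≤1+n _) last)))
      (trans (sym (degree-right v k es)) (degree-one v _ last))
      where
      last : suc (suc (suc (3 ℕ.* k))) ≤ 6 ℕ.* D v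
      last = subst₂ _≤_ (ℕ.*-suc 3 k) (sym (ℕ.*-assoc 3 2 (D v))) (ℕ.*-monoʳ-≤ 3 lt)

  module _ {es es′ : List (BEdge G)} (cover : Covers es) (cover′ : Covers es′) (same : weight es ≡ weight es′) where
    private
      external-same : ∀ g → external g es ≡ external g es′
      external-same g = trans (external-weight g es) (trans (cong (λ w → sumFinℕ (nE G) (λ e → lookup w e ℕ.* g e)) same) (sym (external-weight g es′)))

      -- Declared ahead because it and `triangle-same` recurse into each other along the gadget:
      -- path edge 3k + 2, which leaves triangle k, is the one arriving at label 3(k + 1).
      arrives-same : ∀ v k → k < 2 ℕ.* D v → count (arrives v (3 ℕ.* k)) es ≡ count (arrives v (3 ℕ.* k)) es′

      triangle-same : ∀ v k → k < 2 ℕ.* D v →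
        (count (isPath v (3 ℕ.* k)) es ≡ count (isPath v (3 ℕ.* k)) es′) ×
        (count (isPath v (suc (3 ℕ.* k))) es ≡ count (isPath v (suc (3 ℕ.* k))) es′) ×
        (count (isChord v k) es ≡ count (isChord v k) es′) ×
        (count (isPath v (suc (suc (3 ℕ.* k)))) es ≡ count (isPath v (suc (suc (3 ℕ.* k)))) es′)
      triangle-same v k lt = triangle-unique
        (subst₂ (λ s e → Triangle s e _ _ _ _) (arrives-same v k lt) (external-same (halvesAt (v , suc (3 ℕ.* k)))) (triangleAt cover v k lt))
        (triangleAt cover′ v k lt)

      arrives-same v zero lt = trans (count-zero (arrives v 0) es λ _ → refl) (sym (count-zero (arrives v 0) es′ λ _ → refl))
      arrives-same v (suc k) lt = subst (λ n → count (arrives v n) es ≡ count (arrives v n) es′) (sym (ℕ.*-suc 3 k))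
        (proj₂ (proj₂ (proj₂ (triangle-same v k (ℕ.<-trans ℕ.≤-refl lt)))))

      path-same : ∀ v n → n < 6 ℕ.* D v → count (isPath v n) es ≡ count (isPath v n) es′
      path-same v n lt = subst (λ i → count (isPath v i) es ≡ count (isPath v i) es′) (sym split) (by (n % 3) (ℕ.m%n<n n 3))
        where
        k : ℕ
        k = n ℕ./ 3
        split : n ≡ n % 3 ℕ.+ 3 ℕ.* k
        split = trans (ℕ.m≡m%n+[m/n]*n n 3) (cong (n % 3 ℕ.+_) (ℕ.*-comm k 3))
        k< : k < 2 ℕ.* D v
        k< = ℕ.m<n*o⇒m/o<n (subst (n <_) (trans (ℕ.*-assoc 3 2 (D v)) (ℕ.*-comm 3 (2 ℕ.* D v))) lt)
        by : ∀ r → r < 3 → count (isPath v (r ℕ.+ 3 ℕ.* k)) es ≡ count (isPath v (r ℕ.+ 3 ℕ.* k)) es′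
        by 0 _ = proj₁ (triangle-same v k k<)
        by 1 _ = proj₁ (proj₂ (triangle-same v k k<))
        by 2 _ = proj₂ (proj₂ (proj₂ (triangle-same v k k<)))
        by (suc (suc (suc r))) (ℕ.s≤s (ℕ.s≤s (ℕ.s≤s ())))

      isPath-sound : ∀ {v} {j : Fin (6 ℕ.* D v ℕ.∸ 1)} f → isPath v (toℕ j) f ≡ true → f ≡ inj₂ (v , inj₁ j)
      isPath-sound {v} {j} (inj₂ (w , inj₁ i)) h = sound i (labelEq-sound {p = w , toℕ i} {v , toℕ j} h)
        where
        sound : ∀ {w} (i : Fin (6 ℕ.* D w ℕ.∸ 1)) → (w , toℕ i) ≡ (v , toℕ j) → inj₂ (w , inj₁ i) ≡ inj₂ (v , inj₁ j)
        sound i e with Product.,-injectiveˡ e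
        ... | refl = cong (λ i → inj₂ (v , inj₁ i)) (Fin.toℕ-injective (Product.,-injectiveʳ e))

      isChord-sound : ∀ {v} {j : Fin (2 ℕ.* D v)} f → isChord v (toℕ j) f ≡ true → f ≡ inj₂ (v , inj₂ j)
      isChord-sound {v} {j} (inj₂ (w , inj₂ i)) h = sound i (labelEq-sound {p = w , toℕ i} {v , toℕ j} h)
        where
        sound : ∀ {w} (i : Fin (2 ℕ.* D w)) → (w , toℕ i) ≡ (v , toℕ j) → inj₂ (w , inj₂ i) ≡ inj₂ (v , inj₂ j)
        sound i e with Product.,-injectiveˡ e
        ... | refl = cong (λ i → inj₂ (v , inj₂ i)) (Fin.toℕ-injective (Product.,-injectiveʳ e))

      transfer : ∀ (f : BEdge G → Bool) {e} → count f es ≡ count f es′ → e ∈ es → f e ≡ true → (∀ e′ → f e′ ≡ true → e′ ≡ e) → e ∈ es′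
      transfer f c i fe h with count-witness f es′ (λ z → count-positive f i fe (trans c z))
      ... | e′ , i′ , fe′ = subst (_∈ es′) (h e′ fe′) i′

    covers-⊆ : ∀ {e} → e ∈ es → e ∈ es′
    covers-⊆ {inj₁ e} i = transfer (isExternal e)
      (trans (sym (weight-count e es)) (trans (cong (λ w → lookup w e) same) (weight-count e es′))) i (dec-true (e Fin.≟ e) refl) isExternal-sound
    covers-⊆ {inj₂ (v , inj₁ j)} i = transfer (isPath v (toℕ j))
      (path-same v (toℕ j) (ℕ.<-≤-trans (Fin.toℕ<n j) (ℕ.m∸n≤m (6 ℕ.* D v) 1))) i (labelEq-refl (v , toℕ j)) isPath-sound
    covers-⊆ {inj₂ (v , inj₂ j)} i = transfer (isChord v (toℕ j))
      (proj₁ (proj₂ (proj₂ (triangle-same v (toℕ j) (Fin.toℕ<n j))))) i (labelEq-refl (v , toℕ j)) isChord-sound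

  -- An edge lies in a cover iff its count is nonzero, and all counts agree. This is the uniqueness
  -- that `projPf-coefficient` asks for.
  cover-determined : ∀ {es es′} → Covers es → Covers es′ → weight es′ ≡ weight es → es′ ↭ es
  cover-determined c c′ same = same-members-↭ (cover-unique-edges c′) (cover-unique-edges c)
    (covers-⊆ c′ c same) (covers-⊆ c c′ (sym same))

  support : Mono (nE G) → Vec Bool (nE G)
  support = Vec.map λ n → not (n ≡ᵇ 0)

  subsetMono-support : ∀ {m} (α : Mono m) → (∀ e → lookup α e ≤ 1) → subsetMono (Vec.map (λ n → not (n ≡ᵇ 0)) α) ≡ α
  subsetMono-support [] h = refl
  subsetMono-support (zero ∷ α) h = cong (0 ∷_) (subsetMono-support α (h ∘ suc))
  subsetMono-support (suc zero ∷ α) h = cong (1 ∷_) (subsetMono-support α (h ∘ suc))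
  subsetMono-support (suc (suc n) ∷ α) h = contradiction (h zero) λ { (ℕ.s≤s ()) }

  lookup-subsetMono : ∀ {m} (S : Vec Bool m) e → lookup (subsetMono S) e ≡ indicator (lookup S e)
  lookup-subsetMono (b ∷ S) zero = refl
  lookup-subsetMono (b ∷ S) (suc e) = lookup-subsetMono S e

  subsetDeg-weighted : ∀ S v → subsetDeg G S v ≡ sumFinℕ (nE G) (λ e → lookup (subsetMono S) e ℕ.* halfAt G e v)
  subsetDeg-weighted S v = sumFinℕ-cong (nE G) λ e → trans (term (lookup S e) (halfAt G e v)) (cong (ℕ._* halfAt G e v) (sym (lookup-subsetMono S e)))
    where
    term : ∀ b n → (if b then n else 0) ≡ indicator b ℕ.* n
    term false n = refl
    term true n = sym (ℕ.+-identityʳ n)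

  -- A gadget edge has both ends in one gadget and cancels mod 2, leaving the external half-edges at
  -- `v`.
  parity-external : ∀ v es → parityAt v (verts es) ≡ oddℕ (external (λ e → halfAt G e v) es)
  parity-external v [] = refl
  parity-external v (inj₁ e ∷ es) = trans (cong (λ r → h₀ xor (h₁ xor r)) (parity-external v es))
    (sym (trans (oddℕ-+ (halfAt G e v) (external (λ e → halfAt G e v) es))
      (trans (cong (_xor oddℕ (external (λ e → halfAt G e v) es)) (two-halves h₀ h₁))
        (tautology 3 (λ a b c → (a xor b) xor c) (λ a b c → a xor (b xor c)) refl h₀ h₁ _))))
    where
    h₀ h₁ : Bool
    h₀ = does (end G e zero Fin.≟ v)
    h₁ = does (end G e (suc zero) Fin.≟ v)
    two-halves : ∀ a b → oddℕ ((if a then 1 else 0) ℕ.+ ((if b then 1 else 0) ℕ.+ 0)) ≡ a xor b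
    two-halves false false = refl
    two-halves false true = refl
    two-halves true false = refl
    two-halves true true = refl
  parity-external v (inj₂ (w , inj₁ j) ∷ es) = trans (tautology 2 (λ a b → a xor (a xor b)) (λ a b → b) refl (does (w Fin.≟ v)) _) (parity-external v es)
  parity-external v (inj₂ (w , inj₂ j) ∷ es) = trans (tautology 2 (λ a b → a xor (a xor b)) (λ a b → b) refl (does (w Fin.≟ v)) _) (parity-external v es)

  Even : Vec Bool (nE G) → Set
  Even S = ∀ v → oddℕ (subsetDeg G S v) ≡ false

  cover-weight : ∀ {es} → Covers es → Σ (Vec Bool (nE G)) λ S → (weight es ≡ subsetMono S) × Even S
  cover-weight {es} cover = S , sym w , λ v → begin
    oddℕ (subsetDeg G S v) ≡⟨ cong oddℕ (subsetDeg-weighted S v) ⟩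
    oddℕ (sumFinℕ (nE G) (λ e → lookup (subsetMono S) e ℕ.* halfAt G e v))
      ≡⟨ cong (λ α → oddℕ (sumFinℕ (nE G) (λ e → lookup α e ℕ.* halfAt G e v))) w ⟩
    oddℕ (sumFinℕ (nE G) (λ e → lookup (weight es) e ℕ.* halfAt G e v)) ≡⟨ cong oddℕ (sym (external-weight _ es)) ⟩
    oddℕ (external (λ e → halfAt G e v) es) ≡⟨ sym (parity-external v es) ⟩
    parityAt v (verts es) ≡⟨ parityAt-↭ v (↭-trans cover vertexList-↭) ⟩
    parityAt v (allLabels G) ≡⟨ allLabels-even G v ⟩
    false ∎
    where
    open ≡-Reasoning
    S : Vec Bool (nE G)
    S = support (weight es)
    -- A cover lists no edge twice, since its labels are distinct; so the exponents are those of a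
    -- subset.
    at-most-one : ∀ e → lookup (weight es) e ≤ 1
    at-most-one e with lookup (weight es) e in eq
    ... | zero = ℕ.z≤n
    ... | suc n with count-witness (isExternal e) es (λ z → contradiction (trans (sym eq) (trans (weight-count e es) z)) λ ())
    ...   | f , i , fe = ℕ.≤-reflexive (trans (sym eq) (trans (weight-count e es)
              (count-single (isExternal e) (cover-unique-edges cover) i fe λ _ h → trans (isExternal-sound _ h) (sym (isExternal-sound _ fe)))))
    w : subsetMono S ≡ weight es
    w = subsetMono-support (weight es) at-most-one

-- Quadratic functions

Affine : ∀ {m} → (Vec Bool m → Bool) → Set
Affine f = ∀ x y → f (x ⊕ y) ≡ f x xor (f y xor f 𝟎)

affine-const : ∀ {m} c → Affine {m} (λ _ → c)
affine-const c x y = tautology 1 (λ c → c) (λ c → c xor (c xor c)) refl c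

affine-lookup : ∀ {m} (e : Fin m) → Affine (λ x → lookup x e)
affine-lookup zero (a ∷ x) (b ∷ y) = tautology 2 _xor_ (λ a b → a xor (b xor false)) refl a b
affine-lookup (suc e) (a ∷ x) (b ∷ y) = affine-lookup e x y

affine-xor : ∀ {m} (f g : Vec Bool m → Bool) → Affine f → Affine g → Affine (λ x → f x xor g x)
affine-xor f g F G x y = trans (cong₂ _xor_ (F x y) (G x y))
  (tautology 6 (λ a b c d e h → (a xor (b xor c)) xor (d xor (e xor h))) (λ a b c d e h → (a xor d) xor ((b xor e) xor (c xor h))) refl
    (f x) (f y) (f 𝟎) (g x) (g y) (g 𝟎))

affine-∧ : ∀ {m} (f : Vec Bool m → Bool) c → Affine f → Affine (λ x → f x ∧ c)
affine-∧ f c F x y = trans (cong (_∧ c) (F x y))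
  (tautology 4 (λ a b d c → (a xor (b xor d)) ∧ c) (λ a b d c → (a ∧ c) xor ((b ∧ c) xor (d ∧ c))) refl (f x) (f y) (f 𝟎) c)

affine-not : ∀ {m} (f : Vec Bool m → Bool) → Affine f → Affine (λ x → not (f x))
affine-not f F x y = trans (cong not (F x y))
  (tautology 3 (λ a b c → not (a xor (b xor c))) (λ a b c → not a xor (not b xor not c)) refl (f x) (f y) (f 𝟎))

affine-cong : ∀ {m} {f g : Vec Bool m → Bool} → (∀ x → f x ≡ g x) → Affine g → Affine f
affine-cong h G x y = trans (h (x ⊕ y)) (trans (G x y) (sym (cong₂ _xor_ (h x) (cong₂ _xor_ (h y) (h 𝟎)))))

quadratic-cong : ∀ {m} {f g : Vec Bool m → Bool} → (∀ x → f x ≡ g x) → Quadratic g → Quadratic f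
quadratic-cong {f = f} {g} h G x y z = trans (p (x ⊕ y) z) (trans (G x y z) (sym (cong₂ _xor_ (p x z) (p y z))))
  where
  p : ∀ x y → polar f x y ≡ polar g x y
  p x y = cong₂ _xor_ (h (x ⊕ y)) (cong₂ _xor_ (h x) (cong₂ _xor_ (h y) (h 𝟎)))

quadratic-xor : ∀ {m} (f g : Vec Bool m → Bool) → Quadratic f → Quadratic g → Quadratic (λ x → f x xor g x)
quadratic-xor f g F G x y z = trans (p (x ⊕ y) z) (trans (cong₂ _xor_ (F x y z) (G x y z))
  (trans (tautology 4 (λ a b c d → (a xor b) xor (c xor d)) (λ a b c d → (a xor c) xor (b xor d)) refl
    (polar f x z) (polar f y z) (polar g x z) (polar g y z)) (sym (cong₂ _xor_ (p x z) (p y z)))))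
  where
  p : ∀ x y → polar (λ x → f x xor g x) x y ≡ polar f x y xor polar g x y
  p x y = tautology 8 (λ a b c d a′ b′ c′ d′ → (a xor a′) xor ((b xor b′) xor ((c xor c′) xor (d xor d′))))
    (λ a b c d a′ b′ c′ d′ → (a xor (b xor (c xor d))) xor (a′ xor (b′ xor (c′ xor d′)))) refl
    (f (x ⊕ y)) (f x) (f y) (f 𝟎) (g (x ⊕ y)) (g x) (g y) (g 𝟎)

quadratic-∧ : ∀ {m} (f g : Vec Bool m → Bool) → Affine f → Affine g → Quadratic (λ x → f x ∧ g x)
quadratic-∧ f g F G x y z = begin
  polar (λ x → f x ∧ g x) (x ⊕ y) z ≡⟨ p (x ⊕ y) z ⟩
  ((f (x ⊕ y) xor f 𝟎) ∧ (g z xor g 𝟎)) xor ((f z xor f 𝟎) ∧ (g (x ⊕ y) xor g 𝟎))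
    ≡⟨ cong₂ (λ a b → ((a xor f 𝟎) ∧ (g z xor g 𝟎)) xor ((f z xor f 𝟎) ∧ (b xor g 𝟎))) (F x y) (G x y) ⟩
  (((f x xor (f y xor f 𝟎)) xor f 𝟎) ∧ (g z xor g 𝟎)) xor ((f z xor f 𝟎) ∧ ((g x xor (g y xor g 𝟎)) xor g 𝟎))
    ≡⟨ tautology 8 (λ a b c d a′ b′ c′ d′ → (((a xor (b xor d)) xor d) ∧ (c′ xor d′)) xor ((c xor d) ∧ ((a′ xor (b′ xor d′)) xor d′)))
         (λ a b c d a′ b′ c′ d′ → (((a xor d) ∧ (c′ xor d′)) xor ((c xor d) ∧ (a′ xor d′))) xor (((b xor d) ∧ (c′ xor d′)) xor ((c xor d) ∧ (b′ xor d′)))) refl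
         (f x) (f y) (f z) (f 𝟎) (g x) (g y) (g z) (g 𝟎) ⟩
  _ ≡⟨ sym (cong₂ _xor_ (p x z) (p y z)) ⟩
  polar (λ x → f x ∧ g x) x z xor polar (λ x → f x ∧ g x) y z ∎
  where
  open ≡-Reasoning
  p : ∀ x y → polar (λ x → f x ∧ g x) x y ≡ ((f x xor f 𝟎) ∧ (g y xor g 𝟎)) xor ((f y xor f 𝟎) ∧ (g x xor g 𝟎))
  p x y = trans (cong₂ (λ a b → (a ∧ b) xor ((f x ∧ g x) xor ((f y ∧ g y) xor (f 𝟎 ∧ g 𝟎)))) (F x y) (G x y))
    (tautology 6 (λ a b d a′ b′ d′ → ((a xor (b xor d)) ∧ (a′ xor (b′ xor d′))) xor ((a ∧ a′) xor ((b ∧ b′) xor (d ∧ d′))))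
      (λ a b d a′ b′ d′ → ((a xor d) ∧ (b′ xor d′)) xor ((b xor d) ∧ (a′ xor d′))) refl
      (f x) (f y) (f 𝟎) (g x) (g y) (g 𝟎))

quadratic-affine : ∀ {m} {f : Vec Bool m → Bool} → Affine f → Quadratic f
quadratic-affine {f = f} F = quadratic-cong (λ x → tautology 1 (λ a → a) (λ a → a ∧ true) refl (f x)) (quadratic-∧ f (λ _ → true) F (affine-const true))

quadratic-const : ∀ {m} c → Quadratic {m} (λ _ → c)
quadratic-const c = quadratic-affine (affine-const c)

-- A function of two bits has an algebraic normal form of degree at most two; `p`, `q` and `r` are
-- its coefficients at `s`, at `e` and at their product.
quadratic-binary : ∀ {m} (g : Bool → Bool → Bool) (s e : Vec Bool m → Bool) → Affine s → Affine e → Quadratic (λ x → g (s x) (e x))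
quadratic-binary g s e S E = quadratic-cong (λ x → interpolate (s x) (e x))
  (quadratic-xor (λ _ → g false false) (λ x → (s x ∧ p) xor (e x ∧ (q xor (s x ∧ r)))) (quadratic-const (g false false))
    (quadratic-xor (λ x → s x ∧ p) (λ x → e x ∧ (q xor (s x ∧ r))) (quadratic-∧ s (λ _ → p) S (affine-const p))
      (quadratic-∧ e (λ x → q xor (s x ∧ r)) E (affine-xor (λ _ → q) (λ x → s x ∧ r) (affine-const q) (affine-∧ s r S)))))
  where
  p q r : Bool
  p = g false false xor g true false
  q = g false false xor g false true
  r = p xor (g false true xor g true true)
  interpolate : ∀ a b → g a b ≡ g false false xor ((a ∧ (g false false xor g true false)) xor
    (b ∧ ((g false false xor g false true) xor (a ∧ ((g false false xor g true false) xor (g false true xor g true true))))))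
  interpolate a b = trans (table a b) (tautology 6 (λ a b p q r t → if a then (if b then t else r) else (if b then q else p))
      (λ a b p q r t → p xor ((a ∧ (p xor r)) xor (b ∧ ((p xor q) xor (a ∧ ((p xor r) xor (q xor t))))))) refl
      a b (g false false) (g false true) (g true false) (g true true))
    where
    table : ∀ a b → g a b ≡ (if a then (if b then g true true else g true false) else (if b then g false true else g false false))
    table false false = refl
    table false true = refl
    table true false = refl
    table true true = refl

-- Words with conditional letters

when : {A : Set} → Bool → A → List A
when b x = if b then x ∷ [] else []

-- The order of the letters is the same for all S and only their presence varies; this makes the
-- inversion parity a polynomial in S.
Conditional : ℕ → Set → Set
Conditional m X = List ((Vec Bool m → Bool) × X)

eval : ∀ {m X} → Conditional m X → Vec Bool m → List X
eval [] S = []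
eval ((u , y) ∷ L) S = when (u S) y ++ eval L S

eval-++ : ∀ {m X} (L M : Conditional m X) S → eval (L ++ M) S ≡ eval L S ++ eval M S
eval-++ [] M S = refl
eval-++ ((u , y) ∷ L) M S = trans (cong (when (u S) y ++_) (eval-++ L M S)) (sym (List.++-assoc (when (u S) y) (eval L S) (eval M S)))

eval-concatMap : ∀ {m X} {A : Set} (F : A → Conditional m X) xs S → eval (concatMap F xs) S ≡ concatMap (λ x → eval (F x) S) xs
eval-concatMap F [] S = refl
eval-concatMap F (x ∷ xs) S = trans (eval-++ (F x) (concatMap F xs) S) (cong (eval (F x) S ++_) (eval-concatMap F xs S))

AllAffine : ∀ {m X} → Conditional m X → Set
AllAffine L = All (λ p → Affine (proj₁ p)) L

module _ {X : Set} (T : X → X → Bool) (tournament : ∀ {p q} → p ≢ q → T q p ≡ not (T p q)) where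
  open Inversions T tournament

  before-affine : ∀ {m} (x : X) {L : Conditional m X} → AllAffine L → Affine (λ S → before x (eval L S))
  before-affine x [] = affine-const false
  before-affine x {(u , y) ∷ L} (U ∷ h) = affine-cong (λ S → head (u S) (eval L S)) (affine-xor (λ S → u S ∧ T y x) (λ S → before x (eval L S)) (affine-∧ u (T y x) U) (before-affine x h))
    where
    head : ∀ b l → before x (when b y ++ l) ≡ (b ∧ T y x) xor before x l
    head false l = refl
    head true l = refl

  -- A pair out of order counts iff both letters are present, a product of two affine conditions.
  -- The head supplies one factor, and the partners collect in `before`, which is affine.
  inv-quadratic : ∀ {m} {L : Conditional m X} → AllAffine L → Quadratic (λ S → inv (eval L S))
  inv-quadratic [] = quadratic-const false
  inv-quadratic {L = (u , y) ∷ L} (U ∷ h) = quadratic-cong (λ S → head (u S) (eval L S)) (quadratic-xor (λ S → u S ∧ before y (eval L S)) (λ S → inv (eval L S)) (quadratic-∧ u (λ S → before y (eval L S)) U (before-affine y h)) (inv-quadratic h))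
    where
    head : ∀ b l → inv (when b y ++ l) ≡ (b ∧ before y l) xor inv l
    head false l = refl
    head true l = refl

-- Perfect matchings realising the even subsets

concatMap-↭ : ∀ {A B : Set} (f : A → List B) {xs ys} → xs ↭ ys → concatMap f xs ↭ concatMap f ys
concatMap-↭ f Perm.refl = ↭-refl
concatMap-↭ f (Perm.prep x p) = Perm.++⁺ˡ (f x) (concatMap-↭ f p)
concatMap-↭ f (Perm.swap x y p) = ↭-trans (Perm.++⁺ˡ (f x) (Perm.++⁺ˡ (f y) (concatMap-↭ f p))) (Perm.shifts (f x) (f y))
concatMap-↭ f (Perm.trans p q) = ↭-trans (concatMap-↭ f p) (concatMap-↭ f q)

concatMap-cong-↭ : ∀ {A B : Set} {f g : A → List B} → (∀ x → f x ↭ g x) → ∀ xs → concatMap f xs ↭ concatMap g xs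
concatMap-cong-↭ h [] = ↭-refl
concatMap-cong-↭ h (x ∷ xs) = Perm.++⁺ (h x) (concatMap-cong-↭ h xs)

concatMap-++-↭ : ∀ {A B : Set} (f g : A → List B) xs → concatMap f xs ++ concatMap g xs ↭ concatMap (λ x → f x ++ g x) xs
concatMap-++-↭ f g [] = ↭-refl
concatMap-++-↭ f g (x ∷ xs) = ↭-trans (↭-reflexive (List.++-assoc (f x) (concatMap f xs) (g x ++ concatMap g xs)))
  (↭-trans (Perm.++⁺ˡ (f x) (Perm.shifts (concatMap f xs) (g x)))
  (↭-trans (Perm.++⁺ˡ (f x) (Perm.++⁺ˡ (g x) (concatMap-++-↭ f g xs))) (↭-reflexive (sym (List.++-assoc (f x) (g x) _)))))

concatMap-++ : ∀ {A B : Set} (f : A → List B) xs ys → concatMap f (xs ++ ys) ≡ concatMap f xs ++ concatMap f ys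
concatMap-++ f [] ys = refl
concatMap-++ f (x ∷ xs) ys = trans (cong (f x ++_) (concatMap-++ f xs ys)) (sym (List.++-assoc (f x) _ _))

concatMap-∘ : ∀ {A B C : Set} (f : B → List C) (g : A → List B) xs → concatMap f (concatMap g xs) ≡ concatMap (λ x → concatMap f (g x)) xs
concatMap-∘ f g [] = refl
concatMap-∘ f g (x ∷ xs) = trans (concatMap-++ f (g x) (concatMap g xs)) (cong (concatMap f (g x) ++_) (concatMap-∘ f g xs))

xorFin : ∀ k → (Fin k → Bool) → Bool
xorFin zero f = false
xorFin (suc k) f = f zero xor xorFin k (f ∘ suc)

-- A stretch of the gadget: the labels k, …, k + 6d − 1, in d blocks of six; block i carries an external edge iff f i.
-- The gadget edges of the matching pair up the labels not taken by external edges, in increasing order.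
module _ {n : ℕ} (v : Fin n) where

  range : ℕ → ℕ → List (Fin n × ℕ)
  range zero k = []
  range (suc d) k = (v , k) ∷ (v , 1 ℕ.+ k) ∷ (v , 2 ℕ.+ k) ∷ (v , 3 ℕ.+ k) ∷ (v , 4 ℕ.+ k) ∷ (v , 5 ℕ.+ k) ∷ range d (6 ℕ.+ k)

  external-word : ∀ d → ℕ → (Fin d → Bool) → List (Fin n × ℕ)
  external-word zero k f = []
  external-word (suc d) k f = when (f zero) (v , 1 ℕ.+ k) ++ external-word d (6 ℕ.+ k) (f ∘ suc)

  gadget-word : ∀ d → ℕ → (Fin d → Bool) → List (Fin n × ℕ)
  gadget-word zero k f = []
  gadget-word (suc d) k f = (v , k) ∷ when (not (f zero)) (v , 1 ℕ.+ k) ++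
    (v , 2 ℕ.+ k) ∷ (v , 3 ℕ.+ k) ∷ (v , 4 ℕ.+ k) ∷ (v , 5 ℕ.+ k) ∷ gadget-word d (6 ℕ.+ k) (f ∘ suc)

  words-↭ : ∀ d k f → external-word d k f ++ gadget-word d k f ↭ range d k
  words-↭ zero k f = ↭-refl
  words-↭ (suc d) k f with f zero
  ... | true = ↭-trans (↭-prep _ (Perm.shifts E ((v , k) ∷ (v , 2 ℕ.+ k) ∷ (v , 3 ℕ.+ k) ∷ (v , 4 ℕ.+ k) ∷ (v , 5 ℕ.+ k) ∷ [])))
      (↭-trans (↭-swap _ _ ↭-refl) (↭-prep _ (↭-prep _ (↭-prep _ (↭-prep _ (↭-prep _ (↭-prep _ (words-↭ d (6 ℕ.+ k) (f ∘ suc)))))))))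
    where
    E : List (Fin n × ℕ)
    E = external-word d (6 ℕ.+ k) (f ∘ suc)
  ... | false = ↭-trans (Perm.shifts E ((v , k) ∷ (v , 1 ℕ.+ k) ∷ (v , 2 ℕ.+ k) ∷ (v , 3 ℕ.+ k) ∷ (v , 4 ℕ.+ k) ∷ (v , 5 ℕ.+ k) ∷ []))
      (↭-prep _ (↭-prep _ (↭-prep _ (↭-prep _ (↭-prep _ (↭-prep _ (words-↭ d (6 ℕ.+ k) (f ∘ suc))))))))
    where
    E : List (Fin n × ℕ)
    E = external-word d (6 ℕ.+ k) (f ∘ suc)

  range-upTo : ∀ d → range d 0 ≡ map (v ,_) (upTo (6 ℕ.* d))
  range-upTo d = go d 0 (λ i → i) (λ i → sym (ℕ.+-identityʳ i))
    where
    go : ∀ d k (g : ℕ → ℕ) → (∀ i → g i ≡ i ℕ.+ k) → range d k ≡ map (v ,_) (List.applyUpTo g (6 ℕ.* d))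
    go zero k g h = refl
    go (suc d) k g h = trans
      (at 0 (at 1 (at 2 (at 3 (at 4 (at 5 (go d (6 ℕ.+ k) (g ∘ (6 ℕ.+_))
        λ i → trans (h (6 ℕ.+ i)) (trans (cong (ℕ._+ k) (ℕ.+-comm 6 i)) (ℕ.+-assoc i 6 k)))))))))
      (cong (λ j → map (v ,_) (List.applyUpTo g j)) (sym (ℕ.*-suc 6 d)))
      where
      at : ∀ i {l l′ : List (Fin n × ℕ)} → l ≡ l′ → (v , i ℕ.+ k) ∷ l ≡ (v , g i) ∷ l′
      at i p = cong₂ _∷_ (cong (v ,_) (sym (h i))) p

  external-word-tabulate : ∀ {A : Set} d k (f : Fin d → Bool) (g : A → List (Fin n × ℕ)) (h : Fin d → A) →
    (∀ i → g (h i) ≡ when (f i) (v , suc (6 ℕ.* toℕ i ℕ.+ k))) → concatMap g (tabulate h) ≡ external-word d k f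
  external-word-tabulate zero k f g h p = refl
  external-word-tabulate (suc d) k f g h p = cong₂ _++_ (p zero) (external-word-tabulate d (6 ℕ.+ k) (f ∘ suc) g (h ∘ suc) λ i →
    trans (p (suc i)) (cong (λ r → when (f (suc i)) (v , suc r))
      (trans (cong (ℕ._+ k) (trans (ℕ.*-suc 6 (toℕ i)) (ℕ.+-comm 6 _))) (ℕ.+-assoc (6 ℕ.* toℕ i) 6 k))))

  parity-external-word : ∀ w d k f → parityAt w (external-word d k f) ≡ does (v Fin.≟ w) ∧ xorFin d f
  parity-external-word w zero k f = tautology 1 (λ _ → false) (λ a → a ∧ false) refl (does (v Fin.≟ w))
  parity-external-word w (suc d) k f with f zero
  ... | false = parity-external-word w d (6 ℕ.+ k) (f ∘ suc)
  ... | true = trans (cong (does (v Fin.≟ w) xor_) (parity-external-word w d (6 ℕ.+ k) (f ∘ suc)))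
    (tautology 2 (λ a b → a xor (a ∧ b)) (λ a b → a ∧ not b) refl (does (v Fin.≟ w)) (xorFin d (f ∘ suc)))

  -- Only `1 ℕ.+ k`, the label an external edge can take, is conditional; however the others are
  -- paired, they appear in the same increasing order.
  gadget-conditional : ∀ {m} d → ℕ → (Fin d → Vec Bool m → Bool) → Conditional m (Fin n × ℕ)
  gadget-conditional zero k f = []
  gadget-conditional (suc d) k f = (always , v , k) ∷ ((λ S → not (f zero S)) , v , 1 ℕ.+ k) ∷
    (always , v , 2 ℕ.+ k) ∷ (always , v , 3 ℕ.+ k) ∷ (always , v , 4 ℕ.+ k) ∷ (always , v , 5 ℕ.+ k) ∷ gadget-conditional d (6 ℕ.+ k) (f ∘ suc)
    where
    always : ∀ {m} → Vec Bool m → Bool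
    always _ = true

  eval-gadget : ∀ {m} d k (f : Fin d → Vec Bool m → Bool) S → eval (gadget-conditional d k f) S ≡ gadget-word d k (λ i → f i S)
  eval-gadget zero k f S = refl
  eval-gadget (suc d) k f S = cong (λ l → (v , k) ∷ when (not (f zero S)) (v , 1 ℕ.+ k) ++
    (v , 2 ℕ.+ k) ∷ (v , 3 ℕ.+ k) ∷ (v , 4 ℕ.+ k) ∷ (v , 5 ℕ.+ k) ∷ l) (eval-gadget d (6 ℕ.+ k) (f ∘ suc) S)

  gadget-affine : ∀ {m} d k (f : Fin d → Vec Bool m → Bool) → (∀ i → Affine (f i)) → AllAffine (gadget-conditional d k f)
  gadget-affine zero k f F = []
  gadget-affine (suc d) k f F = affine-const true ∷ affine-not (f zero) (F zero) ∷ affine-const true ∷ affine-const true ∷ affine-const true ∷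
    affine-const true ∷ gadget-affine d (6 ℕ.+ k) (f ∘ suc) (F ∘ suc)

count-++ : ∀ {A : Set} (f : A → Bool) l l′ → count f (l ++ l′) ≡ count f l ℕ.+ count f l′
count-++ f [] l′ = refl
count-++ f (x ∷ l) l′ = trans (cong (indicator (f x) ℕ.+_) (count-++ f l l′)) (sym (ℕ.+-assoc (indicator (f x)) (count f l) (count f l′)))

vector-ext : ∀ {A : Set} {m} {x y : Vec A m} → (∀ i → lookup x i ≡ lookup y i) → x ≡ y
vector-ext {x = x} {y} h = trans (sym (Vec.tabulate∘lookup x)) (trans (Vec.tabulate-cong h) (Vec.tabulate∘lookup y))

xorOver : {A : Set} → (A → Bool) → List A → Bool
xorOver f [] = false
xorOver f (x ∷ l) = f x xor xorOver f l

dot-tabulate : ∀ {m} (o : Fin m → Bool) (S : Vec Bool m) → dot (Vec.tabulate o) S ≡ xorFin m (λ i → lookup S i ∧ o i)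
dot-tabulate o [] = refl
dot-tabulate o (b ∷ S) = cong₂ _xor_ (tautology 2 _∧_ (λ a b → b ∧ a) refl (o zero) b) (dot-tabulate (o ∘ suc) S)

parityAt-concatMap : ∀ {n} (v : Fin n) (f : Fin n → List (Fin n × ℕ)) (b : Fin n → Bool) →
  (∀ w → parityAt v (f w) ≡ does (w Fin.≟ v) ∧ b w) → parityAt v (concatMap f (allFin n)) ≡ b v
parityAt-concatMap {n} v f b h = present (allFin n) (Unique.allFin⁺ n) (∈-allFin v)
  where
  absent : ∀ ws → (∀ {w} → w ∈ ws → w ≢ v) → parityAt v (concatMap f ws) ≡ false
  absent [] ne = refl
  absent (w ∷ ws) ne = trans (parityAt-++ v (f w) (concatMap f ws))
    (cong₂ _xor_ (trans (h w) (cong (_∧ b w) (dec-false (w Fin.≟ v) (ne (here refl))))) (absent ws (ne ∘ there)))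
  present : ∀ ws → Unique ws → v ∈ ws → parityAt v (concatMap f ws) ≡ b v
  present (w ∷ ws) (w∉ ∷ u) (here refl) = trans (parityAt-++ v (f v) (concatMap f ws))
    (trans (cong₂ _xor_ (trans (h v) (cong (_∧ b v) (dec-true (v Fin.≟ v) refl))) (absent ws λ i e → All.lookup w∉ i (sym e)))
      (tautology 1 (λ a → a xor false) (λ a → a) refl (b v)))
  present (w ∷ ws) (w∉ ∷ u) (there i) = trans (parityAt-++ v (f w) (concatMap f ws))
    (cong₂ _xor_ (trans (h w) (cong (_∧ b w) (dec-false (w Fin.≟ v) (All.lookup w∉ i)))) (present ws u i))

module Realisation (G : Graph) (σ : HalfEdgeOrdering G) (Δ : GadgetOrientations G) (N : ℕ) (num : Fin N ↔ BVert G) where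
  open BlowUp G σ N num
  open Matchings G σ N num

  HalfEdge : Set
  HalfEdge = Fin (nE G) × Fin 2

  halvesOf : Fin (nE G) → List HalfEdge
  halvesOf e = (e , zero) ∷ (e , suc zero) ∷ []

  halfEdges : List HalfEdge
  halfEdges = concatMap halvesOf (allFin (nE G))

  halfAtPos : ∀ v → Fin (deg G v) → HalfEdge
  halfAtPos v i = proj₁ (surj σ v i) , proj₁ (proj₂ (surj σ v i))

  half-end : ∀ v i → end G (proj₁ (halfAtPos v i)) (proj₂ (halfAtPos v i)) ≡ v
  half-end v i = proj₁ (proj₂ (proj₂ (surj σ v i)))

  half-pos : ∀ v i → toℕ (pos σ (proj₁ (halfAtPos v i)) (proj₂ (halfAtPos v i))) ≡ toℕ i
  half-pos v i = proj₂ (proj₂ (proj₂ (surj σ v i)))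

  -- Here `σ` acts as a bijection: it relates the listing of half-edges by edge, natural for G, to
  -- the listing by vertex and position, natural for the gadgets.
  halfEdges-↭ : halfEdges ↭ concatMap (λ v → tabulate (halfAtPos v)) (allFin (nV G))
  halfEdges-↭ = same-members-↭
    (unique-concatMap halvesOf (Unique.allFin⁺ (nE G)) (λ e → ((λ ()) ∷ []) ∷ [] ∷ []) λ i j → trans (sym (edge i)) (edge j))
    (unique-concatMap (λ v → tabulate (halfAtPos v)) (Unique.allFin⁺ (nV G))
      (λ v → Unique.tabulate⁺ λ {i} {j} e → Fin.toℕ-injective (trans (sym (half-pos v i)) (trans (cong (λ h → toℕ (pos σ (proj₁ h) (proj₂ h))) e) (half-pos v j))))
      λ i j → trans (sym (vertex i)) (vertex j))
    (λ {x} _ → to x) (λ {x} _ → from x)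
    where
    edge : ∀ {e x} → x ∈ halvesOf e → proj₁ x ≡ e
    edge (here refl) = refl
    edge (there (here refl)) = refl
    vertex : ∀ {v x} → x ∈ tabulate (halfAtPos v) → end G (proj₁ x) (proj₂ x) ≡ v
    vertex {v} i with ∈-tabulate⁻ {f = halfAtPos v} i
    ... | j , refl = half-end v j
    to : ∀ x → x ∈ concatMap (λ v → tabulate (halfAtPos v)) (allFin (nV G))
    to (e , k) = ∈-concatMap⁺ (λ v → tabulate (halfAtPos v)) (lose (∈-allFin (end G e k))
      (subst (_∈ tabulate (halfAtPos (end G e k))) (inj σ _ _ e k (half-end _ (pos σ e k)) (half-pos _ (pos σ e k))) (∈-tabulate⁺ {f = halfAtPos (end G e k)} (pos σ e k))))
    from : ∀ x → x ∈ halfEdges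
    from (e , zero) = ∈-concatMap⁺ halvesOf (lose (∈-allFin e) (here refl))
    from (e , suc zero) = ∈-concatMap⁺ halvesOf (lose (∈-allFin e) (there (here refl)))

  bits : Vec Bool (nE G) → ∀ v → Fin (deg G v) → Bool
  bits S v i = lookup S (proj₁ (halfAtPos v i))

  end-label : Vec Bool (nE G) → HalfEdge → List (Label G)
  end-label S (e , k) = when (lookup S e) (bEnd G σ (inj₁ e) k)

  externals : Vec Bool (nE G) → List (BEdge G)
  externals S = concatMap (λ e → when (lookup S e) (inj₁ e)) (allFin (nE G))

  verts-externals : ∀ S → verts (externals S) ≡ concatMap (end-label S) halfEdges
  verts-externals S = go (allFin (nE G))
    where
    go : ∀ xs → verts (concatMap (λ e → when (lookup S e) (inj₁ e)) xs) ≡ concatMap (end-label S) (concatMap halvesOf xs)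
    go [] = refl
    go (e ∷ xs) with lookup S e
    ... | true = cong (λ l → _ ∷ _ ∷ l) (go xs)
    ... | false = go xs

  externals-↭ : ∀ S → verts (externals S) ↭ concatMap (λ v → external-word v (deg G v) 0 (bits S v)) (allFin (nV G))
  externals-↭ S = ↭-trans (↭-reflexive (verts-externals S)) (↭-trans (concatMap-↭ (end-label S) halfEdges-↭)
    (↭-reflexive (trans (concatMap-∘ (end-label S) (λ v → tabulate (halfAtPos v)) (allFin (nV G)))
      (List.concatMap-cong (λ v → external-word-tabulate v (deg G v) 0 (bits S v) (end-label S) (halfAtPos v) λ i →
        cong (when (bits S v i)) (cong₂ _,_ (half-end v i)
          (trans (cong (λ p → 6 ℕ.* p ℕ.+ 1) (half-pos v i)) (trans (ℕ.+-comm _ 1) (cong suc (sym (ℕ.+-identityʳ _))))))) (allFin (nV G))))))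

  count-externals : ∀ S e → count (isExternal e) (externals S) ≡ indicator (lookup S e)
  count-externals S e = present (allFin (nE G)) (Unique.allFin⁺ (nE G)) (∈-allFin e)
    where
    list : List (Fin (nE G)) → List (BEdge G)
    list = concatMap (λ e → when (lookup S e) (inj₁ e))
    single : ∀ b f → count (isExternal e) (when b (inj₁ f)) ≡ indicator (b ∧ does (f Fin.≟ e))
    single true f = ℕ.+-identityʳ _
    single false f = refl
    absent : ∀ xs → (∀ {x} → x ∈ xs → x ≢ e) → count (isExternal e) (list xs) ≡ 0
    absent [] ne = refl
    absent (x ∷ xs) ne = trans (count-++ (isExternal e) (when (lookup S x) (inj₁ x)) (list xs)) (cong₂ ℕ._+_
      (trans (single (lookup S x) x) (cong indicator (trans (cong (lookup S x ∧_) (dec-false (x Fin.≟ e) (ne (here refl))))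
        (tautology 1 (λ a → a ∧ false) (λ _ → false) refl (lookup S x))))) (absent xs (ne ∘ there)))
    present : ∀ xs → Unique xs → e ∈ xs → count (isExternal e) (list xs) ≡ indicator (lookup S e)
    present (x ∷ xs) (x∉ ∷ u) (here refl) = trans (count-++ (isExternal e) (when (lookup S x) (inj₁ x)) (list xs))
      (trans (cong₂ ℕ._+_ (trans (single (lookup S x) x) (cong indicator (trans (cong (lookup S x ∧_) (dec-true (x Fin.≟ e) refl))
        (tautology 1 (λ a → a ∧ true) (λ a → a) refl (lookup S x))))) (absent xs λ i p → All.lookup x∉ i (sym p))) (ℕ.+-identityʳ _))
    present (x ∷ xs) (x∉ ∷ u) (there i) = trans (count-++ (isExternal e) (when (lookup S x) (inj₁ x)) (list xs)) (cong₂ ℕ._+_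
      (trans (single (lookup S x) x) (cong indicator (trans (cong (lookup S x ∧_) (dec-false (x Fin.≟ e) (All.lookup x∉ i)))
        (tautology 1 (λ a → a ∧ false) (λ _ → false) refl (lookup S x))))) (present xs u i))

  weight-externals : ∀ S gs → (∀ e → count (isExternal e) gs ≡ 0) → weight (externals S ++ gs) ≡ subsetMono S
  weight-externals S gs none = vector-ext λ e → begin
    lookup (weight (externals S ++ gs)) e ≡⟨ weight-count e (externals S ++ gs) ⟩
    count (isExternal e) (externals S ++ gs) ≡⟨ count-++ (isExternal e) (externals S) gs ⟩
    count (isExternal e) (externals S) ℕ.+ count (isExternal e) gs ≡⟨ cong₂ ℕ._+_ (count-externals S e) (none e) ⟩
    indicator (lookup S e) ℕ.+ 0 ≡⟨ ℕ.+-identityʳ _ ⟩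
    indicator (lookup S e) ≡⟨ sym (lookup-subsetMono S e) ⟩
    lookup (subsetMono S) e ∎
    where open ≡-Reasoning

  inGadget : ∀ v → GadgetEdge G v → BEdge G
  inGadget v g = inj₂ (v , g)

  no-externals : ∀ e (gs : ∀ v → List (GadgetEdge G v)) vs → count (isExternal e) (concatMap (λ v → map (inGadget v) (gs v)) vs) ≡ 0
  no-externals e gs [] = refl
  no-externals e gs (v ∷ vs) = trans (count-++ (isExternal e) (map (inGadget v) (gs v)) _)
    (cong₂ ℕ._+_ (inside (gs v)) (no-externals e gs vs))
    where
    inside : ∀ l → count (isExternal e) (map (inGadget v) l) ≡ 0
    inside [] = refl
    inside (_ ∷ l) = inside l

  -- Both sides count mod 2 the labels at `v` taken by external edges, once by position along `σ`
  -- and once through the weight.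
  bits-parity : ∀ S v → xorFin (deg G v) (bits S v) ≡ oddℕ (subsetDeg G S v)
  bits-parity S v = sym (begin
    oddℕ (subsetDeg G S v) ≡⟨ cong oddℕ (trans (subsetDeg-weighted S v)
        (trans (cong (λ α → sumFinℕ (nE G) (λ e → lookup α e ℕ.* halfAt G e v))
          (trans (sym (weight-externals S [] λ _ → refl)) (cong weight (List.++-identityʳ (externals S)))))
        (sym (external-weight (λ e → halfAt G e v) (externals S))))) ⟩
    oddℕ (external (λ e → halfAt G e v) (externals S)) ≡⟨ sym (parity-external v (externals S)) ⟩
    parityAt v (verts (externals S)) ≡⟨ parityAt-↭ v (externals-↭ S) ⟩
    parityAt v (concatMap (λ v → external-word v (deg G v) 0 (bits S v)) (allFin (nV G)))
      ≡⟨ parityAt-concatMap v _ (λ w → xorFin (deg G w) (bits S w)) (λ w → parity-external-word w v (deg G w) 0 (bits S w)) ⟩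
    xorFin (deg G v) (bits S v) ∎)
    where open ≡-Reasoning

  -- pathSign v p and chordSign v c are junk (false) when there is no such edge.
  pathSign chordSign : Fin (nV G) → ℕ → Bool
  pathSign v p with p ℕ.<? 6 ℕ.* deg G v ℕ.∸ 1
  ... | yes lt = not (Δ v (inj₁ (fromℕ< lt)))
  ... | no _ = false
  chordSign v c with c ℕ.<? 2 ℕ.* deg G v
  ... | yes lt = not (Δ v (inj₂ (fromℕ< lt)))
  ... | no _ = false

  path : ∀ v p → suc p < 6 ℕ.* deg G v → Σ (Fin (6 ℕ.* deg G v ℕ.∸ 1)) λ j → (toℕ j ≡ p) × (not (Δ v (inj₁ j)) ≡ pathSign v p)
  path v p lt with p ℕ.<? 6 ℕ.* deg G v ℕ.∸ 1
  ... | yes lt′ = fromℕ< lt′ , Fin.toℕ-fromℕ< lt′ , refl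
  ... | no nlt = contradiction (ℕ.∸-monoˡ-≤ 1 lt) nlt

  chord : ∀ v c → c < 2 ℕ.* deg G v → Σ (Fin (2 ℕ.* deg G v)) λ j → (toℕ j ≡ c) × (not (Δ v (inj₂ j)) ≡ chordSign v c)
  chord v c lt with c ℕ.<? 2 ℕ.* deg G v
  ... | yes lt′ = fromℕ< lt′ , Fin.toℕ-fromℕ< lt′ , refl
  ... | no nlt = contradiction lt nlt

  gadgetReversed : ∀ v → List (GadgetEdge G v) → Bool
  gadgetReversed v = xorOver (λ g → not (Δ v g))

  -- s tells whether label k is already matched from below, e whether the block carries an external edge.
  blockSign : Fin (nV G) → ℕ → ℕ → Bool → Bool → Bool
  blockSign v k c false false = pathSign v k xor (pathSign v (2 ℕ.+ k) xor pathSign v (4 ℕ.+ k))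
  blockSign v k c false true = chordSign v c xor (pathSign v (3 ℕ.+ k) xor pathSign v (5 ℕ.+ k))
  blockSign v k c true false = pathSign v (1 ℕ.+ k) xor (pathSign v (3 ℕ.+ k) xor pathSign v (5 ℕ.+ k))
  blockSign v k c true true = pathSign v (2 ℕ.+ k) xor pathSign v (4 ℕ.+ k)

  -- `k` and `c` are the first label and the first chord of the current block, which has six labels
  -- and two chords; `s xor f zero` is the bit handed to the next block.
  gadgetSign : Fin (nV G) → ∀ d → ℕ → ℕ → (Fin d → Bool) → Bool → Bool
  gadgetSign v zero k c f s = false
  gadgetSign v (suc d) k c f s = blockSign v k c s (f zero) xor gadgetSign v d (6 ℕ.+ k) (2 ℕ.+ c) (f ∘ suc) (s xor f zero)

  -- The carried bit is a prefix sum of external bits and so stays affine; each block then falls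
  -- under `quadratic-binary`.
  gadgetSign-quadratic : ∀ v d k c (f : Fin d → Vec Bool (nE G) → Bool) (s : Vec Bool (nE G) → Bool) → (∀ i → Affine (f i)) → Affine s →
    Quadratic (λ S → gadgetSign v d k c (λ i → f i S) (s S))
  gadgetSign-quadratic v zero k c f s F A = quadratic-const false
  gadgetSign-quadratic v (suc d) k c f s F A = quadratic-xor (λ S → blockSign v k c (s S) (f zero S))
    (λ S → gadgetSign v d (6 ℕ.+ k) (2 ℕ.+ c) (λ i → f (suc i) S) (s S xor f zero S))
    (quadratic-binary (blockSign v k c) s (f zero) A (F zero))
    (gadgetSign-quadratic v d (6 ℕ.+ k) (2 ℕ.+ c) (f ∘ suc) (λ S → s S xor f zero S) (F ∘ suc) (affine-xor s (f zero) A (F zero)))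

  private
    path-word : ∀ {v : Fin (nV G)} {p n} {l l′ : List (Label G)} → n ≡ p →
      (v , suc p) ∷ l ≡ l′ → _≡_ {A = List (Label G)} ((v , n) ∷ (v , suc n) ∷ l) ((v , p) ∷ l′)
    path-word refl refl = refl

    path-word₂ : ∀ {v : Fin (nV G)} {p n} {l l′ : List (Label G)} → n ≡ p → l ≡ l′ →
      _≡_ {A = List (Label G)} ((v , n) ∷ (v , suc n) ∷ l) ((v , p) ∷ (v , suc p) ∷ l′)
    path-word₂ refl refl = refl

    chord-word : ∀ {v : Fin (nV G)} {k c n} {l l′ : List (Label G)} → k ≡ 3 ℕ.* c → n ≡ c → l ≡ l′ →
      _≡_ {A = List (Label G)} ((v , 3 ℕ.* n) ∷ (v , 3 ℕ.* n ℕ.+ 2) ∷ l) ((v , k) ∷ (v , 2 ℕ.+ k) ∷ l′)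
    chord-word {v} {c = c} {l = l} refl refl refl = cong (λ i → (v , 3 ℕ.* c) ∷ (v , i) ∷ l) (ℕ.+-comm (3 ℕ.* c) 2)

    room : ∀ k d D → k ℕ.+ 6 ℕ.* suc d ≡ 6 ℕ.* D → 6 ℕ.+ k ≤ 6 ℕ.* D
    room k d D e = subst (6 ℕ.+ k ≤_) e (ℕ.≤-trans (ℕ.≤-reflexive (ℕ.+-comm 6 k)) (ℕ.+-monoʳ-≤ k (ℕ.m≤m*n 6 (suc d))))

    next : ∀ k d D → k ℕ.+ 6 ℕ.* suc d ≡ 6 ℕ.* D → (6 ℕ.+ k) ℕ.+ 6 ℕ.* d ≡ 6 ℕ.* D
    next k d D e = trans (cong (ℕ._+ 6 ℕ.* d) (ℕ.+-comm 6 k)) (trans (ℕ.+-assoc k 6 (6 ℕ.* d)) (trans (cong (k ℕ.+_) (sym (ℕ.*-suc 6 d))) e))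

    next-chord : ∀ {k c} → k ≡ 3 ℕ.* c → 6 ℕ.+ k ≡ 3 ℕ.* (2 ℕ.+ c)
    next-chord {c = c} refl = sym (ℕ.*-distribˡ-+ 3 2 c)

    chord-room : ∀ {k c} D → k ≡ 3 ℕ.* c → 6 ℕ.+ k ≤ 6 ℕ.* D → c < 2 ℕ.* D
    chord-room {c = c} D refl le = ℕ.*-cancelˡ-< 3 c (2 ℕ.* D) (subst (3 ℕ.* c <_) (ℕ.*-assoc 3 2 D) (ℕ.≤-trans (ℕ.m≤n+m (suc (3 ℕ.* c)) 5) le))

    sign₃ : ∀ {a b c r a′ b′ c′ r′} → a ≡ a′ → b ≡ b′ → c ≡ c′ → r ≡ r′ → a xor (b xor (c xor r)) ≡ (a′ xor (b′ xor c′)) xor r′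
    sign₃ {a} {b} {c} {r} refl refl refl refl =
      tautology 4 (λ a b c r → a xor (b xor (c xor r))) (λ a b c r → (a xor (b xor c)) xor r) refl a b c r

    sign₂ : ∀ {a b r a′ b′ r′} → a ≡ a′ → b ≡ b′ → r ≡ r′ → a xor (b xor r) ≡ (a′ xor b′) xor r′
    sign₂ {a} {b} {r} refl refl refl = tautology 3 (λ a b r → a xor (b xor r)) (λ a b r → (a xor b) xor r) refl a b r

  -- When `s` holds, label `k` is the far end of an edge begun in the previous block. Prefixing it
  -- makes the word of the remaining edges literally equal to `gadget-word`, so blocks can be
  -- concatenated.
  Realised : ∀ v d → ℕ → ℕ → (Fin d → Bool) → Bool → Set
  Realised v d k c f s = Σ (List (GadgetEdge G v)) λ gs →
    (when s (v , k) ++ verts (map (inGadget v) gs) ≡ gadget-word v d k f) × (gadgetReversed v gs ≡ gadgetSign v d k c f s)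

  -- The premise `k ≡ 3 ℕ.* c` puts the left end of chord `c` at label `k`; the parity premise says
  -- that the carried bit has returned to `false` at the end of the gadget.
  realise : ∀ v d k c (f : Fin d → Bool) s → k ≡ 3 ℕ.* c → k ℕ.+ 6 ℕ.* d ≡ 6 ℕ.* deg G v → s xor xorFin d f ≡ false → Realised v d k c f s
  realise v zero k c f false k≡ bound par = [] , refl , refl
  realise v zero k c f true k≡ bound ()
  realise v (suc d) k c f false k≡ bound par with f zero
  ... | false with realise v d (6 ℕ.+ k) (2 ℕ.+ c) (f ∘ suc) false (next-chord k≡) (next k d (deg G v) bound) par
                 | path v k (ℕ.≤-trans (ℕ.m≤n+m (2 ℕ.+ k) 4) (room k d (deg G v) bound))
                 | path v (2 ℕ.+ k) (ℕ.≤-trans (ℕ.m≤n+m (4 ℕ.+ k) 2) (room k d (deg G v) bound))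
                 | path v (4 ℕ.+ k) (room k d (deg G v) bound)
  ...   | gs , w , r | j₀ , e₀ , s₀ | j₂ , e₂ , s₂ | j₄ , e₄ , s₄ =
    inj₁ j₀ ∷ inj₁ j₂ ∷ inj₁ j₄ ∷ gs , path-word₂ e₀ (path-word₂ e₂ (path-word₂ e₄ w)) , sign₃ s₀ s₂ s₄ r
  -- Parity forbids a carry out of the last block. In the next clause a further block exists for
  -- path edge `5 ℕ.+ k` to enter.
  realise v (suc zero) k c f false k≡ bound () | true
  realise v (suc (suc d)) k c f false k≡ bound par | true
    with realise v (suc d) (6 ℕ.+ k) (2 ℕ.+ c) (f ∘ suc) true (next-chord k≡) (next k (suc d) (deg G v) bound) par
       | chord v c (chord-room (deg G v) k≡ (room k (suc d) (deg G v) bound))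
       | path v (3 ℕ.+ k) (ℕ.≤-trans (ℕ.m≤n+m (5 ℕ.+ k) 1) (room k (suc d) (deg G v) bound))
       | path v (5 ℕ.+ k) (ℕ.≤-trans (ℕ.m≤n+m (7 ℕ.+ k) 5) (room (6 ℕ.+ k) d (deg G v) (next k (suc d) (deg G v) bound)))
  ... | gs , w , r | j₀ , e₀ , s₀ | j₃ , e₃ , s₃ | j₅ , e₅ , s₅ =
    inj₂ j₀ ∷ inj₁ j₃ ∷ inj₁ j₅ ∷ gs , chord-word k≡ e₀ (path-word₂ e₃ (path-word e₅ w)) , sign₃ s₀ s₃ s₅ r
  realise v (suc d) k c f true k≡ bound par with f zero
  ... | true with realise v d (6 ℕ.+ k) (2 ℕ.+ c) (f ∘ suc) false (next-chord k≡) (next k d (deg G v) bound)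
                    (trans (tautology 1 (λ a → a) (λ a → not (not a)) refl _) par)
                | path v (2 ℕ.+ k) (ℕ.≤-trans (ℕ.m≤n+m (4 ℕ.+ k) 2) (room k d (deg G v) bound))
                | path v (4 ℕ.+ k) (room k d (deg G v) bound)
  ...   | gs , w , r | j₂ , e₂ , s₂ | j₄ , e₄ , s₄ =
    inj₁ j₂ ∷ inj₁ j₄ ∷ gs , cong ((v , k) ∷_) (path-word₂ e₂ (path-word₂ e₄ w)) , sign₂ s₂ s₄ r
  realise v (suc zero) k c f true k≡ bound () | false
  realise v (suc (suc d)) k c f true k≡ bound par | false
    with realise v (suc d) (6 ℕ.+ k) (2 ℕ.+ c) (f ∘ suc) true (next-chord k≡) (next k (suc d) (deg G v) bound) par
       | path v (1 ℕ.+ k) (ℕ.≤-trans (ℕ.m≤n+m (3 ℕ.+ k) 3) (room k (suc d) (deg G v) bound))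
       | path v (3 ℕ.+ k) (ℕ.≤-trans (ℕ.m≤n+m (5 ℕ.+ k) 1) (room k (suc d) (deg G v) bound))
       | path v (5 ℕ.+ k) (ℕ.≤-trans (ℕ.m≤n+m (7 ℕ.+ k) 5) (room (6 ℕ.+ k) d (deg G v) (next k (suc d) (deg G v) bound)))
  ... | gs , w , r | j₁ , e₁ , s₁ | j₃ , e₃ , s₃ | j₅ , e₅ , s₅ =
    inj₁ j₁ ∷ inj₁ j₃ ∷ inj₁ j₅ ∷ gs , cong ((v , k) ∷_) (path-word₂ e₁ (path-word₂ e₃ (path-word e₅ w))) , sign₃ s₁ s₃ s₅ r

  -- The letters stand in the order in which `matching` lists them, external pairs by edge and then
  -- the gadgets, so `verts-matching` is an equality and no extra sign arises.
  word : Conditional (nE G) (Label G)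
  word = map (λ h → (λ S → lookup S (proj₁ h)) , bEnd G σ (inj₁ (proj₁ h)) (proj₂ h)) halfEdges ++
    concatMap (λ v → gadget-conditional v (deg G v) 0 (λ i S → bits S v i)) (allFin (nV G))

  gadgetsSign : Vec Bool (nE G) → Bool
  gadgetsSign S = xorOver (λ v → gadgetSign v (deg G v) 0 0 (bits S v) false) (allFin (nV G))

  -- The function Q: the sign exponent when no edge of G is reversed. It is defined and quadratic on
  -- all subsets, while its meaning as a sign of a matching belongs to the even ones.
  form : Vec Bool (nE G) → Bool
  form S = (inv (eval word S) xor gadgetsSign S) xor inv vertexList

  form-quadratic : Quadratic form
  form-quadratic = quadratic-xor (λ S → inv (eval word S) xor gadgetsSign S) (λ _ → inv vertexList)
    (quadratic-xor (λ S → inv (eval word S)) gadgetsSign (inv-quadratic earlier earlier-tournament word-affine) (signs (allFin (nV G))))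
    (quadratic-const (inv vertexList))
    where
    word-affine : AllAffine word
    word-affine = All.++⁺ (All.map⁺ (All.universal (λ h → affine-lookup (proj₁ h)) halfEdges)) (gadgets (allFin (nV G)))
      where
      gadgets : ∀ vs → AllAffine (concatMap (λ v → gadget-conditional v (deg G v) 0 (λ i S → bits S v i)) vs)
      gadgets [] = []
      gadgets (v ∷ vs) = All.++⁺ (gadget-affine v (deg G v) 0 (λ i S → bits S v i) λ i → affine-lookup (proj₁ (halfAtPos v i))) (gadgets vs)
    signs : ∀ vs → Quadratic (λ S → xorOver (λ v → gadgetSign v (deg G v) 0 0 (bits S v) false) vs)
    signs [] = quadratic-const false
    signs (v ∷ vs) = quadratic-xor (λ S → gadgetSign v (deg G v) 0 0 (bits S v) false)
      (λ S → xorOver (λ v → gadgetSign v (deg G v) 0 0 (bits S v) false) vs)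
      (gadgetSign-quadratic v (deg G v) 0 0 (λ i S → bits S v i) (λ _ → false) (λ i → affine-lookup (proj₁ (halfAtPos v i))) (affine-const false))
      (signs vs)

  externalReversal : Orientation G → Vec Bool (nE G)
  externalReversal D = Vec.tabulate λ e → not (D (inj₁ e))

  module _ {S : Vec Bool (nE G)} (even : Even S) where

    gadgetMatching : ∀ v → Realised v (deg G v) 0 0 (bits S v) false
    gadgetMatching v = realise v (deg G v) 0 0 (bits S v) false refl refl (trans (bits-parity S v) (even v))

    gadgetEdges : Fin (nV G) → List (BEdge G)
    gadgetEdges v = map (inGadget v) (proj₁ (gadgetMatching v))

    matching : List (BEdge G)
    matching = externals S ++ concatMap gadgetEdges (allFin (nV G))

    verts-gadgets : ∀ vs → verts (concatMap gadgetEdges vs) ≡ concatMap (λ v → gadget-word v (deg G v) 0 (bits S v)) vs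
    verts-gadgets [] = refl
    verts-gadgets (v ∷ vs) = trans (verts-++ (gadgetEdges v) (concatMap gadgetEdges vs))
      (cong₂ _++_ (proj₁ (proj₂ (gadgetMatching v))) (verts-gadgets vs))

    verts-matching : verts matching ≡ eval word S
    verts-matching = trans (verts-++ (externals S) (concatMap gadgetEdges (allFin (nV G)))) (trans
      (cong₂ _++_ (trans (verts-externals S) (sym (external-part halfEdges)))
        (trans (verts-gadgets (allFin (nV G))) (sym (trans
          (eval-concatMap (λ v → gadget-conditional v (deg G v) 0 (λ i S → bits S v i)) (allFin (nV G)) S)
          (List.concatMap-cong (λ v → eval-gadget v (deg G v) 0 (λ i S → bits S v i) S) (allFin (nV G)))))))
      (sym (eval-++ (map (λ h → (λ S → lookup S (proj₁ h)) , bEnd G σ (inj₁ (proj₁ h)) (proj₂ h)) halfEdges) _ S)))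
      where
      external-part : ∀ hs → eval (map (λ h → (λ S → lookup S (proj₁ h)) , bEnd G σ (inj₁ (proj₁ h)) (proj₂ h)) hs) S ≡ concatMap (end-label S) hs
      external-part [] = refl
      external-part (h ∷ hs) = cong (end-label S h ++_) (external-part hs)

    matching-covers : Covers matching
    matching-covers = ↭-trans (↭-reflexive (verts-++ (externals S) (concatMap gadgetEdges (allFin (nV G)))))
      (↭-trans (Perm.++⁺ (externals-↭ S) (↭-reflexive (verts-gadgets (allFin (nV G)))))
      (↭-trans (concatMap-++-↭ (λ v → external-word v (deg G v) 0 (bits S v)) (λ v → gadget-word v (deg G v) 0 (bits S v)) (allFin (nV G)))
      (↭-trans (concatMap-cong-↭ (λ v → ↭-trans (words-↭ v (deg G v) 0 (bits S v)) (↭-reflexive (range-upTo v (deg G v)))) (allFin (nV G)))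
      (↭-sym vertexList-↭))))

    matching-weight : weight matching ≡ subsetMono S
    matching-weight = weight-externals S (concatMap gadgetEdges (allFin (nV G)))
      λ e → no-externals e (proj₁ ∘ gadgetMatching) (allFin (nV G))

    reversed-++ : ∀ D es fs → reversed D (es ++ fs) ≡ reversed D es xor reversed D fs
    reversed-++ D [] fs = refl
    reversed-++ D (e ∷ es) fs = trans (cong (not (D e) xor_) (reversed-++ D es fs))
      (tautology 3 (λ a b c → a xor (b xor c)) (λ a b c → (a xor b) xor c) refl (not (D e)) (reversed D es) (reversed D fs))

    reversed-externals : ∀ D → reversed D (externals S) ≡ dot (externalReversal D) S
    reversed-externals D = trans (go (nE G) (λ i → i)) (sym (dot-tabulate (λ e → not (D (inj₁ e))) S))
      where
      go : ∀ k (h : Fin k → Fin (nE G)) → reversed D (concatMap (λ e → when (lookup S e) (inj₁ e)) (tabulate h))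
        ≡ xorFin k (λ i → lookup S (h i) ∧ not (D (inj₁ (h i))))
      go zero h = refl
      go (suc k) h with lookup S (h zero)
      ... | true = cong (not (D (inj₁ (h zero))) xor_) (go k (h ∘ suc))
      ... | false = go k (h ∘ suc)

    reversed-matching : ∀ {D} → Admissible G Δ D → reversed D matching ≡ dot (externalReversal D) S xor gadgetsSign S
    reversed-matching {D} adm = trans (reversed-++ D (externals S) (concatMap gadgetEdges (allFin (nV G))))
      (cong₂ _xor_ (reversed-externals D) (gadgets (allFin (nV G))))
      where
      inside : ∀ v gs → reversed D (map (inGadget v) gs) ≡ gadgetReversed v gs
      inside v [] = refl
      inside v (g ∷ gs) = cong₂ (λ a b → not a xor b) (adm v g) (inside v gs)
      gadgets : ∀ vs → reversed D (concatMap gadgetEdges vs) ≡ xorOver (λ v → gadgetSign v (deg G v) 0 0 (bits S v) false) vs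
      gadgets [] = refl
      gadgets (v ∷ vs) = trans (reversed-++ D (gadgetEdges v) (concatMap gadgetEdges vs))
        (cong₂ _xor_ (trans (inside v (proj₁ (gadgetMatching v))) (proj₂ (proj₂ (gadgetMatching v)))) (gadgets vs))

    projPf-even : ∀ {D} → Admissible G Δ D → projPf G σ N num D (subsetMono S) ≡ sg (form S xor dot (externalReversal D) S)
    projPf-even {D} adm = begin
      projPf G σ N num D (subsetMono S) ≡⟨ cong (projPf G σ N num D) (sym matching-weight) ⟩
      projPf G σ N num D (weight matching)
        ≡⟨ projPf-coefficient D matching matching-covers (λ es′ c w → cover-determined matching-covers c w) ⟩
      sg ((inv (verts matching) xor reversed D matching) xor inv vertexList)
        ≡⟨ cong₂ (λ l r → sg ((inv l xor r) xor inv vertexList)) verts-matching (reversed-matching adm) ⟩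
      sg ((inv (eval word S) xor (dot (externalReversal D) S xor gadgetsSign S)) xor inv vertexList)
        ≡⟨ cong sg (tautology 4 (λ i o g v → (i xor (o xor g)) xor v) (λ i o g v → ((i xor g) xor v) xor o) refl
             (inv (eval word S)) (dot (externalReversal D) S) (gadgetsSign S) (inv vertexList)) ⟩
      sg (form S xor dot (externalReversal D) S) ∎
      where open ≡-Reasoning

  projPf-support : ∀ D α → (∀ S → Even S → α ≢ subsetMono S) → projPf G σ N num D α ≡ 0ℚ
  projPf-support D α h = by (projPf G σ N num D α ℚ.≟ 0ℚ)
    where
    absurd : Σ (List (BEdge G)) (λ es → Covers es × (weight es ≡ α)) → ⊥
    absurd (es , c , w) = let S , w′ , even = cover-weight c in h S even (trans (sym w) w′)
    by : Dec (projPf G σ N num D α ≡ 0ℚ) → projPf G σ N num D α ≡ 0ℚ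
    by (yes z) = z
    by (no nz) = ⊥-elim (absurd (projPf-nonzero D α nz))

-- The even subgraph polynomial

sumListP-eval : ∀ {m} {A : Set} (f : A → Poly m) xs α → sumListP (map f xs) α ≡ listSum (λ x → f x α) xs
sumListP-eval f [] α = refl
sumListP-eval f (x ∷ xs) α = cong (f x α ℚ.+_) (sumListP-eval f xs α)

allSubsets-unique : ∀ m → Unique (allSubsets m)
allSubsets-unique zero = [] ∷ []
allSubsets-unique (suc m) = subst Unique (sym (concatMap-map _∷_ (true ∷ false ∷ []) (allSubsets m)))
  (Unique.cartesianProductWith⁺ _∷_ (λ { refl → refl , refl }) (((λ ()) ∷ []) ∷ [] ∷ []) (allSubsets-unique m))

subsetMono-injective : ∀ {m} {S S′ : Vec Bool m} → subsetMono S ≡ subsetMono S′ → S ≡ S′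
subsetMono-injective {S = []} {[]} e = refl
subsetMono-injective {S = a ∷ S} {b ∷ S′} e = cong₂ _∷_ (bit a b (Vec.∷-injectiveˡ e)) (subsetMono-injective (Vec.∷-injectiveʳ e))
  where
  bit : ∀ a b → indicator a ≡ indicator b → a ≡ b
  bit false false _ = refl
  bit true true _ = refl

-- An edge in both sets counts twice on the right and not at all on the left. This makes the even
-- sets a subspace.
odd-subset-sum : ∀ m (g : Fin m → ℕ) (S S′ : Vec Bool m) →
  oddℕ (sumFinℕ m (λ e → if lookup (S ⊕ S′) e then g e else 0)) ≡
  oddℕ (sumFinℕ m (λ e → if lookup S e then g e else 0)) xor oddℕ (sumFinℕ m (λ e → if lookup S′ e then g e else 0))
odd-subset-sum zero g [] [] = refl
odd-subset-sum (suc m) g (a ∷ S) (b ∷ S′) = trans (oddℕ-+ (if a xor b then g zero else 0) _)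
  (trans (cong₂ _xor_ (term a b (g zero)) (odd-subset-sum m (g ∘ suc) S S′))
  (trans (tautology 4 (λ p q r s → (p xor q) xor (r xor s)) (λ p q r s → (p xor r) xor (q xor s)) refl
    (oddℕ (if a then g zero else 0)) (oddℕ (if b then g zero else 0)) (rest S) (rest S′))
  (sym (cong₂ _xor_ (oddℕ-+ (if a then g zero else 0) _) (oddℕ-+ (if b then g zero else 0) _)))))
  where
  rest : Vec Bool m → Bool
  rest S = oddℕ (sumFinℕ m (λ e → if lookup S e then g (suc e) else 0))
  term : ∀ a b n → oddℕ (if a xor b then n else 0) ≡ oddℕ (if a then n else 0) xor oddℕ (if b then n else 0)
  term false b n = refl
  term true false n = tautology 1 (λ a → a) (λ a → a xor false) refl (oddℕ n)
  term true true n = sym (tautology 1 (λ a → a xor a) (λ _ → false) refl (oddℕ n))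

all-true : ∀ {A : Set} (p : A → Bool) xs → foldr _∧_ true (map p xs) ≡ true → ∀ {x} → x ∈ xs → p x ≡ true
all-true p (x ∷ xs) h (here refl) = ∧-trueˡ h
all-true p (x ∷ xs) h (there i) = all-true p xs (∧-trueʳ {p x} h) i

true-all : ∀ {A : Set} (p : A → Bool) xs → (∀ x → p x ≡ true) → foldr _∧_ true (map p xs) ≡ true
true-all p [] h = refl
true-all p (x ∷ xs) h = cong₂ _∧_ (h x) (true-all p xs h)

module _ (G : Graph) where

  isEven-sound : ∀ S → isEven G S ≡ true → ∀ v → oddℕ (subsetDeg G S v) ≡ false
  isEven-sound S h v = trans (tautology 1 (λ a → a) (λ a → not (not a)) refl _)
    (cong not (trans (sym (%2-odd (subsetDeg G S v))) (all-true (λ v → (subsetDeg G S v % 2) ≡ᵇ 0) (allFin (nV G)) h (∈-allFin v))))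

  isEven-complete : ∀ S → (∀ v → oddℕ (subsetDeg G S v) ≡ false) → isEven G S ≡ true
  isEven-complete S h = true-all (λ v → (subsetDeg G S v % 2) ≡ᵇ 0) (allFin (nV G)) λ v → trans (%2-odd (subsetDeg G S v)) (cong not (h v))

  even-subspace : Subspace (isEven G)
  even-subspace = record
    { has-𝟎 = isEven-complete 𝟎 λ v → cong oddℕ (sumFinℕ-zero (nE G) λ e → cong (if_then halfAt G e v else 0) (Vec.lookup-replicate e false))
    ; closed = λ {x} {y} p q → isEven-complete (x ⊕ y) λ v → trans (odd-subset-sum (nE G) (λ e → halfAt G e v) x y)
        (cong₂ _xor_ (isEven-sound x p v) (isEven-sound y q v)) }

  private
    summand : Vec Bool (nE G) → Poly (nE G)
    summand S = if isEven G S then monoP (subsetMono S) else 0P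

  evenPoly-even : ∀ S → isEven G S ≡ true → evenPoly G (subsetMono S) ≡ 1ℚ
  evenPoly-even S even = trans (sumListP-eval summand (allSubsets (nE G)) (subsetMono S))
    (trans (listSum-single (λ S′ → summand S′ (subsetMono S)) (allSubsets-unique (nE G)) (∈-allSubsets S) others) here-value)
    where
    here-value : summand S (subsetMono S) ≡ 1ℚ
    here-value rewrite even = monoP-hit (subsetMono S)
    others : ∀ {S′} → S′ ∈ allSubsets (nE G) → S′ ≢ S → summand S′ (subsetMono S) ≡ 0ℚ
    others {S′} _ ne with isEven G S′
    ... | true = monoP-miss (ne ∘ subsetMono-injective)
    ... | false = refl

  evenPoly-support : ∀ α → (∀ S → isEven G S ≡ true → α ≢ subsetMono S) → evenPoly G α ≡ 0ℚ
  evenPoly-support α h = trans (sumListP-eval summand (allSubsets (nE G)) α) (listSum-zero _ (allSubsets (nE G)) λ {S} _ → zero-at S)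
    where
    zero-at : ∀ S → summand S α ≡ 0ℚ
    zero-at S with isEven G S in e
    ... | true = monoP-miss (λ p → h S e (sym p))
    ... | false = refl

  -- Polynomials are compared one coefficient at a time; this separates the monomials of even sets
  -- from those where both sides vanish.
  even-monomial? : ∀ α → (Σ (Vec Bool (nE G)) λ S → (isEven G S ≡ true) × (α ≡ subsetMono S)) ⊎ (∀ S → isEven G S ≡ true → α ≢ subsetMono S)
  even-monomial? α with search (λ S → isEven G S ∧ does (Vec.≡-dec ℕ._≟_ α (subsetMono S)))
  ... | inj₁ (S , e) = inj₁ (S , ∧-trueˡ e , Vec-sound (∧-trueʳ {isEven G S} e))
    where
    Vec-sound : does (Vec.≡-dec ℕ._≟_ α (subsetMono S)) ≡ true → α ≡ subsetMono S
    Vec-sound e with Vec.≡-dec ℕ._≟_ α (subsetMono S)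
    ... | yes p = p
  ... | inj₂ none = inj₂ λ S e p → false≢true (none S) (cong₂ _∧_ e (dec-true (Vec.≡-dec ℕ._≟_ α (subsetMono S)) p))

-- The minimal number of orientations

mainTheorem1 : (G : Graph) (σ : HalfEdgeOrdering G) (Δ : GadgetOrientations G)
    (N : ℕ) (num : Fin N ↔ BVert G) →
    Σ ℕ (λ t → IsMinRepSize G σ Δ N num (4 ^ t))
mainTheorem1 G σ Δ N num = t , (orientation ∘ characters V D , (λ _ _ _ → refl) , distinct , coefficients V D , representation) , minimal
  where
  open Realisation G σ Δ N num
  V : Subspace (isEven G)
  V = even-subspace G
  D : Decomposition (isEven G) form (allSubsets (nE G))
  D = decompose V form-quadratic (allSubsets (nE G))
  t : ℕ
  t = Decomposition.t D
  orientation : Vec Bool (nE G) → Orientation G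
  -- Negated because `externalReversal` marks the edges whose orientation bit is `false`.
  orientation o (inj₁ e) = not (lookup o e)
  orientation o (inj₂ (v , g)) = Δ v g
  reversal-orientation : ∀ o → externalReversal (orientation o) ≡ o
  reversal-orientation o = trans (Vec.tabulate-cong λ e → tautology 1 (λ a → not (not a)) (λ a → a) refl (lookup o e)) (Vec.tabulate∘lookup o)
  distinct : ∀ i j → i ≢ j → ¬ (∀ e → orientation (characters V D i) e ≡ orientation (characters V D j) e)
  distinct i j i≢j h = i≢j (characters-injective V D i j
    (trans (sym (reversal-orientation _)) (trans (Vec.tabulate-cong λ e → cong not (h (inj₁ e))) (reversal-orientation _))))
  value : ∀ {k} (Ds : Fin k → Orientation G) (c : Fin k → ℚ) → (∀ i → Admissible G Δ (Ds i)) → ∀ {S} → isEven G S ≡ true →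
    sumFinP k (λ i → c i ·P projPf G σ N num (Ds i)) (subsetMono S) ≡ sumF k (λ i → c i ℚ.* sg (form S xor dot (externalReversal (Ds i)) S))
  value {k} Ds c adm {S} even = trans (sumFinP-eval k (λ i → c i ·P projPf G σ N num (Ds i)) (subsetMono S))
    (sumF-cong k λ i → cong (c i ℚ.*_) (projPf-even {S} (isEven-sound G S even) {Ds i} (adm i)))
  representation : evenPoly G ≈P sumFinP (4 ^ t) (λ i → coefficients V D i ·P projPf G σ N num (orientation (characters V D i)))
  representation α = by (even-monomial? G α)
    where
    by : (Σ (Vec Bool (nE G)) λ S → (isEven G S ≡ true) × (α ≡ subsetMono S)) ⊎ (∀ S → isEven G S ≡ true → α ≢ subsetMono S) →
      evenPoly G α ≡ sumFinP (4 ^ t) (λ i → coefficients V D i ·P projPf G σ N num (orientation (characters V D i))) α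
    by (inj₁ (S , even , refl)) = trans (evenPoly-even G S even) (sym (trans
      (value (orientation ∘ characters V D) (coefficients V D) (λ _ _ _ → refl) {S} even)
      (trans (sumF-cong (4 ^ t) λ i → cong (λ o → coefficients V D i ℚ.* sg (form S xor dot o S)) (reversal-orientation (characters V D i)))
        (fourier-expansion V D S even))))
    by (inj₂ none) = trans (evenPoly-support G α none) (sym (trans
      (sumFinP-eval (4 ^ t) (λ i → coefficients V D i ·P projPf G σ N num (orientation (characters V D i))) α)
      (sumF-zero (4 ^ t) λ i → trans (cong (coefficients V D i ℚ.*_)
        (projPf-support (orientation (characters V D i)) α λ S even → none S (isEven-complete G S even))) (ℚ.*-zeroʳ (coefficients V D i)))))
  minimal : ∀ k → Representable G σ Δ N num k → 4 ^ t ≤ k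
  -- The coefficients at even monomials already force the bound: there the polynomial identity is an
  -- expansion of the constant 1.
  minimal k (Ds , adm , _ , c , eq) = fourier-minimality V D (externalReversal ∘ Ds) c λ S even →
    trans (sym (value Ds c adm {S} even)) (trans (sym (eq (subsetMono S))) (evenPoly-even G S even))
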